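{- For every integer $n\ge 0$, \[ |\mathrm{OSASM}(2n+1)| = 2^{2n}\,X^{\mathrm O}_{2n+2}(1,-1). \]
   Context: An alternating sign matrix (ASM) is a square matrix with entries in $\{ -1,0,1\}$ such that in each row and each column the nonzero entries alternate in sign and sum to $1$. A diagonally symmetric ASM (DSASM) is a symmetric ASM. An off-diagonally symmetric ASM (OSASM) of even order is a DSASM all of whose diagonal entries are $0$; an OSASM of odd order is a DSASM with exactly one nonzero diagonal entry. $\mathrm{OSASM}(m)$ denotes the set of OSASMs of order $m$. For an $m\times m$ DSASM $A$, let $R(A)=\sum_{1\le i<j\le m}|A_{i,j}|$ (number of nonzero strictly upper triangular entries) and $T(A)$ the column index of the unique $1$ in the first row of $A$. The OSASM generating function is $X^{\mathrm O}_m(r,t)=\sum_{A\in\mathrm{OSASM}(m)} r^{R(A)}t^{T(A)}$. -}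

module Defs where

open import Data.Nat as ℕ using (ℕ; zero; suc; _%_)
open import Data.Integer as ℤ using (ℤ; +_; -_; _+_; _*_; _^_; ∣_∣)
import Data.Integer.Properties as ℤP
import Data.Nat.Properties as ℕP
open import Data.Fin using (Fin; zero; suc; toℕ)
open import Data.Fin.Properties using (all?)
open import Data.List as List using (List; []; _∷_; map; filter; length; allFin; concatMap; foldr)
open import Data.Vec.Functional as VF using (Vector)
open import Data.Product using (_×_; _,_)
open import Data.Sum using (_⊎_)
open import Data.Unit using (⊤; tt)
open import Relation.Nullary using (Dec; yes; no; ¬_)
open import Relation.Nullary.Decidable using (_×-dec_; _⊎-dec_; ¬?)
open import Relation.Binary.PropositionalEquality using (_≡_; _≢_)

sumℤ : List ℤ → ℤ
sumℤ = foldr _+_ (+ 0)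

sumℕ : List ℕ → ℕ
sumℕ = foldr ℕ._+_ 0

-- Square m×m integer matrices, indices 0..m-1 (the paper's i is our i-1).
Matrix : ℕ → Set
Matrix m = Fin m → Fin m → ℤ

row : ∀ {m} → Matrix m → Fin m → List ℤ
row {m} A i = map (A i) (allFin m)

col : ∀ {m} → Matrix m → Fin m → List ℤ
col {m} A j = map (λ i → A i j) (allFin m)

nonzeros : List ℤ → List ℤ
nonzeros = filter (λ x → ¬? (x ℤ.≟ + 0))

-- consecutive entries alternate in sign (for entries in {-1,1}: y = -x)
Alternating : List ℤ → Set
Alternating [] = ⊤
Alternating (x ∷ []) = ⊤
Alternating (x ∷ y ∷ xs) = (y ≡ - x) × Alternating (y ∷ xs)

alternating? : (xs : List ℤ) → Dec (Alternating xs)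
alternating? [] = yes tt
alternating? (x ∷ []) = yes tt
alternating? (x ∷ y ∷ xs) = (y ℤ.≟ - x) ×-dec alternating? (y ∷ xs)

GoodLine : List ℤ → Set
GoodLine l = Alternating (nonzeros l) × (sumℤ (nonzeros l) ≡ + 1)

goodLine? : (l : List ℤ) → Dec (GoodLine l)
goodLine? l = alternating? (nonzeros l) ×-dec (sumℤ (nonzeros l) ℤ.≟ + 1)

Entry : ℤ → Set
Entry x = (x ≡ - (+ 1)) ⊎ ((x ≡ + 0) ⊎ (x ≡ + 1))

entry? : (x : ℤ) → Dec (Entry x)
entry? x = (x ℤ.≟ - (+ 1)) ⊎-dec ((x ℤ.≟ + 0) ⊎-dec (x ℤ.≟ + 1))

IsASM : ∀ {m} → Matrix m → Set
IsASM A = (∀ i j → Entry (A i j)) × ((∀ i → GoodLine (row A i)) × (∀ j → GoodLine (col A j)))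

isASM? : ∀ {m} (A : Matrix m) → Dec (IsASM A)
isASM? A = all? (λ i → all? (λ j → entry? (A i j)))
           ×-dec (all? (λ i → goodLine? (row A i)) ×-dec all? (λ j → goodLine? (col A j)))

Symmetric : ∀ {m} → Matrix m → Set
Symmetric A = ∀ i j → A i j ≡ A j i

symmetric? : ∀ {m} (A : Matrix m) → Dec (Symmetric A)
symmetric? A = all? (λ i → all? (λ j → A i j ℤ.≟ A j i))

IsDSASM : ∀ {m} → Matrix m → Set
IsDSASM A = IsASM A × Symmetric A

isDSASM? : ∀ {m} (A : Matrix m) → Dec (IsDSASM A)
isDSASM? A = isASM? A ×-dec symmetric? A

diagonal : ∀ {m} → Matrix m → List ℤ
diagonal {m} A = map (λ i → A i i) (allFin m)

DiagCond : ∀ {m} → Matrix m → Set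
DiagCond {m} A with m % 2
... | zero  = ∀ i → A i i ≡ + 0
... | suc _ = length (nonzeros (diagonal A)) ≡ 1

diagCond? : ∀ {m} (A : Matrix m) → Dec (DiagCond A)
diagCond? {m} A with m % 2
... | zero  = all? (λ i → A i i ℤ.≟ + 0)
... | suc _ = length (nonzeros (diagonal A)) ℕ.≟ 1

IsOSASM : ∀ {m} → Matrix m → Set
IsOSASM A = IsDSASM A × DiagCond A

isOSASM? : ∀ {m} (A : Matrix m) → Dec (IsOSASM A)
isOSASM? A = isDSASM? A ×-dec diagCond? A

allFuns : ∀ {a} {A : Set a} (n : ℕ) → List A → List (Vector A n)
allFuns zero xs = (λ ()) ∷ []
allFuns (suc n) xs = concatMap (λ x → map (λ f → x VF.∷ f) (allFuns n xs)) xs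

allMatrices : (m : ℕ) → List (Matrix m)
allMatrices m = allFuns m (allFuns m (- (+ 1) ∷ + 0 ∷ + 1 ∷ []))

-- the finite set OSASM(m), as a duplicate-free list
OSASM : (m : ℕ) → List (Matrix m)
OSASM m = filter isOSASM? (allMatrices m)

-- R(A) = number of nonzero strictly upper triangular entries = Σ_{i<j} |A i j|
R : ∀ {m} → Matrix m → ℕ
R {m} A = sumℕ (map (λ i → sumℕ (map (λ j → if< i j) (allFin m))) (allFin m))
  where
  if< : Fin m → Fin m → ℕ
  if< i j with toℕ i ℕ.<? toℕ j
  ... | yes _ = ∣ A i j ∣
  ... | no _  = 0

-- T(A) = 1-based column index of the (first, for ASMs unique) 1 in the first row
-- (defined for m ≥ 1; the fallback 0 never occurs for ASMs)
firstOne : ∀ {k} → Vector ℤ k → ℕ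
firstOne {zero} v = 0
firstOne {suc k} v with v zero ℤ.≟ + 1
... | yes _ = 1
... | no _  = suc (firstOne (VF.tail v))

T : ∀ {m} → Matrix (suc m) → ℕ
T A = firstOne (A zero)

-- X^O_{m}(r,t) = Σ_{A ∈ OSASM(m)} r^{R(A)} t^{T(A)}, for order m = suc k ≥ 1
XO : (k : ℕ) → ℤ → ℤ → ℤ
XO k r t = sumℤ (map (λ A → (r ^ R A) * (t ^ T A)) (OSASM (suc k)))

{-# OPTIONS --safe #-}
module Submission where

-- Cutting a symmetric matrix along its diagonal turns OSASMs into states of the six-vertex model on
-- a triangle.  Let every line carry a spectral parameter (p : q), with weights at Δ = 1/2, and let
-- Z₀ and Z₁ be the partition functions with no, respectively one, nonzero diagonal entry; both are
-- symmetric in the lines by the Yang–Baxter and reflection equations.  For an odd number of lines u,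
-- and an extra line ω at (1 : -1),
--
--   ∏ (p + q) Z₀(u, ω)  =  ∏ p Z₁(u) + ∏ q Z₁(ū),      where ū exchanges p and q.
--
-- Both sides are binary forms of the same degree in the first line.  Where a or b vanishes between
-- the first line and another one, the vertex rules freeze these two lines and the identity reduces
-- to the one with two lines fewer; this gives more zeros of the difference than its degree allows.
-- At p = q = 1 the row of ω contributes (-1)^T, and the identity becomes 2^(2n+1) X = 2 |OSASM|.
-- This point is reached from lines in general position, for which the zeros are distinct, by
-- congruences modulo every s.

open import Defs

-- Everything stays in ℤ. No square roots occur: the two bends of a vertex weigh 1 and `N u * N w`,
-- and only their product a² - ab + b² matters. No fractions occur: lines are points of a projective
-- line and the weights are homogeneous, so the zeros of a and b have integer coordinates. Why
-- freezing respects the identity: (p + q)(p' + q') = pp' + 3b = qq' + 3a, while against ω the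
-- weights are a = q and b = -p. Where b = 0, the two frozen lines put pp' (from p + q) times qq'
-- (from ω) on the left. On the right, the first term has pp' as prefactor and qq' from zero
-- diagonal entries, and the second has these exchanged. Their weights against the remaining lines
-- agree in all three terms. The exchange relations only hold after multiplication by an R-matrix
-- entry α, so reordering needs α ≠ 0. Interpolation needs distinct zeros, which fails when all
-- lines are equal. The nodes (1 + 3j : 1) satisfy both demands, and they are congruent to (1 : 1)
-- when j is a multiple of s.

module SixVertex where

  open import Algebra.Bundles using (AbelianGroup)
  open import Data.Bool using (Bool; true; false; not; _∧_)
  open import Data.Fin using (Fin; zero; suc)
  open import Data.Integer using (ℤ; +_; -[1+_]; _+_; _*_; -_; _-_; _^_; ∣_∣; _≟_; ≢-nonZero)
  import Data.Integer.Properties as ℤP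
  import Data.Integer.Tactic.RingSolver as ℤSolver
  open import Data.List using (List; []; _∷_; _++_; _∷ʳ_; length; replicate; map; filter; concatMap; tabulate; allFin; applyUpTo)
  import Data.List.Properties as ListP
  open import Data.List.Membership.Propositional using (_∈_)
  open import Data.List.Membership.Propositional.Properties using (∈-∃++)
  open import Data.List.Relation.Binary.Permutation.Propositional using (_↭_; prep; swap; ↭-sym; ↭-trans; ↭⇒↭ₛ)
  import Data.List.Relation.Binary.Permutation.Propositional.Properties as Perm
  import Data.List.Relation.Binary.Permutation.Setoid.Properties as PermS
  open import Data.List.Relation.Binary.Pointwise as Pointwise using (Pointwise; []; _∷_)
  open import Data.List.Relation.Unary.All as All using (All; []; _∷_)
  import Data.List.Relation.Unary.All.Properties as AllP
  open import Data.List.Relation.Unary.AllPairs as AllPairs using (AllPairs; []; _∷_)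
  import Data.List.Relation.Unary.AllPairs.Properties as AllPairsP
  open import Data.List.Relation.Unary.Unique.Propositional using (Unique)
  open import Data.Nat as ℕ using (ℕ; zero; suc; s≤s; _%_)
  import Data.Nat.DivMod as DivMod
  import Data.Nat.Properties as ℕP
  open import Data.Product using (∃; ∃₂; _×_; _,_; proj₁; proj₂)
  open import Data.Sum using (_⊎_; inj₁; inj₂)
  open import Data.Unit using (tt)
  open import Data.Vec as Vec using (Vec; []; _∷_; lookup; toList)
  import Data.Vec.Functional as VF
  open VF using (Vector)
  import Data.Vec.Properties as VecP
  open import Function using (_∘_; id)
  open import Relation.Binary.PropositionalEquality
  open import Relation.Nullary using (Dec; yes; no; does; ¬_; contradiction)
  open import Relation.Nullary.Decidable using (dec-true; dec-false; ¬?)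
  open import Algebra.Properties.Group (AbelianGroup.group ℤP.+-0-abelianGroup) using (∙-cancelˡ)
  open import Tactic.RingSolver.NonReflective ℤSolver.ring using (Expr; Κ; _⊕_; _⊗_; ⊝_; _⊜_; solve)
  open ≡-Reasoning

  -- Weights and state sums

  -- A line (x , y) stands for the spectral parameter (p : q) = (x + 3y : x).  In these coordinates
  -- a = (pp' + pq' + qp') / 3, b = (qq' + pq' + qp') / 3, N = (p² + pq + q²) / 3 and
  -- a² - ab + b² = N N', the six-vertex weights at Δ = 1/2; all of them are 1 at (1 , 0).
  Line : Set
  Line = ℤ × ℤ

  -- In the parameters, `α` is (pp' + qp' + qq') / 3 and `δ` is (qp' - pq') / 3. They satisfy α² -
  -- αδ + δ² = N N', the same relation as `a` and `b`, so the R-matrix built from them belongs to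
  -- the same Δ.
  a b α δ : Line → Line → ℤ
  a (x , y) (x' , y') = x * x' + + 2 * (x * y' + y * x') + + 3 * (y * y')
  b (x , y) (x' , y') = x * x' + (x * y' + y * x')
  α (x , y) (x' , y') = x * x' + (+ 2 * (x * y') + y * x') + + 3 * (y * y')
  δ (x , y) (x' , y') = x * y' - y * x'

  N : Line → ℤ
  N (x , y) = x * x + + 3 * (x * y) + + 3 * (y * y)

  -- A vertex has the running row sum h and the running column sum v as its incoming edges; the matrix
  -- entry is 0 if the lines go straight on and ±1 if both sums are flipped.
  straight bend : Line → Line → Bool → Bool → ℤ
  straight u w false false = b u w
  straight u w false true  = a u w
  straight u w true  false = a u w
  straight u w true  true  = b u w
  bend u w false false = + 1
  bend u w false true  = + 0
  bend u w true  false = + 0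
  bend u w true  true  = N u * N w

  end : Bool → ℤ → ℤ
  end false z = + 0
  end true  z = z

  -- One row of the matrix: the final row sum must be 1, and k receives the outgoing column sums.
  transfer : Line → Bool → List Line → List Bool → (List Bool → ℤ) → ℤ
  transfer u h [] [] k = end h (k [])
  transfer u h (w ∷ us) (v ∷ vs) k =
      straight u w h v * transfer u h us vs (k ∘ (v ∷_))
    + bend u w h v * transfer u (not h) us vs (k ∘ (not v ∷_))
  transfer u h _ _ k = + 0

  -- State sums over symmetric triangles with all diagonal entries 0 (F₀, weight c u each), or with
  -- exactly one nonzero diagonal entry (F₁).  By symmetry the row of a line starts, at the diagonal,
  -- with the column sum accumulated above it.
  F₀ : (Line → ℤ) → List Line → List Bool → ℤ
  F₀ c [] [] = + 1
  F₀ c (u ∷ us) (v ∷ vs) = c u * transfer u v us vs (F₀ c us)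
  F₀ c _ _ = + 0

  diag : Line → Bool → ℤ
  diag u false = + 1
  diag u true  = N u

  F₁ : List Line → List Bool → ℤ
  F₁ (u ∷ us) (v ∷ vs) =
    proj₁ u * transfer u v us vs (F₁ us) + diag u v * transfer u (not v) us vs (F₀ proj₁ us)
  F₁ _ _ = + 0

  transfer-cong : ∀ u h us vs {f g : List Bool → ℤ} → (∀ t → f t ≡ g t) → transfer u h us vs f ≡ transfer u h us vs g
  transfer-cong u false [] [] f≗g = refl
  transfer-cong u true  [] [] f≗g = f≗g []
  transfer-cong u h [] (v ∷ vs) f≗g = refl
  transfer-cong u h (w ∷ us) [] f≗g = refl
  transfer-cong u h (w ∷ us) (v ∷ vs) f≗g =
    cong₂ (λ p q → straight u w h v * p + bend u w h v * q)
      (transfer-cong u h us vs (λ t → f≗g (v ∷ t))) (transfer-cong u (not h) us vs (λ t → f≗g (not v ∷ t)))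

  private
    0-sum : ∀ c d e → c * + 0 + d * + 0 ≡ e * + 0
    0-sum = ℤSolver.solve-∀

    linear-0 : ∀ c d → + 0 ≡ c * + 0 + d * + 0
    linear-0 = ℤSolver.solve-∀

    linear-step : ∀ s e c d p q p' q' →
      s * (c * p + d * q) + e * (c * p' + d * q') ≡ c * (s * p + e * p') + d * (s * q + e * q')
    linear-step = ℤSolver.solve-∀

  transfer-linear : ∀ u h us vs c d (f g : List Bool → ℤ) →
    transfer u h us vs (λ t → c * f t + d * g t) ≡ c * transfer u h us vs f + d * transfer u h us vs g
  transfer-linear u false [] [] c d f g = linear-0 c d
  transfer-linear u true  [] [] c d f g = refl
  transfer-linear u h [] (v ∷ vs) c d f g = linear-0 c d
  transfer-linear u h (w ∷ us) [] c d f g = linear-0 c d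
  transfer-linear u h (w ∷ us) (v ∷ vs) c d f g = trans
    (cong₂ (λ p q → straight u w h v * p + bend u w h v * q)
      (transfer-linear u h us vs c d (f ∘ (v ∷_)) (g ∘ (v ∷_)))
      (transfer-linear u (not h) us vs c d (f ∘ (not v ∷_)) (g ∘ (not v ∷_))))
    (linear-step (straight u w h v) (bend u w h v) c d _ _ _ _)

  private
    drop-0 : ∀ c p q → c * p + + 0 * q ≡ c * p
    drop-0 = ℤSolver.solve-∀

  transfer-scale : ∀ u h us vs c (f : List Bool → ℤ) → transfer u h us vs (λ t → c * f t) ≡ c * transfer u h us vs f
  transfer-scale u h us vs c f = begin
    transfer u h us vs (λ t → c * f t)                   ≡⟨ transfer-cong u h us vs (λ t → sym (drop-0 c (f t) (f t))) ⟩
    transfer u h us vs (λ t → c * f t + + 0 * f t)       ≡⟨ transfer-linear u h us vs c (+ 0) f f ⟩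
    c * transfer u h us vs f + + 0 * transfer u h us vs f     ≡⟨ drop-0 c _ (transfer u h us vs f) ⟩
    c * transfer u h us vs f                             ∎

  -- The R-matrix, for lines u and w in adjacent positions.
  scatter : Line → Line → Bool → Bool → (Bool → Bool → ℤ) → ℤ
  scatter u w false false f = α u w * f false false
  scatter u w false true  f = N u * f false true + δ u w * f true false
  scatter u w true  false f = N w * f true false + δ u w * f false true
  scatter u w true  true  f = α u w * f true true

  scatter-cong : ∀ u w h h' {f g : Bool → Bool → ℤ} → (∀ i j → f i j ≡ g i j) → scatter u w h h' f ≡ scatter u w h h' g
  scatter-cong u w false false f≗g = cong (α u w *_) (f≗g false false)
  scatter-cong u w false true  f≗g = cong₂ (λ p q → N u * p + δ u w * q) (f≗g false true) (f≗g true false)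
  scatter-cong u w true  false f≗g = cong₂ (λ p q → N w * p + δ u w * q) (f≗g true false) (f≗g false true)
  scatter-cong u w true  true  f≗g = cong (α u w *_) (f≗g true true)

  scatter-linear : ∀ u w h h' c d (f g : Bool → Bool → ℤ) →
    scatter u w h h' (λ i j → c * f i j + d * g i j) ≡ c * scatter u w h h' f + d * scatter u w h h' g
  scatter-linear u w h h' c d f g = go h h'
    where
    one : ∀ r c d p q → r * (c * p + d * q) ≡ c * (r * p) + d * (r * q)
    one = ℤSolver.solve-∀
    go : ∀ h h' → scatter u w h h' (λ i j → c * f i j + d * g i j) ≡ c * scatter u w h h' f + d * scatter u w h h' g
    go false false = one (α u w) c d _ _
    go false true  = linear-step (N u) (δ u w) c d _ _ _ _
    go true  false = linear-step (N w) (δ u w) c d _ _ _ _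
    go true  true  = one (α u w) c d _ _

  scatter-0 : ∀ u w h h' → scatter u w h h' (λ _ _ → + 0) ≡ + 0
  scatter-0 u w h h' = scatter-linear u w h h' (+ 0) (+ 0) (λ _ _ → + 0) (λ _ _ → + 0)

  -- Local relations: the Yang-Baxter and reflection equations.

  -- A column `z` with incoming sum `v` passes the row of `u` and then the row of `w`; `T` receives
  -- the two outgoing row sums and the outgoing column sum.
  cross₂ : Line → Line → Line → Bool → Bool → Bool → (Bool → Bool → Bool → ℤ) → ℤ
  cross₂ u w z h h' v T =
      straight u z h v * (straight w z h' v * T h h' v + bend w z h' v * T h (not h') (not v))
    + bend u z h v * (straight w z h' (not v) * T (not h) h' (not v)
                      + bend w z h' (not v) * T (not h) (not h') (not (not v)))

  -- The corner at the diagonal formed by two consecutive lines: the two diagonal entries and the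
  -- vertex between them. The column sum of `w` leaving that vertex becomes the initial row sum of
  -- `w`.
  cap₀ : ℤ → ℤ → Line → Line → (Bool → Bool → ℤ) → Bool → Bool → ℤ
  cap₀ c c' u w T i j =
    c * (straight u w i j * (c' * T i j) + bend u w i j * (c' * T (not i) (not j)))

  -- `T` continues when the nonzero diagonal entry is still to come, `S` when it lies on `u` or on
  -- `w`.
  cap₁ : Line → Line → (Bool → Bool → ℤ) → (Bool → Bool → ℤ) → Bool → Bool → ℤ
  cap₁ u w T S i j =
      proj₁ u * (straight u w i j * (proj₁ w * T i j + diag w j * S i (not j))
                 + bend u w i j * (proj₁ w * T (not i) (not j) + diag w (not j) * S (not i) (not (not j))))
    + diag u i * (straight u w (not i) j * (proj₁ w * S (not i) j)
                  + bend u w (not i) j * (proj₁ w * S (not (not i)) (not j)))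

  -- Syntactic copies of the weights, as input for the ring solver.
  module _ {k : ℕ} where
    private
      E = Expr ℤ k
      L = E × E

    aᴱ bᴱ αᴱ δᴱ : L → L → E
    aᴱ (x , y) (x' , y') = x ⊗ x' ⊕ Κ (+ 2) ⊗ (x ⊗ y' ⊕ y ⊗ x') ⊕ Κ (+ 3) ⊗ (y ⊗ y')
    bᴱ (x , y) (x' , y') = x ⊗ x' ⊕ (x ⊗ y' ⊕ y ⊗ x')
    αᴱ (x , y) (x' , y') = x ⊗ x' ⊕ (Κ (+ 2) ⊗ (x ⊗ y') ⊕ y ⊗ x') ⊕ Κ (+ 3) ⊗ (y ⊗ y')
    δᴱ (x , y) (x' , y') = x ⊗ y' ⊕ ⊝ (y ⊗ x')

    Nᴱ : L → E
    Nᴱ (x , y) = x ⊗ x ⊕ Κ (+ 3) ⊗ (x ⊗ y) ⊕ Κ (+ 3) ⊗ (y ⊗ y)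

    straightᴱ bendᴱ : L → L → Bool → Bool → E
    straightᴱ u w false false = bᴱ u w
    straightᴱ u w false true  = aᴱ u w
    straightᴱ u w true  false = aᴱ u w
    straightᴱ u w true  true  = bᴱ u w
    bendᴱ u w false false = Κ (+ 1)
    bendᴱ u w false true  = Κ (+ 0)
    bendᴱ u w true  false = Κ (+ 0)
    bendᴱ u w true  true  = Nᴱ u ⊗ Nᴱ w

    diagᴱ : L → Bool → E
    diagᴱ u false = Κ (+ 1)
    diagᴱ u true  = Nᴱ u

    scatterᴱ : L → L → Bool → Bool → (Bool → Bool → E) → E
    scatterᴱ u w false false f = αᴱ u w ⊗ f false false
    scatterᴱ u w false true  f = Nᴱ u ⊗ f false true ⊕ δᴱ u w ⊗ f true false
    scatterᴱ u w true  false f = Nᴱ w ⊗ f true false ⊕ δᴱ u w ⊗ f false true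
    scatterᴱ u w true  true  f = αᴱ u w ⊗ f true true

    cross₂ᴱ : L → L → L → Bool → Bool → Bool → (Bool → Bool → Bool → E) → E
    cross₂ᴱ u w z h h' v T =
        straightᴱ u z h v ⊗ (straightᴱ w z h' v ⊗ T h h' v ⊕ bendᴱ w z h' v ⊗ T h (not h') (not v))
      ⊕ bendᴱ u z h v ⊗ (straightᴱ w z h' (not v) ⊗ T (not h) h' (not v)
                         ⊕ bendᴱ w z h' (not v) ⊗ T (not h) (not h') (not (not v)))

    -- The values of an arbitrary continuation become independent solver variables, so the relations
    -- are checked coefficient by coefficient.
    square : E → E → E → E → Bool → Bool → E
    square t₀ t₁ t₂ t₃ false false = t₀
    square t₀ t₁ t₂ t₃ false true  = t₁
    square t₀ t₁ t₂ t₃ true  false = t₂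
    square t₀ t₁ t₂ t₃ true  true  = t₃

    cube : E → E → E → E → E → E → E → E → Bool → Bool → Bool → E
    cube t₀ t₁ t₂ t₃ t₄ t₅ t₆ t₇ h h' false = square t₀ t₂ t₄ t₆ h h'
    cube t₀ t₁ t₂ t₃ t₄ t₅ t₆ t₇ h h' true  = square t₁ t₃ t₅ t₇ h h'

    yang-baxterᴱ : Bool → Bool → Bool → E → E → E → E → E → E → E → E → E → E → E → E → E → E → E × E
    yang-baxterᴱ h h' v t₀ t₁ t₂ t₃ t₄ t₅ t₆ t₇ x y x' y' p q =
      cross₂ᴱ w u z h h' v (λ i j c → scatterᴱ u w i j (λ i j → τ i j c)) ⊜ scatterᴱ u w h h' (λ i j → cross₂ᴱ u w z i j v τ)
      where
      u w z : L
      u = (x , y)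
      w = (x' , y')
      z = (p , q)
      τ : Bool → Bool → Bool → E
      τ = cube t₀ t₁ t₂ t₃ t₄ t₅ t₆ t₇

    cap₀ᴱ : E → E → L → L → (Bool → Bool → E) → Bool → Bool → E
    cap₀ᴱ c c' u w τ i j =
      c ⊗ (straightᴱ u w i j ⊗ (c' ⊗ τ i j) ⊕ bendᴱ u w i j ⊗ (c' ⊗ τ (not i) (not j)))

    cap₁ᴱ : L → L → (Bool → Bool → E) → (Bool → Bool → E) → Bool → Bool → E
    cap₁ᴱ u w τ S i j =
        proj₁ u ⊗ (straightᴱ u w i j ⊗ (proj₁ w ⊗ τ i j ⊕ diagᴱ w j ⊗ S i (not j))
                   ⊕ bendᴱ u w i j ⊗ (proj₁ w ⊗ τ (not i) (not j) ⊕ diagᴱ w (not j) ⊗ S (not i) (not (not j))))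
      ⊕ diagᴱ u i ⊗ (straightᴱ u w (not i) j ⊗ (proj₁ w ⊗ S (not i) j)
                     ⊕ bendᴱ u w (not i) j ⊗ (proj₁ w ⊗ S (not (not i)) (not j)))

    reflection₀ᴱ : Bool → Bool → E → E → E → E → E → E → E → E → E → E → E × E
    reflection₀ᴱ i j t₀ t₁ t₂ t₃ c c' x y x' y' =
      cap₀ᴱ c' c w u (λ i j → scatterᴱ u w i j τ) i j ⊜ scatterᴱ u w i j (cap₀ᴱ c c' u w τ)
      where
      u w : L
      u = (x , y)
      w = (x' , y')
      τ : Bool → Bool → E
      τ = square t₀ t₁ t₂ t₃

    reflection₁ᴱ : Bool → Bool → E → E → E → E → E → E → E → E → E → E → E → E → E × E
    reflection₁ᴱ i j t₀ t₁ t₂ t₃ s₀ s₁ s₂ s₃ x y x' y' =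
      cap₁ᴱ w u (λ i j → scatterᴱ u w i j τ) (λ i j → scatterᴱ u w i j S) i j ⊜ scatterᴱ u w i j (cap₁ᴱ u w τ S)
      where
      u w : L
      u = (x , y)
      w = (x' , y')
      τ S : Bool → Bool → E
      τ = square t₀ t₁ t₂ t₃
      S = square s₀ s₁ s₂ s₃

  yang-baxter : ∀ u w z h h' v (T : Bool → Bool → Bool → ℤ) →
    cross₂ w u z h h' v (λ i j c → scatter u w i j (λ i j → T i j c)) ≡ scatter u w h h' (λ i j → cross₂ u w z i j v T)
  yang-baxter (x , y) (x' , y') (p , q) false false false T = solve 14 (yang-baxterᴱ false false false) refl
    (T false false false) (T false false true) (T false true false) (T false true true) (T true false false) (T true false true) (T true true false) (T true true true)
    x y x' y' p q
  yang-baxter (x , y) (x' , y') (p , q) false false true  T = solve 14 (yang-baxterᴱ false false true ) refl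
    (T false false false) (T false false true) (T false true false) (T false true true) (T true false false) (T true false true) (T true true false) (T true true true)
    x y x' y' p q
  yang-baxter (x , y) (x' , y') (p , q) false true  false T = solve 14 (yang-baxterᴱ false true  false) refl
    (T false false false) (T false false true) (T false true false) (T false true true) (T true false false) (T true false true) (T true true false) (T true true true)
    x y x' y' p q
  yang-baxter (x , y) (x' , y') (p , q) false true  true  T = solve 14 (yang-baxterᴱ false true  true ) refl
    (T false false false) (T false false true) (T false true false) (T false true true) (T true false false) (T true false true) (T true true false) (T true true true)
    x y x' y' p q
  yang-baxter (x , y) (x' , y') (p , q) true  false false T = solve 14 (yang-baxterᴱ true  false false) refl
    (T false false false) (T false false true) (T false true false) (T false true true) (T true false false) (T true false true) (T true true false) (T true true true)
    x y x' y' p q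
  yang-baxter (x , y) (x' , y') (p , q) true  false true  T = solve 14 (yang-baxterᴱ true  false true ) refl
    (T false false false) (T false false true) (T false true false) (T false true true) (T true false false) (T true false true) (T true true false) (T true true true)
    x y x' y' p q
  yang-baxter (x , y) (x' , y') (p , q) true  true  false T = solve 14 (yang-baxterᴱ true  true  false) refl
    (T false false false) (T false false true) (T false true false) (T false true true) (T true false false) (T true false true) (T true true false) (T true true true)
    x y x' y' p q
  yang-baxter (x , y) (x' , y') (p , q) true  true  true  T = solve 14 (yang-baxterᴱ true  true  true ) refl
    (T false false false) (T false false true) (T false true false) (T false true true) (T true false false) (T true false true) (T true true false) (T true true true)
    x y x' y' p q

  reflection₀ : ∀ c c' u w T i j →
    cap₀ c' c w u (λ i j → scatter u w i j T) i j ≡ scatter u w i j (cap₀ c c' u w T)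
  reflection₀ c c' (x , y) (x' , y') T false false = solve 10 (reflection₀ᴱ false false) refl
    (T false false) (T false true) (T true false) (T true true) c c' x y x' y'
  reflection₀ c c' (x , y) (x' , y') T false true  = solve 10 (reflection₀ᴱ false true ) refl
    (T false false) (T false true) (T true false) (T true true) c c' x y x' y'
  reflection₀ c c' (x , y) (x' , y') T true  false = solve 10 (reflection₀ᴱ true  false) refl
    (T false false) (T false true) (T true false) (T true true) c c' x y x' y'
  reflection₀ c c' (x , y) (x' , y') T true  true  = solve 10 (reflection₀ᴱ true  true ) refl
    (T false false) (T false true) (T true false) (T true true) c c' x y x' y'

  -- The terms in `T` are `reflection₀` again. The new content is in `S`: there a zero entry on one
  -- line meets a nonzero entry on the other, so the diagonal weights no longer form a common
  -- factor, and the weights q against 1 and `N` make the two sides balance.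
  reflection₁ : ∀ u w T S i j →
    cap₁ w u (λ i j → scatter u w i j T) (λ i j → scatter u w i j S) i j ≡ scatter u w i j (cap₁ u w T S)
  reflection₁ (x , y) (x' , y') T S false false = solve 12 (reflection₁ᴱ false false) refl
    (T false false) (T false true) (T true false) (T true true)
    (S false false) (S false true) (S true false) (S true true) x y x' y'
  reflection₁ (x , y) (x' , y') T S false true  = solve 12 (reflection₁ᴱ false true ) refl
    (T false false) (T false true) (T true false) (T true true)
    (S false false) (S false true) (S true false) (S true true) x y x' y'
  reflection₁ (x , y) (x' , y') T S true  false = solve 12 (reflection₁ᴱ true  false) refl
    (T false false) (T false true) (T true false) (T true true)
    (S false false) (S false true) (S true false) (S true true) x y x' y'
  reflection₁ (x , y) (x' , y') T S true  true  = solve 12 (reflection₁ᴱ true  true ) refl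
    (T false false) (T false true) (T true false) (T true true)
    (S false false) (S false true) (S true false) (S true true) x y x' y'

  -- Exchange of adjacent lines

  transfer₂ : Line → Line → Bool → Bool → List Line → List Bool → (List Bool → ℤ) → ℤ
  transfer₂ u w h h' us vs k = transfer u h us vs (λ t → transfer w h' us t k)

  -- `transfer₂` runs row by row, but the Yang-Baxter equation acts column by column. Linearity
  -- pulls the first vertex of the second row out through the whole first row.
  transfer₂-∷ : ∀ u w z h h' us v vs k →
    transfer₂ u w h h' (z ∷ us) (v ∷ vs) k ≡ cross₂ u w z h h' v (λ i j c → transfer₂ u w i j us vs (k ∘ (c ∷_)))
  transfer₂-∷ u w z h h' us v vs k = cong₂ (λ p q → straight u z h v * p + bend u z h v * q)
    (transfer-linear u h us vs (straight w z h' v) (bend w z h' v)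
      (λ t → transfer w h' us t (k ∘ (v ∷_))) (λ t → transfer w (not h') us t (k ∘ (not v ∷_))))
    (transfer-linear u (not h) us vs (straight w z h' (not v)) (bend w z h' (not v))
      (λ t → transfer w h' us t (k ∘ (not v ∷_))) (λ t → transfer w (not h') us t (k ∘ (not (not v) ∷_))))

  cross₂-scale : ∀ c u w z h h' v T → c * cross₂ u w z h h' v T ≡ cross₂ u w z h h' v (λ i j d → c * T i j d)
  cross₂-scale c u w z h h' v T = go c
    (straight u z h v) (straight w z h' v) (T h h' v) (bend w z h' v) (T h (not h') (not v))
    (bend u z h v) (straight w z h' (not v)) (T (not h) h' (not v)) (bend w z h' (not v)) (T (not h) (not h') (not (not v)))
    where
    go : ∀ c p q r s t p' q' r' s' t' →
      c * (p * (q * r + s * t) + p' * (q' * r' + s' * t'))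
        ≡ p * (q * (c * r) + s * (c * t)) + p' * (q' * (c * r') + s' * (c * t'))
    go = ℤSolver.solve-∀

  cross₂-cong : ∀ u w z h h' v {T S : Bool → Bool → Bool → ℤ} → (∀ i j c → T i j c ≡ S i j c) →
    cross₂ u w z h h' v T ≡ cross₂ u w z h h' v S
  cross₂-cong u w z h h' v T≗S = cong₂ _+_
    (cong (straight u z h v *_) (cong₂ _+_ (cong (straight w z h' v *_) (T≗S _ _ _)) (cong (bend w z h' v *_) (T≗S _ _ _))))
    (cong (bend u z h v *_) (cong₂ _+_ (cong (straight w z h' (not v) *_) (T≗S _ _ _)) (cong (bend w z h' (not v) *_) (T≗S _ _ _))))

  -- The R-matrix of two consecutive rows travels through the columns by the Yang–Baxter equation.
  transfer₂-exchange : ∀ u w us vs h h' k →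
    α u w * transfer₂ w u h h' us vs k ≡ scatter u w h h' (λ i j → transfer₂ u w i j us vs k)
  -- At the right border only the state with both row sums 1 survives. There the R-matrix is the
  -- scalar `α u w`, which is the origin of the factor on the left.
  transfer₂-exchange u w [] [] false false k = refl
  transfer₂-exchange u w [] [] false true  k = sym (0-sum (N u) (δ u w) (α u w))
  transfer₂-exchange u w [] [] true  false k = sym (0-sum (N w) (δ u w) (α u w))
  transfer₂-exchange u w [] [] true  true  k = refl
  transfer₂-exchange u w [] (v ∷ vs) h h' k = trans (ℤP.*-zeroʳ (α u w)) (sym (scatter-0 u w h h'))
  transfer₂-exchange u w (z ∷ us) [] h h' k = trans (ℤP.*-zeroʳ (α u w)) (sym (scatter-0 u w h h'))
  transfer₂-exchange u w (z ∷ us) (v ∷ vs) h h' k = begin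
    α u w * transfer₂ w u h h' (z ∷ us) (v ∷ vs) k
      ≡⟨ cong (α u w *_) (transfer₂-∷ w u z h h' us v vs k) ⟩
    α u w * cross₂ w u z h h' v (λ i j c → transfer₂ w u i j us vs (k ∘ (c ∷_)))
      ≡⟨ cross₂-scale (α u w) w u z h h' v (λ i j c → transfer₂ w u i j us vs (k ∘ (c ∷_))) ⟩
    cross₂ w u z h h' v (λ i j c → α u w * transfer₂ w u i j us vs (k ∘ (c ∷_)))
      ≡⟨ cross₂-cong w u z h h' v (λ i j c → transfer₂-exchange u w us vs i j (k ∘ (c ∷_))) ⟩
    cross₂ w u z h h' v (λ i j c → scatter u w i j (λ i j → transfer₂ u w i j us vs (k ∘ (c ∷_))))
      ≡⟨ yang-baxter u w z h h' v (λ i j c → transfer₂ u w i j us vs (k ∘ (c ∷_))) ⟩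
    scatter u w h h' (λ i j → cross₂ u w z i j v (λ i j c → transfer₂ u w i j us vs (k ∘ (c ∷_))))
      ≡⟨ scatter-cong u w h h' (λ i j → transfer₂-∷ u w z i j us v vs k) ⟨
    scatter u w h h' (λ i j → transfer₂ u w i j (z ∷ us) (v ∷ vs) k) ∎

  -- g and f agree up to the R-matrix acting on the positions k and k + 1 of their argument.
  Exchange : Line → Line → ℕ → (List Bool → ℤ) → (List Bool → ℤ) → Set
  Exchange u w zero    g f = ∀ i j t → α u w * g (i ∷ j ∷ t) ≡ scatter u w i j (λ i j → f (i ∷ j ∷ t))
  Exchange u w (suc k) g f = ∀ i → Exchange u w k (g ∘ (i ∷_)) (f ∘ (i ∷_))

  exchange-linear : ∀ u w k c d {g f g' f'} → Exchange u w k g f → Exchange u w k g' f' →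
    Exchange u w k (λ t → c * g t + d * g' t) (λ t → c * f t + d * f' t)
  exchange-linear u w zero c d {g} {f} {g'} {f'} p q i j t = begin
    α u w * (c * g (i ∷ j ∷ t) + d * g' (i ∷ j ∷ t))
      ≡⟨ move (α u w) c d (g (i ∷ j ∷ t)) (g' (i ∷ j ∷ t)) ⟩
    c * (α u w * g (i ∷ j ∷ t)) + d * (α u w * g' (i ∷ j ∷ t))
      ≡⟨ cong₂ (λ p q → c * p + d * q) (p i j t) (q i j t) ⟩
    c * scatter u w i j (λ i j → f (i ∷ j ∷ t)) + d * scatter u w i j (λ i j → f' (i ∷ j ∷ t))
      ≡⟨ scatter-linear u w i j c d (λ i j → f (i ∷ j ∷ t)) (λ i j → f' (i ∷ j ∷ t)) ⟨
    scatter u w i j (λ i j → c * f (i ∷ j ∷ t) + d * f' (i ∷ j ∷ t)) ∎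
    where
    move : ∀ r c d p q → r * (c * p + d * q) ≡ c * (r * p) + d * (r * q)
    move = ℤSolver.solve-∀
  exchange-linear u w (suc k) c d p q i = exchange-linear u w k c d (p i) (q i)

  scatter-scale : ∀ u w i j c f → scatter u w i j (λ i j → c * f i j) ≡ c * scatter u w i j f
  scatter-scale u w i j c f = begin
    scatter u w i j (λ i j → c * f i j)
      ≡⟨ scatter-cong u w i j (λ i j → sym (drop-0 c (f i j) (f i j))) ⟩
    scatter u w i j (λ i j → c * f i j + + 0 * f i j)
      ≡⟨ scatter-linear u w i j c (+ 0) f f ⟩
    c * scatter u w i j f + + 0 * scatter u w i j f
      ≡⟨ drop-0 c _ (scatter u w i j f) ⟩
    c * scatter u w i j f ∎

  exchange-scale : ∀ u w k c {g f} → Exchange u w k g f → Exchange u w k (λ t → c * g t) (λ t → c * f t)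
  exchange-scale u w zero c {g} {f} p i j t = begin
    α u w * (c * g (i ∷ j ∷ t))                      ≡⟨ move (α u w) c (g (i ∷ j ∷ t)) ⟩
    c * (α u w * g (i ∷ j ∷ t))                      ≡⟨ cong (c *_) (p i j t) ⟩
    c * scatter u w i j (λ i j → f (i ∷ j ∷ t))  ≡⟨ scatter-scale u w i j c (λ i j → f (i ∷ j ∷ t)) ⟨
    scatter u w i j (λ i j → c * f (i ∷ j ∷ t))  ∎
    where
    move : ∀ r c p → r * (c * p) ≡ c * (r * p)
    move = ℤSolver.solve-∀
  exchange-scale u w (suc k) c p i = exchange-scale u w k c (p i)

  transfer-scatter : ∀ z h us vs u w i j (f : Bool → Bool → List Bool → ℤ) →
    transfer z h us vs (λ t → scatter u w i j (λ i j → f i j t)) ≡ scatter u w i j (λ i j → transfer z h us vs (f i j))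
  transfer-scatter z h us vs u w false false f = transfer-scale z h us vs (α u w) (f false false)
  transfer-scatter z h us vs u w false true  f = transfer-linear z h us vs (N u) (δ u w) (f false true) (f true false)
  transfer-scatter z h us vs u w true  false f = transfer-linear z h us vs (N w) (δ u w) (f true false) (f false true)
  transfer-scatter z h us vs u w true  true  f = transfer-scale z h us vs (α u w) (f true true)

  a-comm : ∀ u w → a u w ≡ a w u
  a-comm (x , y) (x' , y') = go x y x' y'
    where
    go : ∀ x y x' y' → x * x' + + 2 * (x * y' + y * x') + + 3 * (y * y') ≡ x' * x + + 2 * (x' * y + y' * x) + + 3 * (y' * y)
    go = ℤSolver.solve-∀

  b-comm : ∀ u w → b u w ≡ b w u
  b-comm (x , y) (x' , y') = go x y x' y'
    where
    go : ∀ x y x' y' → x * x' + (x * y' + y * x') ≡ x' * x + (x' * y + y' * x)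
    go = ℤSolver.solve-∀

  straight-transpose : ∀ u w h v → straight u w h v ≡ straight w u v h
  straight-transpose u w false false = b-comm u w
  straight-transpose u w false true  = a-comm u w
  straight-transpose u w true  false = a-comm u w
  straight-transpose u w true  true  = b-comm u w

  bend-transpose : ∀ u w h v → bend u w h v ≡ bend w u v h
  bend-transpose u w false false = refl
  bend-transpose u w false true  = refl
  bend-transpose u w true  false = refl
  bend-transpose u w true  true  = ℤP.*-comm (N u) (N w)

  -- Vertex weights are invariant under transposition, so one row crossing two columns is also a
  -- `cross₂`, and `yang-baxter` applies to adjacent columns as well.
  transfer-∷∷ : ∀ z u w us h i j t (f : List Bool → ℤ) →
    transfer z h (u ∷ w ∷ us) (i ∷ j ∷ t) f ≡ cross₂ u w z i j h (λ i j c → transfer z c us t (λ s → f (i ∷ j ∷ s)))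
  transfer-∷∷ z u w us h i j t f
    rewrite straight-transpose z u h i | bend-transpose z u h i
          | straight-transpose z w h j | bend-transpose z w h j
          | straight-transpose z w (not h) j | bend-transpose z w (not h) j
    = refl

  -- In the row of an earlier line `z`, the exchanged lines are adjacent columns. The R-matrix moves
  -- from the column sums below this row to those above it; the columns in `pre` are passed by
  -- linearity.
  transfer-exchange : ∀ z pre u w post {g f} → Exchange u w (length pre) g f → ∀ h →
    Exchange u w (length pre) (λ vs → transfer z h (pre ++ w ∷ u ∷ post) vs g)
                              (λ vs → transfer z h (pre ++ u ∷ w ∷ post) vs f)
  transfer-exchange z [] u w post {g} {f} p h i j t = begin
    α u w * transfer z h (w ∷ u ∷ post) (i ∷ j ∷ t) g
      ≡⟨ cong (α u w *_) (transfer-∷∷ z w u post h i j t g) ⟩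
    α u w * cross₂ w u z i j h (λ i j c → transfer z c post t (λ s → g (i ∷ j ∷ s)))
      ≡⟨ cross₂-scale (α u w) w u z i j h (λ i j c → transfer z c post t (λ s → g (i ∷ j ∷ s))) ⟩
    cross₂ w u z i j h (λ i j c → α u w * transfer z c post t (λ s → g (i ∷ j ∷ s)))
      ≡⟨ cross₂-cong w u z i j h (λ i j c → trans (sym (transfer-scale z c post t (α u w) (λ s → g (i ∷ j ∷ s))))
           (trans (transfer-cong z c post t (p i j)) (transfer-scatter z c post t u w i j (λ i j s → f (i ∷ j ∷ s))))) ⟩
    cross₂ w u z i j h (λ i j c → scatter u w i j (λ i j → transfer z c post t (λ s → f (i ∷ j ∷ s))))
      ≡⟨ yang-baxter u w z i j h (λ i j c → transfer z c post t (λ s → f (i ∷ j ∷ s))) ⟩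
    scatter u w i j (λ i j → cross₂ u w z i j h (λ i j c → transfer z c post t (λ s → f (i ∷ j ∷ s))))
      ≡⟨ scatter-cong u w i j (λ i j → transfer-∷∷ z u w post h i j t f) ⟨
    scatter u w i j (λ i j → transfer z h (u ∷ w ∷ post) (i ∷ j ∷ t) f) ∎
  transfer-exchange z (y ∷ pre) u w post p h i =
    exchange-linear u w (length pre) (straight z y h i) (bend z y h i)
      (transfer-exchange z pre u w post (p i) h) (transfer-exchange z pre u w post (p (not i)) (not h))

  cap₀-cong : ∀ c c' u w {T S : Bool → Bool → ℤ} → (∀ i j → T i j ≡ S i j) → ∀ i j →
    cap₀ c c' u w T i j ≡ cap₀ c c' u w S i j
  cap₀-cong c c' u w T≗S i j =
    cong₂ (λ p q → c * (straight u w i j * (c' * p) + bend u w i j * (c' * q))) (T≗S _ _) (T≗S _ _)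

  F₀-∷∷ : ∀ c u w us i j t → F₀ c (u ∷ w ∷ us) (i ∷ j ∷ t) ≡
    cap₀ (c u) (c w) u w (λ i j → transfer₂ u w i j us t (F₀ c us)) i j
  F₀-∷∷ c u w us i j t = cong (c u *_) (cong₂ (λ p q → straight u w i j * p + bend u w i j * q)
    (transfer-scale u i us t (c w) (λ s → transfer w j us s (F₀ c us)))
    (transfer-scale u (not i) us t (c w) (λ s → transfer w (not j) us s (F₀ c us))))

  -- The R-matrix enters at the right border, crosses the rows of `u` and `w` by
  -- `transfer₂-exchange`, turns at the diagonal by `reflection₀`, and climbs through the earlier
  -- rows by `transfer-exchange`. The weight `c` is free because every line carries it exactly once.
  F₀-exchange : ∀ c pre u w post →
    Exchange u w (length pre) (F₀ c (pre ++ w ∷ u ∷ post)) (F₀ c (pre ++ u ∷ w ∷ post))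
  F₀-exchange c [] u w us i j t = begin
    α u w * F₀ c (w ∷ u ∷ us) (i ∷ j ∷ t)
      ≡⟨ cong (α u w *_) (F₀-∷∷ c w u us i j t) ⟩
    α u w * cap₀ (c w) (c u) w u (λ i j → transfer₂ w u i j us t (F₀ c us)) i j
      ≡⟨ scale (α u w) (c w) (c u) (straight w u i j) (bend w u i j)
           (transfer₂ w u i j us t (F₀ c us)) (transfer₂ w u (not i) (not j) us t (F₀ c us)) ⟩
    cap₀ (c w) (c u) w u (λ i j → α u w * transfer₂ w u i j us t (F₀ c us)) i j
      ≡⟨ cap₀-cong (c w) (c u) w u (λ i j → transfer₂-exchange u w us t i j (F₀ c us)) i j ⟩
    cap₀ (c w) (c u) w u (λ i j → scatter u w i j (λ i j → transfer₂ u w i j us t (F₀ c us))) i j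
      ≡⟨ reflection₀ (c u) (c w) u w (λ i j → transfer₂ u w i j us t (F₀ c us)) i j ⟩
    scatter u w i j (cap₀ (c u) (c w) u w (λ i j → transfer₂ u w i j us t (F₀ c us)))
      ≡⟨ scatter-cong u w i j (λ i j → F₀-∷∷ c u w us i j t) ⟨
    scatter u w i j (λ i j → F₀ c (u ∷ w ∷ us) (i ∷ j ∷ t)) ∎
    where
    scale : ∀ r c c' p q s t → r * (c * (p * (c' * s) + q * (c' * t))) ≡ c * (p * (c' * (r * s)) + q * (c' * (r * t)))
    scale = ℤSolver.solve-∀
  F₀-exchange c (z ∷ pre) u w post i =
    exchange-scale u w (length pre) (c z) (transfer-exchange z pre u w post (F₀-exchange c pre u w post) i)

  cap₁-cong : ∀ u w {T T' S S' : Bool → Bool → ℤ} → (∀ i j → T i j ≡ T' i j) → (∀ i j → S i j ≡ S' i j) →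
    ∀ i j → cap₁ u w T S i j ≡ cap₁ u w T' S' i j
  cap₁-cong u w T≗T' S≗S' i j
    rewrite T≗T' i j | T≗T' (not i) (not j)
          | S≗S' i (not j) | S≗S' (not i) (not (not j)) | S≗S' (not i) j | S≗S' (not (not i)) (not j)
    = refl

  F₁-∷∷ : ∀ u w us i j t → F₁ (u ∷ w ∷ us) (i ∷ j ∷ t) ≡
    cap₁ u w (λ i j → transfer₂ u w i j us t (F₁ us)) (λ i j → transfer₂ u w i j us t (F₀ proj₁ us)) i j
  F₁-∷∷ u w us i j t = cong₂ (λ p q → proj₁ u * p + diag u i * q)
    (cong₂ (λ p q → straight u w i j * p + bend u w i j * q)
      (transfer-linear u i us t (proj₁ w) (diag w j)
        (λ s → transfer w j us s (F₁ us)) (λ s → transfer w (not j) us s (F₀ proj₁ us)))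
      (transfer-linear u (not i) us t (proj₁ w) (diag w (not j))
        (λ s → transfer w (not j) us s (F₁ us)) (λ s → transfer w (not (not j)) us s (F₀ proj₁ us))))
    (cong₂ (λ p q → straight u w (not i) j * p + bend u w (not i) j * q)
      (transfer-scale u (not i) us t (proj₁ w) (λ s → transfer w j us s (F₀ proj₁ us)))
      (transfer-scale u (not (not i)) us t (proj₁ w) (λ s → transfer w (not j) us s (F₀ proj₁ us))))

  -- The route is that of `F₀-exchange`. Configurations whose nonzero diagonal entry has been placed
  -- continue with `F₀ proj₁`, so both exchange relations travel together.
  F₁-exchange : ∀ pre u w post →
    Exchange u w (length pre) (F₁ (pre ++ w ∷ u ∷ post)) (F₁ (pre ++ u ∷ w ∷ post))
  F₁-exchange [] u w us i j t = begin
    α u w * F₁ (w ∷ u ∷ us) (i ∷ j ∷ t)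
      ≡⟨ cong (α u w *_) (F₁-∷∷ w u us i j t) ⟩
    α u w * cap₁ w u (λ i j → transfer₂ w u i j us t (F₁ us)) (λ i j → transfer₂ w u i j us t (F₀ proj₁ us)) i j
      ≡⟨ scale (α u w) (proj₁ w) (straight w u i j) (proj₁ u) (diag u j) (bend w u i j) (diag u (not j))
           (diag w i) (straight w u (not i) j) (bend w u (not i) j)
           (transfer₂ w u i j us t (F₁ us)) (transfer₂ w u (not i) (not j) us t (F₁ us))
           (transfer₂ w u i (not j) us t (F₀ proj₁ us)) (transfer₂ w u (not i) (not (not j)) us t (F₀ proj₁ us))
           (transfer₂ w u (not i) j us t (F₀ proj₁ us)) (transfer₂ w u (not (not i)) (not j) us t (F₀ proj₁ us)) ⟩
    cap₁ w u (λ i j → α u w * transfer₂ w u i j us t (F₁ us)) (λ i j → α u w * transfer₂ w u i j us t (F₀ proj₁ us)) i j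
      ≡⟨ cap₁-cong w u (λ i j → transfer₂-exchange u w us t i j (F₁ us))
                       (λ i j → transfer₂-exchange u w us t i j (F₀ proj₁ us)) i j ⟩
    cap₁ w u (λ i j → scatter u w i j (λ i j → transfer₂ u w i j us t (F₁ us)))
             (λ i j → scatter u w i j (λ i j → transfer₂ u w i j us t (F₀ proj₁ us))) i j
      ≡⟨ reflection₁ u w (λ i j → transfer₂ u w i j us t (F₁ us)) (λ i j → transfer₂ u w i j us t (F₀ proj₁ us)) i j ⟩
    scatter u w i j (cap₁ u w (λ i j → transfer₂ u w i j us t (F₁ us)) (λ i j → transfer₂ u w i j us t (F₀ proj₁ us)))
      ≡⟨ scatter-cong u w i j (λ i j → F₁-∷∷ u w us i j t) ⟨
    scatter u w i j (λ i j → F₁ (u ∷ w ∷ us) (i ∷ j ∷ t)) ∎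
    where
    scale : ∀ r c p q d e d' f g h t t' s s' s'' s''' →
      r * (c * (p * (q * t + d * s) + e * (q * t' + d' * s')) + f * (g * (q * s'') + h * (q * s''')))
        ≡ c * (p * (q * (r * t) + d * (r * s)) + e * (q * (r * t') + d' * (r * s')))
          + f * (g * (q * (r * s'')) + h * (q * (r * s''')))
    scale = ℤSolver.solve-∀
  F₁-exchange (z ∷ pre) u w post i =
    exchange-linear u w (length pre) (proj₁ z) (diag z i)
      (transfer-exchange z pre u w post (F₁-exchange pre u w post) i)
      (transfer-exchange z pre u w post (F₀-exchange proj₁ pre u w post) (not i))

  zeros : List Line → List Bool
  zeros us = replicate (length us) false

  -- At the top all column sums are 0, and there the R-matrix is the scalar `α u w` once more.
  -- Symmetry results because both borders give the same scalar.
  exchange-zeros : ∀ u w k m {g f} → Exchange u w k g f →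
    α u w * g (replicate (k ℕ.+ suc (suc m)) false) ≡ α u w * f (replicate (k ℕ.+ suc (suc m)) false)
  exchange-zeros u w zero    m p = p false false (replicate m false)
  exchange-zeros u w (suc k) m p = exchange-zeros u w k m (p false)

  Exchangeable : (List Line → List Bool → ℤ) → Set
  Exchangeable F = ∀ pre u w post → Exchange u w (length pre) (F (pre ++ w ∷ u ∷ post)) (F (pre ++ u ∷ w ∷ post))

  swap-zeros : ∀ {F} → Exchangeable F → ∀ pre u w post → α u w ≢ + 0 →
    F (pre ++ w ∷ u ∷ post) (zeros (pre ++ w ∷ u ∷ post)) ≡ F (pre ++ u ∷ w ∷ post) (zeros (pre ++ u ∷ w ∷ post))
  swap-zeros {F} ex pre u w post α≢0
    rewrite ListP.length-++ pre {w ∷ u ∷ post} | ListP.length-++ pre {u ∷ w ∷ post} =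
    ℤP.*-cancelˡ-≡ (α u w) _ _ {{≢-nonZero α≢0}} (exchange-zeros u w (length pre) (length post) (ex pre u w post))

  -- Every transposition used costs a cancellation of `α`, in an order fixed by the derivation of
  -- the permutation; hence a class `P` of lines on which `α` never vanishes. The lines in `pre` are
  -- never moved and need no condition.
  perm-zeros : ∀ {F} → Exchangeable F → ∀ {P : Line → Set} → (∀ {u w} → P u → P w → α u w ≢ + 0) →
    ∀ {us ws} → us ↭ ws → All P us → ∀ pre →
    F (pre ++ us) (zeros (pre ++ us)) ≡ F (pre ++ ws) (zeros (pre ++ ws))
  perm-zeros ex α≢0 _↭_.refl ok pre = refl
  perm-zeros {F} ex α≢0 {us = u ∷ us} {ws = u ∷ ws} (prep u p) (_ ∷ ok) pre
    rewrite sym (ListP.++-assoc pre (u ∷ []) us) | sym (ListP.++-assoc pre (u ∷ []) ws)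
    = perm-zeros {F} ex α≢0 p ok (pre ∷ʳ u)
  perm-zeros {F} ex α≢0 {us = u ∷ w ∷ us} {ws = w ∷ u ∷ ws} (swap u w p) (pu ∷ pw ∷ ok) pre =
    trans (swap-zeros {F} ex pre w u us (α≢0 pw pu)) step
    where
    step : F (pre ++ w ∷ u ∷ us) (zeros (pre ++ w ∷ u ∷ us)) ≡ F (pre ++ w ∷ u ∷ ws) (zeros (pre ++ w ∷ u ∷ ws))
    step rewrite sym (ListP.++-assoc pre (w ∷ u ∷ []) us) | sym (ListP.++-assoc pre (w ∷ u ∷ []) ws)
      = perm-zeros {F} ex α≢0 p ok (pre ++ w ∷ u ∷ [])
  perm-zeros {F} ex α≢0 (_↭_.trans p q) ok pre =
    trans (perm-zeros {F} ex α≢0 p ok pre) (perm-zeros {F} ex α≢0 q (Perm.All-resp-↭ p ok) pre)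

  -- Frozen lines

  ∏ : (Line → ℤ) → List Line → ℤ
  ∏ f []       = + 1
  ∏ f (u ∷ us) = f u * ∏ f us

  ∏-∷ʳ : ∀ f us w → ∏ f (us ∷ʳ w) ≡ ∏ f us * f w
  ∏-∷ʳ f []       w = ℤP.*-comm (f w) (+ 1)
  ∏-∷ʳ f (u ∷ us) w = trans (cong (f u *_) (∏-∷ʳ f us w)) (sym (ℤP.*-assoc (f u) (∏ f us) (f w)))

  zeros-∷ʳ : ∀ us w → zeros (us ∷ʳ w) ≡ zeros us ∷ʳ false
  zeros-∷ʳ []       w = refl
  zeros-∷ʳ (u ∷ us) w = cong (false ∷_) (zeros-∷ʳ us w)

  private
    drop-right : ∀ p q r → p * q + + 0 * r ≡ p * q
    drop-right = ℤSolver.solve-∀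


  -- With row sum 1 and column sum 0 a bend is impossible: -1 would make the column sum negative,
  -- and 1 would make the row sum 2. The whole row is therefore straight.
  transfer-true-zeros : ∀ u us k → transfer u true us (zeros us) k ≡ ∏ (a u) us * k (zeros us)
  transfer-true-zeros u []       k = sym (ℤP.*-identityˡ (k []))
  transfer-true-zeros u (w ∷ us) k = begin
    a u w * transfer u true us (zeros us) (k ∘ (false ∷_)) + + 0 * transfer u false us (zeros us) (k ∘ (true ∷_))
      ≡⟨ drop-right (a u w) _ (transfer u false us (zeros us) (k ∘ (true ∷_))) ⟩
    a u w * transfer u true us (zeros us) (k ∘ (false ∷_))
      ≡⟨ cong (a u w *_) (transfer-true-zeros u us (k ∘ (false ∷_))) ⟩
    a u w * (∏ (a u) us * k (false ∷ zeros us))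
      ≡⟨ ℤP.*-assoc (a u w) (∏ (a u) us) (k (false ∷ zeros us)) ⟨
    a u w * ∏ (a u) us * k (false ∷ zeros us) ∎

  -- If b u w = 0, the lines u and w at the front are forced into a frozen configuration.
  F₀-b-reduction : ∀ c u w us → b u w ≡ + 0 →
    F₀ c (u ∷ w ∷ us) (zeros (u ∷ w ∷ us)) ≡ c u * c w * (∏ (a u) us * ∏ (a w) us) * F₀ c us (zeros us)
  F₀-b-reduction c u w us b≡0
    rewrite b≡0
          | transfer-true-zeros u us (λ t → F₀ c (w ∷ us) (true ∷ t))
          | transfer-true-zeros w us (F₀ c us)
    = go (c u) (c w) (transfer u false us (zeros us) (λ t → F₀ c (w ∷ us) (false ∷ t))) (∏ (a u) us) (∏ (a w) us) (F₀ c us (zeros us))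
    where
    go : ∀ c c' r p q f → c * (+ 0 * r + + 1 * (p * (c' * (q * f)))) ≡ c * c' * (p * q) * f
    go = ℤSolver.solve-∀

  -- The configurations with the nonzero diagonal entry in one of the two frozen rows cancel.
  F₁-b-cancel : ∀ u w → b u w ≡ + 0 → proj₁ u * N w + a u w * proj₁ w ≡ + 0
  F₁-b-cancel (x , y) (x' , y') b≡0 = trans (go x y x' y') (trans (cong ((+ 2 * x' + + 3 * y') *_) b≡0) (ℤP.*-zeroʳ (+ 2 * x' + + 3 * y')))
    where
    go : ∀ x y x' y' →
      x * (x' * x' + + 3 * (x' * y') + + 3 * (y' * y')) + (x * x' + + 2 * (x * y' + y * x') + + 3 * (y * y')) * x'
        ≡ (+ 2 * x' + + 3 * y') * (x * x' + (x * y' + y * x'))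
    go = ℤSolver.solve-∀

  -- Two kinds of unwanted configurations share the remainder `ρ`: a 1 at the vertex of `u` and `w`
  -- with a -1 on the diagonal of `w`, and a 1 on the diagonal of `u` with that vertex straight.
  -- Their weights add up to the expression in `F₁-b-cancel`.
  F₁-b-reduction : ∀ u w us → b u w ≡ + 0 →
    F₁ (u ∷ w ∷ us) (zeros (u ∷ w ∷ us)) ≡ proj₁ u * proj₁ w * (∏ (a u) us * ∏ (a w) us) * F₁ us (zeros us)
  F₁-b-reduction u w us b≡0
    rewrite transfer-true-zeros u us (λ t → F₁ (w ∷ us) (true ∷ t))
          | transfer-true-zeros u us (λ t → F₀ proj₁ (w ∷ us) (false ∷ t))
          | transfer-true-zeros w us (F₁ us)
    = begin
    x * (b u w * r + + 1 * (p * (x' * (q * f) + N w * ρ))) + + 1 * (a u w * (p * (x' * ρ)) + + 0 * s)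
      ≡⟨ go x (b u w) r p x' q f (N w) ρ (a u w) s ⟩
    x * x' * (p * q) * f + x * r * b u w + p * ρ * (x * N w + a u w * x')
      ≡⟨ cong₂ (λ m n → x * x' * (p * q) * f + x * r * m + p * ρ * n) b≡0 (F₁-b-cancel u w b≡0) ⟩
    x * x' * (p * q) * f + x * r * + 0 + p * ρ * + 0
      ≡⟨ clean (x * x' * (p * q) * f) (x * r) (p * ρ) ⟩
    x * x' * (p * q) * f ∎
    where
    x x' r p q f ρ s : ℤ
    x  = proj₁ u
    x' = proj₁ w
    r  = transfer u false us (zeros us) (λ t → F₁ (w ∷ us) (false ∷ t))
    p  = ∏ (a u) us
    q  = ∏ (a w) us
    f  = F₁ us (zeros us)
    ρ  = transfer w false us (zeros us) (F₀ proj₁ us)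
    s  = transfer u false us (zeros us) (λ t → F₀ proj₁ (w ∷ us) (true ∷ t))
    go : ∀ x b r p x' q f n ρ a s →
      x * (b * r + + 1 * (p * (x' * (q * f) + n * ρ))) + + 1 * (a * (p * (x' * ρ)) + + 0 * s)
        ≡ x * x' * (p * q) * f + x * r * b + p * ρ * (x * n + a * x')
    go = ℤSolver.solve-∀
    clean : ∀ m n o → m + n * + 0 + o * + 0 ≡ m
    clean = ℤSolver.solve-∀

  -- In the last column with sum 1, a bend would end the row with sum 0, and so would a straight
  -- vertex entered with row sum 0. Only the straight vertex of weight `b u z` remains, and the
  -- column factors out.
  transfer-∷ʳ-true : ∀ u h us z vs k →
    transfer u h (us ∷ʳ z) (vs ∷ʳ true) k ≡ b u z * transfer u h us vs (λ t → k (t ∷ʳ true))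
  transfer-∷ʳ-true u false [] z [] k = 0-sum (a u z) (+ 0) (b u z)
  transfer-∷ʳ-true u true  [] z [] k = go (b u z) (k (true ∷ [])) (N u * N z)
    where
    go : ∀ p q r → p * q + r * + 0 ≡ p * q
    go = ℤSolver.solve-∀
  transfer-∷ʳ-true u h [] z (v ∷ [])    k = 0-sum (straight u z h v) (bend u z h v) (b u z)
  transfer-∷ʳ-true u h [] z (v ∷ _ ∷ _) k = 0-sum (straight u z h v) (bend u z h v) (b u z)
  transfer-∷ʳ-true u h (w ∷ [])    z [] k = 0-sum (straight u w h true) (bend u w h true) (b u z)
  transfer-∷ʳ-true u h (w ∷ _ ∷ _) z [] k = 0-sum (straight u w h true) (bend u w h true) (b u z)
  transfer-∷ʳ-true u h (w ∷ us) z (v ∷ vs) k = begin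
    straight u w h v * transfer u h (us ∷ʳ z) (vs ∷ʳ true) (k ∘ (v ∷_))
      + bend u w h v * transfer u (not h) (us ∷ʳ z) (vs ∷ʳ true) (k ∘ (not v ∷_))
      ≡⟨ cong₂ (λ p q → straight u w h v * p + bend u w h v * q)
           (transfer-∷ʳ-true u h us z vs (k ∘ (v ∷_))) (transfer-∷ʳ-true u (not h) us z vs (k ∘ (not v ∷_))) ⟩
    straight u w h v * (b u z * p) + bend u w h v * (b u z * q)
      ≡⟨ go (straight u w h v) (bend u w h v) (b u z) p q ⟩
    b u z * (straight u w h v * p + bend u w h v * q) ∎
    where
    p q : ℤ
    p = transfer u h us vs (λ t → k (v ∷ (t ∷ʳ true)))
    q = transfer u (not h) us vs (λ t → k (not v ∷ (t ∷ʳ true)))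
    go : ∀ s e b p q → s * (b * p) + e * (b * q) ≡ b * (s * p + e * q)
    go = ℤSolver.solve-∀

  F₀-∷ʳ-true : ∀ c us z vs → F₀ c (us ∷ʳ z) (vs ∷ʳ true) ≡ c z * ∏ (λ u → b u z) us * F₀ c us vs
  F₀-∷ʳ-true c [] z []       = go (c z)
    where
    go : ∀ c → c * + 1 ≡ c * + 1 * + 1
    go = ℤSolver.solve-∀
  F₀-∷ʳ-true c [] z (v ∷ []) = trans (ℤP.*-zeroʳ (c z)) (sym (ℤP.*-zeroʳ (c z * + 1)))
  F₀-∷ʳ-true c [] z (v ∷ _ ∷ _) = trans (ℤP.*-zeroʳ (c z)) (sym (ℤP.*-zeroʳ (c z * + 1)))
  F₀-∷ʳ-true c (u ∷ []) z [] = trans (ℤP.*-zeroʳ (c u)) (sym (ℤP.*-zeroʳ (c z * ∏ (λ u → b u z) (u ∷ []))))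
  F₀-∷ʳ-true c (u ∷ us@(_ ∷ _)) z [] = trans (ℤP.*-zeroʳ (c u)) (sym (ℤP.*-zeroʳ (c z * ∏ (λ u → b u z) (u ∷ us))))
  F₀-∷ʳ-true c (u ∷ us) z (v ∷ vs) = begin
    c u * transfer u v (us ∷ʳ z) (vs ∷ʳ true) (F₀ c (us ∷ʳ z))
      ≡⟨ cong (c u *_) (transfer-∷ʳ-true u v us z vs (F₀ c (us ∷ʳ z))) ⟩
    c u * (b u z * transfer u v us vs (λ t → F₀ c (us ∷ʳ z) (t ∷ʳ true)))
      ≡⟨ cong (λ r → c u * (b u z * r)) (trans (transfer-cong u v us vs (F₀-∷ʳ-true c us z))
           (transfer-scale u v us vs (c z * ∏ (λ u → b u z) us) (F₀ c us))) ⟩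
    c u * (b u z * (c z * ∏ (λ u → b u z) us * transfer u v us vs (F₀ c us)))
      ≡⟨ go (c u) (b u z) (c z) (∏ (λ u → b u z) us) (transfer u v us vs (F₀ c us)) ⟩
    c z * (b u z * ∏ (λ u → b u z) us) * (c u * transfer u v us vs (F₀ c us)) ∎
    where
    go : ∀ c b c' p r → c * (b * (c' * p * r)) ≡ c' * (b * p) * (c * r)
    go = ℤSolver.solve-∀

  -- The nonzero diagonal entry cannot lie on `z`: it would turn the sum 1 into 0 with no entries
  -- left in the row.
  F₁-∷ʳ-true : ∀ us z vs → F₁ (us ∷ʳ z) (vs ∷ʳ true) ≡ proj₁ z * ∏ (λ u → b u z) us * F₁ us vs
  F₁-∷ʳ-true [] z []          = 0-sum (proj₁ z) (N z) (proj₁ z * + 1)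
  F₁-∷ʳ-true [] z (v ∷ [])    = 0-sum (proj₁ z) (diag z v) (proj₁ z * + 1)
  F₁-∷ʳ-true [] z (v ∷ _ ∷ _) = 0-sum (proj₁ z) (diag z v) (proj₁ z * + 1)
  F₁-∷ʳ-true (u ∷ []) z []           = 0-sum (proj₁ u) (N u) (proj₁ z * ∏ (λ u → b u z) (u ∷ []))
  F₁-∷ʳ-true (u ∷ us@(_ ∷ _)) z []   = 0-sum (proj₁ u) (N u) (proj₁ z * ∏ (λ u → b u z) (u ∷ us))
  F₁-∷ʳ-true (u ∷ us) z (v ∷ vs) = begin
    proj₁ u * transfer u v (us ∷ʳ z) (vs ∷ʳ true) (F₁ (us ∷ʳ z))
      + diag u v * transfer u (not v) (us ∷ʳ z) (vs ∷ʳ true) (F₀ proj₁ (us ∷ʳ z))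
      ≡⟨ cong₂ (λ p q → proj₁ u * p + diag u v * q)
           (trans (transfer-∷ʳ-true u v us z vs (F₁ (us ∷ʳ z)))
             (cong (b u z *_) (trans (transfer-cong u v us vs (F₁-∷ʳ-true us z))
               (transfer-scale u v us vs (proj₁ z * π) (F₁ us)))))
           (trans (transfer-∷ʳ-true u (not v) us z vs (F₀ proj₁ (us ∷ʳ z)))
             (cong (b u z *_) (trans (transfer-cong u (not v) us vs (F₀-∷ʳ-true proj₁ us z))
               (transfer-scale u (not v) us vs (proj₁ z * π) (F₀ proj₁ us))))) ⟩
    proj₁ u * (b u z * (proj₁ z * π * r)) + diag u v * (b u z * (proj₁ z * π * s))
      ≡⟨ go (proj₁ u) (b u z) (proj₁ z) π r (diag u v) s ⟩
    proj₁ z * (b u z * π) * (proj₁ u * r + diag u v * s) ∎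
    where
    π r s : ℤ
    π = ∏ (λ u → b u z) us
    r = transfer u v us vs (F₁ us)
    s = transfer u (not v) us vs (F₀ proj₁ us)
    go : ∀ x b x' p r d s → x * (b * (x' * p * r)) + d * (b * (x' * p * s)) ≡ x' * (b * p) * (x * r + d * s)
    go = ℤSolver.solve-∀

  transfer-true-∷ʳ-false : ∀ u us z k → a u z ≡ + 0 → transfer u true (us ∷ʳ z) (zeros us ∷ʳ false) k ≡ + 0
  transfer-true-∷ʳ-false u [] z k a≡0 rewrite a≡0 = refl
  transfer-true-∷ʳ-false u (w ∷ us) z k a≡0
    rewrite transfer-true-∷ʳ-false u us z (k ∘ (false ∷_)) a≡0
    = trans (drop-right (a u w) (+ 0) (transfer u false (us ∷ʳ z) (zeros us ∷ʳ false) (k ∘ (true ∷_))))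
            (ℤP.*-zeroʳ (a u w))

  -- Once the row has its 1, it stays straight up to column `z`, where it meets the factor `a u z`,
  -- which is 0. The 1 must therefore stand in column `z` itself.
  transfer-false-∷ʳ-false : ∀ u us z k → a u z ≡ + 0 →
    transfer u false (us ∷ʳ z) (zeros us ∷ʳ false) k ≡ ∏ (b u) us * k (zeros us ∷ʳ true)
  transfer-false-∷ʳ-false u [] z k a≡0 = go (b u z) (k (true ∷ []))
    where
    go : ∀ p q → p * + 0 + + 1 * q ≡ + 1 * q
    go = ℤSolver.solve-∀
  transfer-false-∷ʳ-false u (w ∷ us) z k a≡0
    rewrite transfer-false-∷ʳ-false u us z (k ∘ (false ∷_)) a≡0
          | transfer-true-∷ʳ-false u us z (k ∘ (true ∷_)) a≡0
    = go (b u w) (∏ (b u) us) (k (false ∷ (zeros us ∷ʳ true)))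
    where
    go : ∀ p q r → p * (q * r) + + 1 * + 0 ≡ p * q * r
    go = ℤSolver.solve-∀

  -- Likewise if a u z = 0, for the first line u and the last line z.
  F₀-a-reduction : ∀ c u us z → a u z ≡ + 0 →
    F₀ c (u ∷ (us ∷ʳ z)) (zeros (u ∷ (us ∷ʳ z)))
      ≡ c u * c z * (∏ (b u) us * ∏ (λ w → b w z) us) * F₀ c us (zeros us)
  F₀-a-reduction c u us z a≡0
    rewrite zeros-∷ʳ us z
          | transfer-false-∷ʳ-false u us z (F₀ c (us ∷ʳ z)) a≡0
          | F₀-∷ʳ-true c us z (zeros us)
    = go (c u) (∏ (b u) us) (c z) (∏ (λ w → b w z) us) (F₀ c us (zeros us))
    where
    go : ∀ c p c' q f → c * (p * (c' * q * f)) ≡ c * c' * (p * q) * f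
    go = ℤSolver.solve-∀

  F₁-a-reduction : ∀ u us z → a u z ≡ + 0 →
    F₁ (u ∷ (us ∷ʳ z)) (zeros (u ∷ (us ∷ʳ z)))
      ≡ proj₁ u * proj₁ z * (∏ (b u) us * ∏ (λ w → b w z) us) * F₁ us (zeros us)
  F₁-a-reduction u us z a≡0
    rewrite zeros-∷ʳ us z
          | transfer-false-∷ʳ-false u us z (F₁ (us ∷ʳ z)) a≡0
          | F₁-∷ʳ-true us z (zeros us)
          | transfer-true-∷ʳ-false u us z (F₀ proj₁ (us ∷ʳ z)) a≡0
    = go (proj₁ u) (∏ (b u) us) (proj₁ z) (∏ (λ w → b w z) us) (F₁ us (zeros us))
    where
    go : ∀ c p c' q f → c * (p * (c' * q * f)) + + 1 * + 0 ≡ c * c' * (p * q) * f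
    go = ℤSolver.solve-∀

  -- Binary forms

  -- Form d: binary forms with d coefficients, i.e. of degree d ∸ 1.
  Form : ℕ → (ℤ → ℤ → ℤ) → Set
  Form zero    f = ∀ x y → f x y ≡ + 0
  Form (suc d) f = ∃₂ λ c g → Form d g × (∀ x y → f x y ≡ c * y ^ d + x * g x y)

  form-cong : ∀ {d f g} → (∀ x y → f x y ≡ g x y) → Form d f → Form d g
  form-cong {zero}  f≗g p             x y = trans (sym (f≗g x y)) (p x y)
  form-cong {suc d} f≗g (c , h , p , q) = c , h , p , λ x y → trans (sym (f≗g x y)) (q x y)

  form-+ : ∀ {d f g} → Form d f → Form d g → Form d (λ x y → f x y + g x y)
  form-+ {zero} p q x y = cong₂ _+_ (p x y) (q x y)
  form-+ {suc d} {f} {g} (c , f' , p , e) (c' , g' , p' , e') =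
    c + c' , (λ x y → f' x y + g' x y) , form-+ {d} p p' ,
    λ x y → trans (cong₂ _+_ (e x y) (e' x y)) (go c c' (y ^ d) x (f' x y) (g' x y))
    where
    go : ∀ c c' y x f g → c * y + x * f + (c' * y + x * g) ≡ (c + c') * y + x * (f + g)
    go = ℤSolver.solve-∀

  form-* : ∀ {d f} k → Form d f → Form d (λ x y → k * f x y)
  form-* {zero} k p x y = trans (cong (k *_) (p x y)) (ℤP.*-zeroʳ k)
  form-* {suc d} {f} k (c , f' , p , e) =
    k * c , (λ x y → k * f' x y) , form-* {d} k p ,
    λ x y → trans (cong (k *_) (e x y)) (go k c (y ^ d) x (f' x y))
    where
    go : ∀ k c y x f → k * (c * y + x * f) ≡ k * c * y + x * (k * f)
    go = ℤSolver.solve-∀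

  form-x : ∀ {d f} → Form d f → Form (suc d) (λ x y → x * f x y)
  form-x {d} {f} p = + 0 , f , p , λ x y → go (y ^ d) (x * f x y)
    where
    go : ∀ y t → t ≡ + 0 * y + t
    go = ℤSolver.solve-∀

  form-y : ∀ {d f} → Form d f → Form (suc d) (λ x y → y * f x y)
  form-y {zero} p = + 0 , (λ x y → + 0) , (λ x y → refl) ,
    λ x y → trans (cong (y *_) (p x y)) (go x y)
    where
    go : ∀ x y → y * + 0 ≡ + 0 * + 1 + x * + 0
    go = ℤSolver.solve-∀
  form-y {suc d} {f} (c , f' , p , e) = c , (λ x y → y * f' x y) , form-y {d} p ,
    λ x y → trans (cong (y *_) (e x y)) (go y c (y ^ d) x (f' x y))
    where
    go : ∀ y c z x f → y * (c * z + x * f) ≡ c * (y * z) + x * (y * f)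
    go = ℤSolver.solve-∀

  form-0 : ∀ d → Form d (λ x y → + 0)
  form-0 zero    x y = refl
  form-0 (suc d) = + 0 , (λ _ _ → + 0) , form-0 d , λ x y → go (y ^ d) x
    where
    go : ∀ y x → + 0 ≡ + 0 * y + x * + 0
    go = ℤSolver.solve-∀

  form-const : ∀ k → Form 1 (λ x y → k)
  form-const k = k , (λ _ _ → + 0) , (λ _ _ → refl) , λ x y → go k x
    where
    go : ∀ k x → k ≡ k * + 1 + x * + 0
    go = ℤSolver.solve-∀

  det : Line → Line → ℤ
  det (x , y) (x' , y') = x' * y - y' * x

  -- Division by the linear factor of a point, with remainder and without denominators: the factors
  -- `y₀ ^ d` and `y ^ d` make both sides homogeneous in each of the two points.
  form-divide : ∀ {d f} → Form (suc d) f → ∀ x₀ y₀ → ∃ λ g → Form d g ×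
    (∀ x y → y₀ ^ d * f x y ≡ det (x₀ , y₀) (x , y) * g x y + y ^ d * f x₀ y₀)
  form-divide {zero} {f} (c , g , p , e) x₀ y₀ = (λ _ _ → + 0) , (λ _ _ → refl) , λ x y → begin
    + 1 * f x y                                              ≡⟨ cong (+ 1 *_) (const x y) ⟩
    + 1 * c                                                  ≡⟨ go (det (x₀ , y₀) (x , y)) c ⟩
    det (x₀ , y₀) (x , y) * + 0 + + 1 * c                    ≡⟨ cong (λ t → det (x₀ , y₀) (x , y) * + 0 + + 1 * t) (const x₀ y₀) ⟨
    det (x₀ , y₀) (x , y) * + 0 + + 1 * f x₀ y₀              ∎
    where
    go : ∀ t c → + 1 * c ≡ t * + 0 + + 1 * c
    go = ℤSolver.solve-∀
    go′ : ∀ c x → c * + 1 + x * + 0 ≡ c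
    go′ = ℤSolver.solve-∀
    const : ∀ x y → f x y ≡ c
    const x y = trans (e x y) (trans (cong (λ t → c * + 1 + x * t) (p x y)) (go′ c x))
  form-divide {suc d} {f} (c , f' , p , e) x₀ y₀ with form-divide {d} {f'} p x₀ y₀
  -- The leading terms cancel. What remains, x y₀ times the division of `f'` minus x₀ y times its
  -- remainder, leaves `y ^ d * f' x₀ y₀` times x y₀ - y x₀, hence the first summand of the
  -- quotient.
  ... | g , q , e' = (λ x y → f' x₀ y₀ * y ^ d + x * (y₀ * g x y)) ,
    (f' x₀ y₀ , (λ x y → y₀ * g x y) , form-* {d} y₀ q , λ x y → refl) ,
    λ x y → begin
    y₀ * y₀ ^ d * f x y
      ≡⟨ cong (y₀ * y₀ ^ d *_) (e x y) ⟩
    y₀ * y₀ ^ d * (c * (y * y ^ d) + x * f' x y)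
      ≡⟨ split y₀ (y₀ ^ d) c (y * y ^ d) x (f' x y) ⟩
    y₀ * y₀ ^ d * (c * (y * y ^ d)) + y₀ * x * (y₀ ^ d * f' x y)
      ≡⟨ cong (λ t → y₀ * y₀ ^ d * (c * (y * y ^ d)) + y₀ * x * t) (e' x y) ⟩
    y₀ * y₀ ^ d * (c * (y * y ^ d)) + y₀ * x * (det (x₀ , y₀) (x , y) * g x y + y ^ d * f' x₀ y₀)
      ≡⟨ go x₀ y₀ x y (y₀ ^ d) (y ^ d) c (g x y) (f' x₀ y₀) ⟩
    det (x₀ , y₀) (x , y) * (f' x₀ y₀ * y ^ d + x * (y₀ * g x y)) + y * y ^ d * (c * (y₀ * y₀ ^ d) + x₀ * f' x₀ y₀)
      ≡⟨ cong (λ t → det (x₀ , y₀) (x , y) * (f' x₀ y₀ * y ^ d + x * (y₀ * g x y)) + y * y ^ d * t) (e x₀ y₀) ⟨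
    det (x₀ , y₀) (x , y) * (f' x₀ y₀ * y ^ d + x * (y₀ * g x y)) + y * y ^ d * f x₀ y₀ ∎
    where
    split : ∀ y₀ p c z x f → y₀ * p * (c * z + x * f) ≡ y₀ * p * (c * z) + y₀ * x * (p * f)
    split = ℤSolver.solve-∀
    go : ∀ x₀ y₀ x y p q c g f →
      y₀ * p * (c * (y * q)) + y₀ * x * ((x * y₀ - y * x₀) * g + q * f)
        ≡ (x * y₀ - y * x₀) * (f * q + x * (y₀ * g)) + y * q * (c * (y₀ * p) + x₀ * f)
    go = ℤSolver.solve-∀

  *-zero : ∀ {m n} → m ≢ + 0 → m * n ≡ + 0 → n ≡ + 0
  *-zero {m} {n} m≢0 mn≡0 with ℤP.i*j≡0⇒i≡0∨j≡0 m {n} mn≡0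
  ... | inj₁ m≡0 = contradiction m≡0 m≢0
  ... | inj₂ n≡0 = n≡0

  ^-nonzero : ∀ {m} d → m ≢ + 0 → m ^ d ≢ + 0
  ^-nonzero zero    m≢0 ()
  ^-nonzero {m} (suc d) m≢0 p = ^-nonzero d m≢0 (*-zero m≢0 p)

  -- One point is divided off at a time, and the nonzero determinants pass the other zeros on to the
  -- quotient. Ordinates must be nonzero because the powers of `y₀` from `form-divide` are
  -- cancelled.
  form-vanishes : ∀ {d f} → Form d f → ∀ pts → d ℕ.≤ length pts → All (λ (_ , y) → y ≢ + 0) pts →
    AllPairs (λ u w → det u w ≢ + 0) pts → All (λ (x , y) → f x y ≡ + 0) pts → ∀ x y → f x y ≡ + 0
  form-vanishes {zero} p pts _ _ _ _ = p
  form-vanishes {suc d} {f} p ((x₀ , y₀) ∷ pts) (s≤s d≤) (y₀≢0 ∷ ys) (dets ∷ ds) (f₀≡0 ∷ fs) x y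
    with form-divide {d} {f} p x₀ y₀
  ... | g , q , e = *-zero (^-nonzero d y₀≢0) (begin
    y₀ ^ d * f x y                      ≡⟨ quotient x y ⟩
    det (x₀ , y₀) (x , y) * g x y       ≡⟨ cong (det (x₀ , y₀) (x , y) *_) (g≡0 x y) ⟩
    det (x₀ , y₀) (x , y) * + 0         ≡⟨ ℤP.*-zeroʳ (det (x₀ , y₀) (x , y)) ⟩
    + 0                                 ∎)
    where
    go : ∀ t z → t + z * + 0 ≡ t
    go = ℤSolver.solve-∀
    quotient : ∀ x y → y₀ ^ d * f x y ≡ det (x₀ , y₀) (x , y) * g x y
    quotient x y = trans (e x y) (trans (cong (λ t → det (x₀ , y₀) (x , y) * g x y + y ^ d * t) f₀≡0)
      (go (det (x₀ , y₀) (x , y) * g x y) (y ^ d)))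
    root : ∀ {u : Line} → det (x₀ , y₀) u ≢ + 0 × f (proj₁ u) (proj₂ u) ≡ + 0 → g (proj₁ u) (proj₂ u) ≡ + 0
    root {x , y} (det≢0 , f≡0) = *-zero det≢0
      (trans (sym (quotient x y)) (trans (cong (y₀ ^ d *_) f≡0) (ℤP.*-zeroʳ (y₀ ^ d))))
    g≡0 : ∀ x y → g x y ≡ + 0
    g≡0 = form-vanishes {d} {g} q pts d≤ ys ds (All.map root (All.zip (dets , fs)))

  -- The degree count is made for a line with linear coordinates in x and y, so that it serves both
  -- the varying line and its image under `sw`.
  module _ (U : ℤ → ℤ → Line)
    (form-X : ∀ {d f} → Form d f → Form (suc d) (λ x y → proj₁ (U x y) * f x y))
    (form-Y : ∀ {d f} → Form d f → Form (suc d) (λ x y → proj₂ (U x y) * f x y)) where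

    form-a : ∀ {d f} w → Form d f → Form (suc d) (λ x y → a (U x y) w * f x y)
    form-a {d} {f} w@(x' , y') p = form-cong {suc d}
      (λ x y → go (proj₁ (U x y)) (proj₂ (U x y)) x' y' (f x y))
      (form-+ {suc d} (form-* {suc d} (x' + + 2 * y') (form-X {d} p)) (form-* {suc d} (+ 2 * x' + + 3 * y') (form-Y {d} p)))
      where
      go : ∀ x y x' y' f → (x' + + 2 * y') * (x * f) + (+ 2 * x' + + 3 * y') * (y * f) ≡ (x * x' + + 2 * (x * y' + y * x') + + 3 * (y * y')) * f
      go = ℤSolver.solve-∀

    form-b : ∀ {d f} w → Form d f → Form (suc d) (λ x y → b (U x y) w * f x y)
    form-b {d} {f} w@(x' , y') p = form-cong {suc d}
      (λ x y → go (proj₁ (U x y)) (proj₂ (U x y)) x' y' (f x y))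
      (form-+ {suc d} (form-* {suc d} (x' + y') (form-X {d} p)) (form-* {suc d} x' (form-Y {d} p)))
      where
      go : ∀ x y x' y' f → (x' + y') * (x * f) + x' * (y * f) ≡ (x * x' + (x * y' + y * x')) * f
      go = ℤSolver.solve-∀

    form-N : ∀ {d f} → Form d f → Form (suc (suc d)) (λ x y → N (U x y) * f x y)
    form-N {d} {f} p = form-cong {suc (suc d)}
      (λ x y → go (proj₁ (U x y)) (proj₂ (U x y)) (f x y))
      (form-+ {suc (suc d)} (form-X {suc d} (form-X {d} p))
        (form-* {suc (suc d)} (+ 3) (form-+ {suc (suc d)} (form-X {suc d} (form-Y {d} p)) (form-Y {suc d} (form-Y {d} p)))))
      where
      go : ∀ x y f → x * (x * f) + + 3 * (x * (y * f) + y * (y * f)) ≡ (x * x + + 3 * (x * y) + + 3 * (y * y)) * f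
      go = ℤSolver.solve-∀

    rowSize : Bool → ℕ → ℕ
    rowSize false m = m
    rowSize true  m = suc m

    -- A vertex has degree 1 in the row's line, except that a bend has degree 0 where the row sum
    -- rises and 2 where it falls. From 0 to 1 there is one more rise than falls, so the degree is
    -- one less than from 1 to 1.
    form-transfer : ∀ h us vs k → Form (rowSize h (length us)) (λ x y → transfer (U x y) h us vs k)
    form-transfer false [] [] k x y = refl
    form-transfer true  [] [] k = form-const (k [])
    form-transfer h [] (v ∷ vs) k = form-0 (rowSize h 0)
    form-transfer h (w ∷ us) [] k = form-0 (rowSize h (suc (length us)))
    form-transfer false (w ∷ us) (false ∷ vs) k = form-+ {suc (length us)}
      (form-b {length us} w (form-transfer false us vs _)) (form-* {suc (length us)} (+ 1) (form-transfer true us vs _))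
    form-transfer false (w ∷ us) (true ∷ vs) k = form-+ {suc (length us)}
      (form-a {length us} w (form-transfer false us vs _)) (form-0 (suc (length us)))
    form-transfer true (w ∷ us) (false ∷ vs) k = form-+ {suc (suc (length us))}
      (form-a {suc (length us)} w (form-transfer true us vs _)) (form-0 (suc (suc (length us))))
    form-transfer true (w ∷ us) (true ∷ vs) k = form-+ {suc (suc (length us))}
      (form-b {suc (length us)} w (form-transfer true us vs _))
      (form-cong {suc (suc (length us))} (λ x y → go (N w) (N (U x y)) (transfer (U x y) false us vs (λ t → k (false ∷ t))))
        (form-* {suc (suc (length us))} (N w) (form-N {length us} (form-transfer false us vs (λ t → k (false ∷ t))))))
      where
      go : ∀ n m f → n * (m * f) ≡ m * n * f
      go = ℤSolver.solve-∀

    form-F₁ : ∀ us vs → Form (suc (length us)) (λ x y → F₁ (U x y ∷ us) (false ∷ vs))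
    form-F₁ us vs = form-+ {suc (length us)}
      (form-X {length us} (form-transfer false us vs (F₁ us)))
      (form-* {suc (length us)} (+ 1) (form-transfer true us vs (F₀ proj₁ us)))

  -- The identity and its reductions

  one : Line → ℤ
  one _ = + 1

  Z₀ Z₁ : List Line → ℤ
  Z₀ us = F₀ one us (zeros us)
  Z₁ us = F₁ us (zeros us)

  -- Exchanges p and q, hence a and b.
  sw : Line → Line
  sw (x , y) = x + + 3 * y , - y

  -- ℓ = p + q.
  ℓ p : Line → ℤ
  ℓ (x , y) = + 2 * x + + 3 * y
  p u = proj₁ (sw u)

  a-sw : ∀ u w → a (sw u) (sw w) ≡ b u w
  a-sw (x , y) (x' , y') = go x y x' y'
    where
    go : ∀ x y x' y' → (x + + 3 * y) * (x' + + 3 * y') + + 2 * ((x + + 3 * y) * (- y') + (- y) * (x' + + 3 * y')) + + 3 * ((- y) * (- y'))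
      ≡ x * x' + (x * y' + y * x')
    go = ℤSolver.solve-∀

  b-sw : ∀ u w → b (sw u) (sw w) ≡ a u w
  b-sw (x , y) (x' , y') = go x y x' y'
    where
    go : ∀ x y x' y' → (x + + 3 * y) * (x' + + 3 * y') + ((x + + 3 * y) * (- y') + (- y) * (x' + + 3 * y'))
      ≡ x * x' + + 2 * (x * y' + y * x') + + 3 * (y * y')
    go = ℤSolver.solve-∀

  α-sw : ∀ u w → α (sw u) (sw w) ≡ α w u
  α-sw (x , y) (x' , y') = go x y x' y'
    where
    go : ∀ x y x' y' → (x + + 3 * y) * (x' + + 3 * y') + (+ 2 * ((x + + 3 * y) * (- y')) + (- y) * (x' + + 3 * y')) + + 3 * ((- y) * (- y'))
      ≡ x' * x + (+ 2 * (x' * y) + y' * x) + + 3 * (y' * y)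
    go = ℤSolver.solve-∀

  -- The point (p : q) = (1 : -1), up to a factor: its row has weights q and - p, and so signs at (1 , 0).
  ω : Line
  ω = -[1+ 2 ] , + 2

  a-ω : ∀ u → a u ω ≡ proj₁ u
  a-ω (x , y) = go x y
    where
    go : ∀ x y → x * -[1+ 2 ] + + 2 * (x * + 2 + y * -[1+ 2 ]) + + 3 * (y * + 2) ≡ x
    go = ℤSolver.solve-∀

  b-ω : ∀ u → b u ω ≡ - p u
  b-ω (x , y) = go x y
    where
    go : ∀ x y → x * -[1+ 2 ] + (x * + 2 + y * -[1+ 2 ]) ≡ - (x + + 3 * y)
    go = ℤSolver.solve-∀

  ℓℓ-b : ∀ u w → b u w ≡ + 0 → ℓ u * ℓ w ≡ p u * p w
  ℓℓ-b (x , y) (x' , y') b≡0 = trans (go x y x' y')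
    (trans (cong (λ t → (x + + 3 * y) * (x' + + 3 * y') + + 3 * t) b≡0) (ℤP.+-identityʳ ((x + + 3 * y) * (x' + + 3 * y'))))
    where
    go : ∀ x y x' y' → (+ 2 * x + + 3 * y) * (+ 2 * x' + + 3 * y')
      ≡ (x + + 3 * y) * (x' + + 3 * y') + + 3 * (x * x' + (x * y' + y * x'))
    go = ℤSolver.solve-∀

  ℓℓ-a : ∀ u w → a u w ≡ + 0 → ℓ u * ℓ w ≡ proj₁ u * proj₁ w
  ℓℓ-a (x , y) (x' , y') a≡0 = trans (go x y x' y')
    (trans (cong (λ t → x * x' + + 3 * t) a≡0) (ℤP.+-identityʳ (x * x')))
    where
    go : ∀ x y x' y' → (+ 2 * x + + 3 * y) * (+ 2 * x' + + 3 * y')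
      ≡ x * x' + + 3 * (x * x' + + 2 * (x * y' + y * x') + + 3 * (y * y'))
    go = ℤSolver.solve-∀

  ∏-cong : ∀ {f g} → (∀ u → f u ≡ g u) → ∀ us → ∏ f us ≡ ∏ g us
  ∏-cong f≗g []       = refl
  ∏-cong f≗g (u ∷ us) = cong₂ _*_ (f≗g u) (∏-cong f≗g us)

  ∏-map : ∀ f g us → ∏ f (map g us) ≡ ∏ (f ∘ g) us
  ∏-map f g []       = refl
  ∏-map f g (u ∷ us) = cong (f (g u) *_) (∏-map f g us)

  ∏-↭ : ∀ f {us ws} → us ↭ ws → ∏ f us ≡ ∏ f ws
  ∏-↭ f _↭_.refl = refl
  ∏-↭ f (prep u q) = cong (f u *_) (∏-↭ f q)
  ∏-↭ f (swap u w q) = trans (cong (λ t → f u * (f w * t)) (∏-↭ f q)) (go (f u) (f w) _)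
    where
    go : ∀ m n t → m * (n * t) ≡ n * (m * t)
    go m n t = trans (sym (ℤP.*-assoc m n t)) (trans (cong (_* t) (ℤP.*-comm m n)) (ℤP.*-assoc n m t))
  ∏-↭ f (_↭_.trans q r) = trans (∏-↭ f q) (∏-↭ f r)

  even odd : List Line → ℤ
  even us = ∏ ℓ us * Z₀ (us ∷ʳ ω)
  odd us = ∏ p us * Z₁ us + ∏ proj₁ us * Z₁ (map sw us)

  Balanced : List Line → Set
  Balanced us = even us ≡ odd us

  -- For natural j all values of `α` among these lines and ω are nonzero, in either order, and j ≡ 0
  -- modulo s makes the line congruent to `pt 0`, where all weights are 1.
  pt : ℕ → Line
  pt j = + 1 , + j

  Node : Line → Set
  Node u = (∃ λ j → u ≡ pt j) ⊎ u ≡ ω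

  α-pt : ∀ i j → α (pt i) (pt j) ≡ + suc (2 ℕ.* j ℕ.+ i ℕ.+ 3 ℕ.* (i ℕ.* j))
  α-pt i j = trans (go (+ i) (+ j)) (cong (λ t → + 1 + t) (cong₂ _+_
    (cong (λ t → t + + i) (sym (ℤP.pos-* 2 j)))
    (trans (cong (+ 3 *_) (sym (ℤP.pos-* i j))) (sym (ℤP.pos-* 3 (i ℕ.* j))))))
    where
    go : ∀ i j → + 1 * + 1 + (+ 2 * (+ 1 * j) + i * + 1) + + 3 * (i * j) ≡ + 1 + (+ 2 * j + i + + 3 * (i * j))
    go = ℤSolver.solve-∀

  α-pt-ω : ∀ j → α (pt j) ω ≡ + suc (3 ℕ.* j)
  α-pt-ω j = trans (go (+ j)) (cong (λ t → + 1 + t) (sym (ℤP.pos-* 3 j)))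
    where
    go : ∀ j → + 1 * -[1+ 2 ] + (+ 2 * (+ 1 * + 2) + j * -[1+ 2 ]) + + 3 * (j * + 2) ≡ + 1 + + 3 * j
    go = ℤSolver.solve-∀

  α-ω-pt : ∀ j → α ω (pt j) ≡ -[1+ 0 ]
  α-ω-pt j = go (+ j)
    where
    go : ∀ j → -[1+ 2 ] * + 1 + (+ 2 * (-[1+ 2 ] * j) + + 2 * + 1) + + 3 * (+ 2 * j) ≡ -[1+ 0 ]
    go = ℤSolver.solve-∀

  α-node : ∀ {u w} → Node u → Node w → α u w ≢ + 0
  α-node (inj₁ (i , refl)) (inj₁ (j , refl)) α≡0 with () ← trans (sym (α-pt i j)) α≡0
  α-node (inj₁ (i , refl)) (inj₂ refl)       α≡0 with () ← trans (sym (α-pt-ω i)) α≡0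
  α-node (inj₂ refl)       (inj₁ (j , refl)) α≡0 with () ← trans (sym (α-ω-pt j)) α≡0
  α-node (inj₂ refl)       (inj₂ refl)       ()

  SwNode : Line → Set
  SwNode u = ∃ λ w → Node w × u ≡ sw w

  α-swNode : ∀ {u w} → SwNode u → SwNode w → α u w ≢ + 0
  α-swNode (u , nu , refl) (w , nw , refl) α≡0 = α-node nw nu (trans (sym (α-sw u w)) α≡0)

  swNodes : ∀ {us} → All Node us → All SwNode (map sw us)
  swNodes ns = AllP.map⁺ (All.map (λ {u} n → u , n , refl) ns)

  Z₀-↭ : ∀ {us ws} u → us ↭ ws → All Node us → Z₀ (u ∷ us) ≡ Z₀ (u ∷ ws)
  Z₀-↭ u q ns = perm-zeros {F₀ one} (F₀-exchange one) α-node q ns (u ∷ [])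

  Z₁-↭ : ∀ {us ws} u → us ↭ ws → All Node us → Z₁ (u ∷ us) ≡ Z₁ (u ∷ ws)
  Z₁-↭ u q ns = perm-zeros {F₁} F₁-exchange α-node q ns (u ∷ [])

  Z₁-sw-↭ : ∀ {us ws} u → us ↭ ws → All Node us → Z₁ (u ∷ map sw us) ≡ Z₁ (u ∷ map sw ws)
  Z₁-sw-↭ u q ns = perm-zeros {F₁} F₁-exchange α-swNode (Perm.map⁺ sw q) (swNodes ns) (u ∷ [])

  -- Nothing is known about `α` for `u`, which will be a zero of a or b, so `u` stays in front and
  -- only the nodes behind it are permuted.
  balanced-↭ : ∀ {us ws} u → us ↭ ws → All Node us → Balanced (u ∷ ws) → Balanced (u ∷ us)
  balanced-↭ {us} {ws} u q ns bal = begin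
    ℓ u * ∏ ℓ us * Z₀ (u ∷ (us ∷ʳ ω))
      ≡⟨ cong₂ (λ s t → ℓ u * s * t) (∏-↭ ℓ q) (Z₀-↭ u (Perm.++⁺ʳ (ω ∷ []) q) (AllP.++⁺ ns (inj₂ refl ∷ []))) ⟩
    ℓ u * ∏ ℓ ws * Z₀ (u ∷ (ws ∷ʳ ω))
      ≡⟨ bal ⟩
    p u * ∏ p ws * Z₁ (u ∷ ws) + proj₁ u * ∏ proj₁ ws * Z₁ (sw u ∷ map sw ws)
      ≡⟨ cong₂ _+_ (cong₂ (λ s t → p u * s * t) (∏-↭ p q) (Z₁-↭ u q ns))
                   (cong₂ (λ s t → proj₁ u * s * t) (∏-↭ proj₁ q) (Z₁-sw-↭ (sw u) q ns)) ⟨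
    p u * ∏ p us * Z₁ (u ∷ us) + proj₁ u * ∏ proj₁ us * Z₁ (sw u ∷ map sw us) ∎

  -- Since `sw` exchanges a and b, the last term reduces by `F₁-a-reduction`, after `sw w` is moved
  -- to the end; the other two terms reduce by the b-reductions.
  balanced-b : ∀ u w us → b u w ≡ + 0 → All Node (w ∷ us) → Balanced us → Balanced (u ∷ w ∷ us)
  balanced-b u w us b≡0 ns bal = begin
    ℓ u * (ℓ w * L) * Z₀ (u ∷ w ∷ (us ∷ʳ ω))
      ≡⟨ cong (ℓ u * (ℓ w * L) *_) (trans (F₀-b-reduction one u w (us ∷ʳ ω) b≡0)
           (cong₂ (λ s t → + 1 * + 1 * (s * t) * z₀) (edge u) (edge w))) ⟩
    ℓ u * (ℓ w * L) * (+ 1 * + 1 * ((P * x) * (Q * x')) * z₀)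
      ≡⟨ go₁ (ℓ u) (ℓ w) L P x Q x' z₀ ⟩
    (ℓ u * ℓ w) * (P * x * (Q * x')) * (L * z₀)
      ≡⟨ cong₂ (λ s t → s * (P * x * (Q * x')) * t) (ℓℓ-b u w b≡0) bal ⟩
    (p u * p w) * (P * x * (Q * x')) * (∏ p us * Z₁ us + ∏ proj₁ us * Z₁ (map sw us))
      ≡⟨ go₂ (p u) (p w) P x Q x' (∏ p us) (Z₁ us) (∏ proj₁ us) (Z₁ (map sw us)) ⟩
    p u * (p w * ∏ p us) * (x * x' * (P * Q) * Z₁ us) + x * (x' * ∏ proj₁ us) * (p u * p w * (P * Q) * Z₁ (map sw us))
      ≡⟨ cong₂ (λ s t → p u * (p w * ∏ p us) * s + x * (x' * ∏ proj₁ us) * t) (F₁-b-reduction u w us b≡0) swapped ⟨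
    p u * (p w * ∏ p us) * Z₁ (u ∷ w ∷ us) + x * (x' * ∏ proj₁ us) * Z₁ (sw u ∷ sw w ∷ map sw us) ∎
    where
    L P Q x x' z₀ : ℤ
    L  = ∏ ℓ us
    P  = ∏ (a u) us
    Q  = ∏ (a w) us
    x  = proj₁ u
    x' = proj₁ w
    z₀ = Z₀ (us ∷ʳ ω)
    edge : ∀ v → ∏ (a v) (us ∷ʳ ω) ≡ ∏ (a v) us * proj₁ v
    edge v = trans (∏-∷ʳ (a v) us ω) (cong (∏ (a v) us *_) (a-ω v))
    swapped : Z₁ (sw u ∷ sw w ∷ map sw us) ≡ p u * p w * (P * Q) * Z₁ (map sw us)
    swapped = begin
      Z₁ (sw u ∷ map sw (w ∷ us))           ≡⟨ Z₁-sw-↭ (sw u) (Perm.∷↭∷ʳ w us) ns ⟩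
      Z₁ (sw u ∷ map sw (us ∷ʳ w))          ≡⟨ cong (λ t → Z₁ (sw u ∷ t)) (ListP.map-++ sw us (w ∷ [])) ⟩
      Z₁ (sw u ∷ (map sw us ∷ʳ sw w))       ≡⟨ F₁-a-reduction (sw u) (map sw us) (sw w) (trans (a-sw u w) b≡0) ⟩
      p u * p w * (∏ (b (sw u)) (map sw us) * ∏ (λ v → b v (sw w)) (map sw us)) * Z₁ (map sw us)
        ≡⟨ cong₂ (λ s t → p u * p w * (s * t) * Z₁ (map sw us))
             (trans (∏-map (b (sw u)) sw us) (∏-cong (b-sw u) us))
             (trans (∏-map (λ v → b v (sw w)) sw us) (∏-cong (λ v → trans (b-sw v w) (a-comm v w)) us)) ⟩
      p u * p w * (P * Q) * Z₁ (map sw us) ∎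
    go₁ : ∀ l m L P x Q x' z → l * (m * L) * (+ 1 * + 1 * ((P * x) * (Q * x')) * z) ≡ (l * m) * (P * x * (Q * x')) * (L * z)
    go₁ = ℤSolver.solve-∀
    go₂ : ∀ p q P x Q x' m z n z' → (p * q) * (P * x * (Q * x')) * (m * z + n * z')
      ≡ p * (q * m) * (x * x' * (P * Q) * z) + x * (x' * n) * (p * q * (P * Q) * z')
    go₂ = ℤSolver.solve-∀

  -- The mirror image of `balanced-b`. The weights `- p u` and `- p w` at ω occur together, so their
  -- signs cancel.
  balanced-a : ∀ u us w → a u w ≡ + 0 → All Node (us ∷ʳ w) → Balanced us → Balanced (u ∷ (us ∷ʳ w))
  balanced-a u us w a≡0 ns bal = begin
    ℓ u * ∏ ℓ (us ∷ʳ w) * Z₀ (u ∷ ((us ∷ʳ w) ∷ʳ ω))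
      ≡⟨ cong₂ (λ s t → ℓ u * s * t) (∏-∷ʳ ℓ us w) (trans reorder (trans (F₀-a-reduction one u (us ∷ʳ ω) w a≡0)
           (cong₂ (λ s t → + 1 * + 1 * (s * t) * z₀) edge₁ edge₂))) ⟩
    ℓ u * (L * ℓ w) * (+ 1 * + 1 * ((P * - p u) * (Q * - p w)) * z₀)
      ≡⟨ go₁ (ℓ u) (ℓ w) L P (p u) Q (p w) z₀ ⟩
    (ℓ u * ℓ w) * (P * p u * (Q * p w)) * (L * z₀)
      ≡⟨ cong₂ (λ s t → s * (P * p u * (Q * p w)) * t) (ℓℓ-a u w a≡0) bal ⟩
    (x * x') * (P * p u * (Q * p w)) * (∏ p us * Z₁ us + ∏ proj₁ us * Z₁ (map sw us))
      ≡⟨ go₂ x x' P (p u) Q (p w) (∏ p us) (Z₁ us) (∏ proj₁ us) (Z₁ (map sw us)) ⟩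
    p u * (∏ p us * p w) * (x * x' * (P * Q) * Z₁ us) + x * (∏ proj₁ us * x') * (p u * p w * (P * Q) * Z₁ (map sw us))
      ≡⟨ cong₂ _+_ (cong₂ (λ s t → p u * s * t) (∏-∷ʳ p us w) (F₁-a-reduction u us w a≡0))
                   (cong₂ (λ s t → x * s * t) (∏-∷ʳ proj₁ us w) swapped) ⟨
    p u * ∏ p (us ∷ʳ w) * Z₁ (u ∷ (us ∷ʳ w)) + x * ∏ proj₁ (us ∷ʳ w) * Z₁ (sw u ∷ map sw (us ∷ʳ w)) ∎
    where
    L P Q x x' z₀ : ℤ
    L  = ∏ ℓ us
    P  = ∏ (b u) us
    Q  = ∏ (λ v → b v w) us
    x  = proj₁ u
    x' = proj₁ w
    z₀ = Z₀ (us ∷ʳ ω)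
    -- The reduction freezes the first line with the last, so `w` has to pass ω.
    reorder : Z₀ (u ∷ ((us ∷ʳ w) ∷ʳ ω)) ≡ Z₀ (u ∷ ((us ∷ʳ ω) ∷ʳ w))
    reorder = Z₀-↭ u (subst₂ _↭_ (sym (ListP.++-assoc us (w ∷ []) (ω ∷ []))) (sym (ListP.++-assoc us (ω ∷ []) (w ∷ [])))
      (Perm.++⁺ˡ us (swap w ω _↭_.refl))) (AllP.++⁺ ns (inj₂ refl ∷ []))
    edge₁ : ∏ (b u) (us ∷ʳ ω) ≡ P * - p u
    edge₁ = trans (∏-∷ʳ (b u) us ω) (cong (P *_) (b-ω u))
    edge₂ : ∏ (λ v → b v w) (us ∷ʳ ω) ≡ Q * - p w
    edge₂ = trans (∏-∷ʳ (λ v → b v w) us ω) (cong (Q *_) (trans (b-comm ω w) (b-ω w)))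
    swapped : Z₁ (sw u ∷ map sw (us ∷ʳ w)) ≡ p u * p w * (P * Q) * Z₁ (map sw us)
    swapped = begin
      Z₁ (sw u ∷ map sw (us ∷ʳ w))      ≡⟨ Z₁-sw-↭ (sw u) (↭-sym (Perm.∷↭∷ʳ w us)) ns ⟩
      Z₁ (sw u ∷ sw w ∷ map sw us)      ≡⟨ F₁-b-reduction (sw u) (sw w) (map sw us) (trans (b-sw u w) a≡0) ⟩
      p u * p w * (∏ (a (sw u)) (map sw us) * ∏ (a (sw w)) (map sw us)) * Z₁ (map sw us)
        ≡⟨ cong₂ (λ s t → p u * p w * (s * t) * Z₁ (map sw us))
             (trans (∏-map (a (sw u)) sw us) (∏-cong (a-sw u) us))
             (trans (∏-map (a (sw w)) sw us) (∏-cong (λ v → trans (a-sw w v) (b-comm w v)) us)) ⟩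
      p u * p w * (P * Q) * Z₁ (map sw us) ∎
    go₁ : ∀ l m L P x Q x' z → l * (L * m) * (+ 1 * + 1 * ((P * - x) * (Q * - x')) * z) ≡ (l * m) * (P * x * (Q * x')) * (L * z)
    go₁ = ℤSolver.solve-∀
    go₂ : ∀ x x' P p Q q m z n z' → (x * x') * (P * p * (Q * q)) * (m * z + n * z')
      ≡ p * (m * q) * (x * x' * (P * Q) * z) + x * (n * x') * (p * q * (P * Q) * z')
    go₂ = ℤSolver.solve-∀

  -- Interpolation

  -- The zeros of b _ (pt j) and a _ (pt j).
  rootᵇ rootᵃ : ℕ → Line
  rootᵇ j = -[1+ 0 ] , + 1 + + j
  rootᵃ j = - (+ 2 + + 3 * + j) , + 1 + + 2 * + j

  b-root : ∀ j → b (rootᵇ j) (pt j) ≡ + 0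
  b-root j = go (+ j)
    where
    go : ∀ j → -[1+ 0 ] * + 1 + (-[1+ 0 ] * j + (+ 1 + j) * + 1) ≡ + 0
    go = ℤSolver.solve-∀

  a-root : ∀ j → a (rootᵃ j) (pt j) ≡ + 0
  a-root j = go (+ j)
    where
    go : ∀ j → (- (+ 2 + + 3 * j)) * + 1 + + 2 * ((- (+ 2 + + 3 * j)) * j + (+ 1 + + 2 * j) * + 1) + + 3 * ((+ 1 + + 2 * j) * j) ≡ + 0
    go = ℤSolver.solve-∀

  ordinateᵃ≢0 : ∀ j → proj₂ (rootᵃ j) ≢ + 0
  ordinateᵃ≢0 j e with () ← trans (cong (λ t → + 1 + t) (ℤP.pos-* 2 j)) e

  difference≢0 : ∀ {i j} → i ≢ j → + j - + i ≢ + 0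
  difference≢0 {i} {j} i≢j e = i≢j (sym (ℤP.+-injective (ℤP.i-j≡0⇒i≡j (+ j) (+ i) e)))

  det-bb : ∀ {i j} → i ≢ j → det (rootᵇ i) (rootᵇ j) ≢ + 0
  det-bb {i} {j} i≢j e = difference≢0 i≢j (trans (sym (go (+ i) (+ j))) e)
    where
    go : ∀ i j → -[1+ 0 ] * (+ 1 + i) - (+ 1 + j) * -[1+ 0 ] ≡ j - i
    go = ℤSolver.solve-∀

  det-aa : ∀ {i j} → i ≢ j → det (rootᵃ i) (rootᵃ j) ≢ + 0
  det-aa {i} {j} i≢j e = difference≢0 i≢j (trans (sym (go (+ i) (+ j))) e)
    where
    go : ∀ i j → (- (+ 2 + + 3 * j)) * (+ 1 + + 2 * i) - (+ 1 + + 2 * j) * (- (+ 2 + + 3 * i)) ≡ j - i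
    go = ℤSolver.solve-∀

  det-ba : ∀ i j → det (rootᵇ i) (rootᵃ j) ≢ + 0
  det-ba i j e = contradiction (trans (sym value) e) λ ()
    where
    go : ∀ i j → (- (+ 2 + + 3 * j)) * (+ 1 + i) - (+ 1 + + 2 * j) * -[1+ 0 ] ≡ - (+ 1 + (+ 2 * i + j + + 3 * (i * j)))
    go = ℤSolver.solve-∀
    value : det (rootᵇ i) (rootᵃ j) ≡ -[1+ 2 ℕ.* i ℕ.+ j ℕ.+ 3 ℕ.* (i ℕ.* j) ]
    value = trans (go (+ i) (+ j)) (cong (λ t → - (+ 1 + t)) (cong₂ _+_
      (cong (λ t → t + + j) (sym (ℤP.pos-* 2 i)))
      (trans (cong (+ 3 *_) (sym (ℤP.pos-* i j))) (sym (ℤP.pos-* 3 (i ℕ.* j))))))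

  pick : ∀ {js : List ℕ} {j} → j ∈ js → ∃ λ js' → js ↭ j ∷ js'
  pick {js} {j} j∈ with ∈-∃++ j∈
  ... | ys , zs , refl = ys ++ zs , Perm.shift j ys zs

  unique-↭ : ∀ {is js : List ℕ} → is ↭ js → Unique is → Unique js
  unique-↭ q = PermS.Unique-resp-↭ (setoid ℕ) (↭⇒↭ₛ q)

  nodes : ∀ js → All Node (map pt js)
  nodes []       = []
  nodes (j ∷ js) = inj₁ (j , refl) ∷ nodes js

  excess : List Line → ℤ → ℤ → ℤ
  excess us x y = even ((x , y) ∷ us) + -[1+ 0 ] * odd ((x , y) ∷ us)

  excess-≡ : ∀ m n → m - n ≡ m + -[1+ 0 ] * n
  excess-≡ = ℤSolver.solve-∀

  excess⇒balanced : ∀ us x y → excess us x y ≡ + 0 → Balanced ((x , y) ∷ us)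
  excess⇒balanced us x y e = ℤP.i-j≡0⇒i≡j (even ((x , y) ∷ us)) (odd ((x , y) ∷ us))
    (trans (excess-≡ (even ((x , y) ∷ us)) (odd ((x , y) ∷ us))) e)

  balanced⇒excess : ∀ us x y → Balanced ((x , y) ∷ us) → excess us x y ≡ + 0
  balanced⇒excess us x y e = trans (sym (excess-≡ (even ((x , y) ∷ us)) (odd ((x , y) ∷ us))))
    (trans (cong (_- odd ((x , y) ∷ us)) e) (ℤP.i≡j⇒i-j≡0 {odd ((x , y) ∷ us)} refl))

  -- Each term has degree `length us + 1` in the first line, one of it from the prefactor. In `Z₀`
  -- its row starts at 0 but crosses the extra column ω; in `Z₁` it either starts at 0 with an extra
  -- factor from the zero diagonal entry, or starts at 1.
  form-excess : ∀ us → Form (suc (suc (length us))) (excess us)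
  form-excess us = form-+ {d} left (form-* {d} -[1+ 0 ] (form-+ {d} right₁ right₂))
    where
    d : ℕ
    d = suc (suc (length us))
    U : ℤ → ℤ → Line
    U x y = sw (x , y)
    form-p : ∀ {d f} → Form d f → Form (suc d) (λ x y → p (x , y) * f x y)
    form-p {d} {f} q = form-cong {suc d} (λ x y → go x y (f x y))
      (form-+ {suc d} (form-x {d} q) (form-* {suc d} (+ 3) (form-y {d} q)))
      where
      go : ∀ x y f → x * f + + 3 * (y * f) ≡ (x + + 3 * y) * f
      go = ℤSolver.solve-∀
    form-neg-y : ∀ {d f} → Form d f → Form (suc d) (λ x y → (- y) * f x y)
    form-neg-y {d} {f} q = form-cong {suc d} (λ x y → go y (f x y)) (form-* {suc d} -[1+ 0 ] (form-y {d} q))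
      where
      go : ∀ y f → -[1+ 0 ] * (y * f) ≡ (- y) * f
      go = ℤSolver.solve-∀
    form-Z₀ : Form (suc (length us)) (λ x y → Z₀ ((x , y) ∷ (us ∷ʳ ω)))
    form-Z₀ = subst (λ d → Form d (λ x y → Z₀ ((x , y) ∷ (us ∷ʳ ω)))) (ListP.length-++-comm us (ω ∷ []))
      (form-* {length (us ∷ʳ ω)} (+ 1)
        (form-transfer _,_ (λ {d} → form-x {d}) (λ {d} → form-y {d}) false (us ∷ʳ ω) (zeros (us ∷ʳ ω)) (F₀ one (us ∷ʳ ω))))
    left : Form d (λ x y → ∏ ℓ ((x , y) ∷ us) * Z₀ ((x , y) ∷ (us ∷ʳ ω)))
    left = form-cong {d} (λ x y → go x y (∏ ℓ us) (Z₀ ((x , y) ∷ (us ∷ʳ ω))))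
      (form-* {d} (∏ ℓ us) (form-+ {d} (form-* {d} (+ 2) (form-x {suc (length us)} form-Z₀)) (form-* {d} (+ 3) (form-y {suc (length us)} form-Z₀))))
      where
      go : ∀ x y L z → L * (+ 2 * (x * z) + + 3 * (y * z)) ≡ (+ 2 * x + + 3 * y) * L * z
      go = ℤSolver.solve-∀
    move : ∀ m p z → m * (p * z) ≡ p * m * z
    move = ℤSolver.solve-∀
    right₁ : Form d (λ x y → ∏ p ((x , y) ∷ us) * Z₁ ((x , y) ∷ us))
    right₁ = form-cong {d} (λ x y → move (∏ p us) (p (x , y)) (Z₁ ((x , y) ∷ us)))
      (form-* {d} (∏ p us) (form-p {suc (length us)}
        (form-F₁ _,_ (λ {d} → form-x {d}) (λ {d} → form-y {d}) us (zeros us))))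
    right₂ : Form d (λ x y → ∏ proj₁ ((x , y) ∷ us) * Z₁ (sw (x , y) ∷ map sw us))
    right₂ = form-cong {d} (λ x y → move (∏ proj₁ us) x (Z₁ (sw (x , y) ∷ map sw us)))
      (form-* {d} (∏ proj₁ us) (form-x {suc (length us)}
        (subst (λ m → Form (suc m) (λ x y → Z₁ (sw (x , y) ∷ map sw us))) (ListP.length-map sw us)
          (form-F₁ U (λ {d} → form-p {d}) (λ {d} → form-neg-y {d}) (map sw us) (zeros (map sw us))))))

  -- With 2n nodes besides `u`, the difference has degree 2n + 1 in `u` and each node supplies two
  -- zeros. The 4n zeros suffice from n = 1 on, and at each of them the identity for 2n - 1 lines is
  -- used.
  balanced : ∀ n js → length js ≡ n ℕ.+ n → Unique js → ∀ u → Balanced (u ∷ map pt js)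
  -- For a single line `Z₀` and both `Z₁` are 1, and the claim is ℓ = p + q.
  balanced zero [] _ _ u@(x , y) = go x y (b u ω)
    where
    go : ∀ x y b → (+ 2 * x + + 3 * y) * + 1 * (+ 1 * (b * + 0 + + 1 * (+ 1 * + 1)))
      ≡ (x + + 3 * y) * + 1 * (x * + 0 + + 1 * + 1) + x * + 1 * ((x + + 3 * y) * + 0 + + 1 * + 1)
    go = ℤSolver.solve-∀
  balanced (suc n) js len uniq (x , y) = excess⇒balanced (map pt js) x y
    (form-vanishes {suc (suc (length (map pt js)))} {excess (map pt js)} (form-excess (map pt js)) points enough
      (AllP.++⁺ (AllP.map⁺ (All.universal (λ _ ()) js)) (AllP.map⁺ (All.universal ordinateᵃ≢0 js)))
      (AllPairsP.++⁺ (AllPairsP.map⁺ (AllPairs.map det-bb uniq)) (AllPairsP.map⁺ (AllPairs.map det-aa uniq))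
        (AllP.map⁺ (All.universal (λ i → AllP.map⁺ (All.universal (det-ba i) js)) js)))
      (AllP.++⁺ (AllP.map⁺ (All.tabulate vanishᵇ)) (AllP.map⁺ (All.tabulate vanishᵃ)))
      x y)
    where
    points : List Line
    points = map rootᵇ js ++ map rootᵃ js
    enough : suc (suc (length (map pt js))) ℕ.≤ length points
    enough rewrite ListP.length-++ (map rootᵇ js) {map rootᵃ js} | ListP.length-map rootᵇ js | ListP.length-map rootᵃ js
                 | ListP.length-map pt js | len | ℕP.+-suc n n = s≤s (s≤s (ℕP.m≤n+m _ _))
    smaller : ∀ j js' → js ↭ j ∷ js' → Balanced (map pt js')
    smaller j js' q with unique-↭ q uniq | trans (sym (Perm.↭-length q)) len
    smaller j [] q          | _              | e with () ← trans (ℕP.suc-injective e) (ℕP.+-suc n n)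
    smaller j (i ∷ js'') q  | _ ∷ (_ ∷ uniq'') | e =
      balanced n js'' (ℕP.suc-injective (trans (ℕP.suc-injective e) (ℕP.+-suc n n))) uniq'' (pt i)
    vanishᵇ : ∀ {j} → j ∈ js → excess (map pt js) (proj₁ (rootᵇ j)) (proj₂ (rootᵇ j)) ≡ + 0
    vanishᵇ {j} j∈ with pick j∈
    ... | js' , q = balanced⇒excess (map pt js) (proj₁ (rootᵇ j)) (proj₂ (rootᵇ j))
      (balanced-↭ (rootᵇ j) (Perm.map⁺ pt q) (nodes js)
        (balanced-b (rootᵇ j) (pt j) (map pt js') (b-root j) (nodes (j ∷ js')) (smaller j js' q)))
    vanishᵃ : ∀ {j} → j ∈ js → excess (map pt js) (proj₁ (rootᵃ j)) (proj₂ (rootᵃ j)) ≡ + 0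
    vanishᵃ {j} j∈ with pick j∈
    ... | js' , q = balanced⇒excess (map pt js) (proj₁ (rootᵃ j)) (proj₂ (rootᵃ j))
      (balanced-↭ (rootᵃ j) q' (nodes js)
        (balanced-a (rootᵃ j) (map pt js') (pt j) (a-root j) (Perm.All-resp-↭ q' (nodes js)) (smaller j js' q)))
      where
      q' : map pt js ↭ map pt js' ∷ʳ pt j
      q' = ↭-trans (Perm.map⁺ pt q) (Perm.∷↭∷ʳ (pt j) (map pt js'))

  -- Specialisation to equal lines

  -- This replaces a limit: the state sums are polynomials with integer coefficients in the
  -- coordinates of the lines, so replacing lines by congruent ones changes them by a multiple of s.
  module Congruence (s : ℤ) where

    infix 4 _≈_ _≋_
    record _≈_ (m n : ℤ) : Set where
      constructor multiple
      field
        factor   : ℤ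
        equation : m ≡ n + factor * s

    ≈-refl : ∀ {m} → m ≈ m
    ≈-refl {m} = multiple (+ 0) (sym (ℤP.+-identityʳ m))

    ≈-+ : ∀ {m m' n n'} → m ≈ m' → n ≈ n' → m + n ≈ m' + n'
    ≈-+ {m} {m'} {n} {n'} (multiple k e) (multiple l f) = multiple (k + l) (trans (cong₂ _+_ e f) (go m' n' k l s))
      where
      go : ∀ m n k l s → m + k * s + (n + l * s) ≡ m + n + (k + l) * s
      go = ℤSolver.solve-∀

    ≈-* : ∀ {m m' n n'} → m ≈ m' → n ≈ n' → m * n ≈ m' * n'
    ≈-* {m} {m'} {n} {n'} (multiple k e) (multiple l f) =
      multiple (m' * l + k * n' + k * l * s) (trans (cong₂ _*_ e f) (go m' n' k l s))
      where
      go : ∀ m n k l s → (m + k * s) * (n + l * s) ≡ m * n + (m * l + k * n + k * l * s) * s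
      go = ℤSolver.solve-∀

    ≈-neg : ∀ {m n} → m ≈ n → - m ≈ - n
    ≈-neg {m} {n} (multiple k e) = multiple (- k) (trans (cong -_ e) (go n k s))
      where
      go : ∀ n k s → - (n + k * s) ≡ - n + (- k) * s
      go = ℤSolver.solve-∀

    ≈-transport : ∀ {m m' n n'} → m ≈ m' → n ≈ n' → m ≡ n → m' ≈ n'
    ≈-transport {m} {m'} {n} {n'} (multiple k e) (multiple l f) m≡n = multiple (l - k) (begin
      m'                     ≡⟨ go₁ m' k s ⟩
      m' + k * s - k * s     ≡⟨ cong (_- k * s) (trans (sym e) (trans m≡n f)) ⟩
      n' + l * s - k * s     ≡⟨ go₂ n' k l s ⟩
      n' + (l - k) * s       ∎)
      where
      go₁ : ∀ m k s → m ≡ m + k * s - k * s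
      go₁ = ℤSolver.solve-∀
      go₂ : ∀ n k l s → n + l * s - k * s ≡ n + (l - k) * s
      go₂ = ℤSolver.solve-∀

    record _≋_ (u w : Line) : Set where
      constructor _∥_
      field
        x≈ : proj₁ u ≈ proj₁ w
        y≈ : proj₂ u ≈ proj₂ w
    open _≋_

    ≋-refl : ∀ {u} → u ≋ u
    ≋-refl = ≈-refl ∥ ≈-refl


    ≈-a : ∀ {u u' w w'} → u ≋ u' → w ≋ w' → a u w ≈ a u' w'
    ≈-a (x ∥ y) (x' ∥ y') = ≈-+ (≈-+ (≈-* x x') (≈-* (≈-refl {+ 2}) (≈-+ (≈-* x y') (≈-* y x')))) (≈-* (≈-refl {+ 3}) (≈-* y y'))

    ≈-b : ∀ {u u' w w'} → u ≋ u' → w ≋ w' → b u w ≈ b u' w'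
    ≈-b (x ∥ y) (x' ∥ y') = ≈-+ (≈-* x x') (≈-+ (≈-* x y') (≈-* y x'))

    ≈-N : ∀ {u u'} → u ≋ u' → N u ≈ N u'
    ≈-N (x ∥ y) = ≈-+ (≈-+ (≈-* x x) (≈-* (≈-refl {+ 3}) (≈-* x y))) (≈-* (≈-refl {+ 3}) (≈-* y y))

    ≈-straight : ∀ {u u' w w'} → u ≋ u' → w ≋ w' → ∀ h v → straight u w h v ≈ straight u' w' h v
    ≈-straight u w false false = ≈-b u w
    ≈-straight u w false true  = ≈-a u w
    ≈-straight u w true  false = ≈-a u w
    ≈-straight u w true  true  = ≈-b u w

    ≈-bend : ∀ {u u' w w'} → u ≋ u' → w ≋ w' → ∀ h v → bend u w h v ≈ bend u' w' h v
    ≈-bend u w false false = ≈-refl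
    ≈-bend u w false true  = ≈-refl
    ≈-bend u w true  false = ≈-refl
    ≈-bend u w true  true  = ≈-* (≈-N u) (≈-N w)

    ≈-diag : ∀ {u u'} → u ≋ u' → ∀ v → diag u v ≈ diag u' v
    ≈-diag u false = ≈-refl
    ≈-diag u true  = ≈-N u

    ≈-transfer : ∀ {u u'} → u ≋ u' → ∀ {us us'} → Pointwise _≋_ us us' → ∀ {f g} → (∀ t → f t ≈ g t) →
      ∀ h vs → transfer u h us vs f ≈ transfer u' h us' vs g
    ≈-transfer u []       f≈g false []  = ≈-refl
    ≈-transfer u []       f≈g true  []  = f≈g []
    ≈-transfer u []       f≈g h (v ∷ vs) = ≈-refl
    ≈-transfer u (w ∷ us) f≈g h []       = ≈-refl
    ≈-transfer u (w ∷ us) f≈g h (v ∷ vs) = ≈-+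
      (≈-* (≈-straight u w h v) (≈-transfer u us (λ t → f≈g (v ∷ t)) h vs))
      (≈-* (≈-bend u w h v) (≈-transfer u us (λ t → f≈g (not v ∷ t)) (not h) vs))

    ≈-F₀ : ∀ {c} → (∀ {u u'} → u ≋ u' → c u ≈ c u') → ∀ {us us'} → Pointwise _≋_ us us' → ∀ vs → F₀ c us vs ≈ F₀ c us' vs
    ≈-F₀ c []       []       = ≈-refl
    ≈-F₀ c []       (v ∷ vs) = ≈-refl
    ≈-F₀ c (u ∷ us) []       = ≈-refl
    ≈-F₀ c (u ∷ us) (v ∷ vs) = ≈-* (c u) (≈-transfer u us (≈-F₀ c us) v vs)

    ≈-F₁ : ∀ {us us'} → Pointwise _≋_ us us' → ∀ vs → F₁ us vs ≈ F₁ us' vs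
    ≈-F₁ []       vs       = ≈-refl
    ≈-F₁ (u ∷ us) []       = ≈-refl
    ≈-F₁ (u ∷ us) (v ∷ vs) = ≈-+
      (≈-* (x≈ u) (≈-transfer u us (≈-F₁ us) v vs))
      (≈-* (≈-diag u v) (≈-transfer u us (≈-F₀ x≈ us) (not v) vs))

    ≈-∏ : ∀ {c} → (∀ {u u'} → u ≋ u' → c u ≈ c u') → ∀ {us us'} → Pointwise _≋_ us us' → ∏ c us ≈ ∏ c us'
    ≈-∏ c []       = ≈-refl
    ≈-∏ c (u ∷ us) = ≈-* (c u) (≈-∏ c us)

    zeros-≋ : ∀ {us us'} → Pointwise _≋_ us us' → zeros us ≡ zeros us'
    zeros-≋ q = cong (λ m → replicate m false) (Pointwise.Pointwise-length q)

    ≋-sw : ∀ {u u'} → u ≋ u' → sw u ≋ sw u'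
    ≋-sw (x ∥ y) = ≈-+ x (≈-* (≈-refl {+ 3}) y) ∥ ≈-neg y

    ≈-Z₀ : ∀ {us us'} → Pointwise _≋_ us us' → Z₀ us ≈ Z₀ us'
    ≈-Z₀ {us' = us'} q rewrite zeros-≋ q = ≈-F₀ {one} (λ _ → ≈-refl) q (zeros us')

    ≈-Z₁ : ∀ {us us'} → Pointwise _≋_ us us' → Z₁ us ≈ Z₁ us'
    ≈-Z₁ {us' = us'} q rewrite zeros-≋ q = ≈-F₁ q (zeros us')

    ≈-even : ∀ {us us'} → Pointwise _≋_ us us' → even us ≈ even us'
    ≈-even q = ≈-* (≈-∏ (λ (x ∥ y) → ≈-+ (≈-* (≈-refl {+ 2}) x) (≈-* (≈-refl {+ 3}) y)) q)
      (≈-Z₀ (Pointwise.++⁺ q (≋-refl ∷ [])))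

    ≈-odd : ∀ {us us'} → Pointwise _≋_ us us' → odd us ≈ odd us'
    ≈-odd q = ≈-+
      (≈-* (≈-∏ (λ u → x≈ (≋-sw u)) q) (≈-Z₁ q))
      (≈-* (≈-∏ x≈ q) (≈-Z₁ (Pointwise.map⁺ sw sw (Pointwise.map ≋-sw q))))

  open Congruence using (_≈_)

  -- The modulus 1 + ∣m - n∣ exceeds the difference that it divides.
  ≈-all⇒≡ : ∀ m n → (∀ s → (_≈_ (+ suc s)) m n) → m ≡ n
  ≈-all⇒≡ m n m≈n with m≈n ∣ m - n ∣
  ... | Congruence.multiple k e = ℤP.i-j≡0⇒i≡j m n (ℤP.∣i∣≡0⇒i≡0 (small ∣ k ∣ size))
    where
    cancel : ∀ n t → n + t - n ≡ t
    cancel = ℤSolver.solve-∀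
    size : ∣ m - n ∣ ≡ ∣ k ∣ ℕ.* suc ∣ m - n ∣
    size = trans (cong ∣_∣ (trans (cong (_- n) e) (cancel n (k * + suc ∣ m - n ∣)))) (ℤP.abs-* k (+ suc ∣ m - n ∣))
    small : ∀ k {d} → d ≡ k ℕ.* suc d → d ≡ 0
    small zero    e = e
    small (suc k) {d} e = contradiction (ℕP.m≤m+n (suc d) (k ℕ.* suc d)) (ℕP.<⇒≱ (ℕP.≤-reflexive (cong suc (sym e))))

  unit : Line
  unit = pt 0

  spaced : ℕ → ℕ → List ℕ
  spaced s = applyUpTo (λ i → suc s ℕ.* suc i)

  spaced-unique : ∀ s m → Unique (spaced s m)
  spaced-unique s m = AllPairsP.applyUpTo⁺₁ (λ i → suc s ℕ.* suc i) m
    (λ i<j _ e → ℕP.<⇒≢ i<j (ℕP.suc-injective (ℕP.*-cancelˡ-≡ _ _ (suc s) e)))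

  spaced-≋ : ∀ s m (f : ℕ → ℕ) → Pointwise (Congruence._≋_ (+ suc s)) (map pt (applyUpTo (λ i → suc s ℕ.* f i) m)) (replicate m unit)
  spaced-≋ s zero    f = []
  spaced-≋ s (suc m) f = (Congruence.≈-refl (+ suc s) Congruence.∥ Congruence.multiple (+ f 0) shift) ∷ spaced-≋ s m (f ∘ suc)
    where
    shift : + (suc s ℕ.* f 0) ≡ + 0 + + f 0 * + suc s
    shift = trans (cong +_ (ℕP.*-comm (suc s) (f 0))) (trans (ℤP.pos-* (f 0) (suc s)) (sym (ℤP.+-identityˡ (+ f 0 * + suc s))))

  balanced-units : ∀ n → Balanced (replicate (suc (n ℕ.+ n)) unit)
  balanced-units n = ≈-all⇒≡ (even us) (odd us) close
    where
    us : List Line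
    us = replicate (suc (n ℕ.+ n)) unit
    close : ∀ s → (_≈_ (+ suc s)) (even us) (odd us)
    close s = ≈-transport (≈-even near) (≈-odd near)
      (balanced n (spaced s (n ℕ.+ n)) (ListP.length-applyUpTo _ (n ℕ.+ n)) (spaced-unique s (n ℕ.+ n)) unit)
      where
      open Congruence (+ suc s) hiding (_≈_)
      near : Pointwise _≋_ (unit ∷ map pt (spaced s (n ℕ.+ n))) us
      near = ≋-refl ∷ spaced-≋ s (n ℕ.+ n) suc

  ∏-replicate : ∀ f u m → ∏ f (replicate m u) ≡ f u ^ m
  ∏-replicate f u zero    = refl
  ∏-replicate f u (suc m) = cong (f u *_) (∏-replicate f u m)

  -- The line `unit` is fixed by `sw`, so the two terms on the right coincide and a factor 2
  -- cancels. ω moves to the front because `T` reads the first row.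
  units-relation : ∀ n → Z₁ (replicate (suc (n ℕ.+ n)) unit) ≡ (+ 2) ^ (n ℕ.+ n) * Z₀ (ω ∷ replicate (suc (n ℕ.+ n)) unit)
  units-relation n = sym (ℤP.*-cancelˡ-≡ (+ 2) ((+ 2) ^ (n ℕ.+ n) * Z₀ (ω ∷ us)) (Z₁ us) (begin
    + 2 * ((+ 2) ^ (n ℕ.+ n) * Z₀ (ω ∷ us))
      ≡⟨ ℤP.*-assoc (+ 2) ((+ 2) ^ (n ℕ.+ n)) (Z₀ (ω ∷ us)) ⟨
    (+ 2) ^ m * Z₀ (ω ∷ us)
      ≡⟨ cong₂ _*_ (sym (∏-replicate ℓ unit m)) (perm-zeros {F₀ one} (F₀-exchange one) α-node (Perm.∷↭∷ʳ ω us) (inj₂ refl ∷ nodes-us) []) ⟩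
    even us
      ≡⟨ balanced-units n ⟩
    ∏ p us * Z₁ us + ∏ proj₁ us * Z₁ (map sw us)
      ≡⟨ cong₂ (λ s t → s * Z₁ us + t) (trans (∏-replicate p unit m) (ℤP.^-zeroˡ m))
           (cong₂ _*_ (trans (∏-replicate proj₁ unit m) (ℤP.^-zeroˡ m)) (cong Z₁ (ListP.map-replicate sw m unit))) ⟩
    + 1 * Z₁ us + + 1 * Z₁ us
      ≡⟨ go (Z₁ us) ⟩
    + 2 * Z₁ us ∎))
    where
    m : ℕ
    m = suc (n ℕ.+ n)
    us : List Line
    us = replicate m unit
    nodes-us : All Node us
    nodes-us = AllP.replicate⁺ m (inj₁ (0 , refl))
    go : ∀ z → + 1 * z + + 1 * z ≡ + 2 * z
    go = ℤSolver.solve-∀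

  -- Sums over matrices

  private variable
    X Y : Set

  ∑ : List X → (X → ℤ) → ℤ
  ∑ xs f = sumℤ (map f xs)

  ∑-cong : ∀ (xs : List X) {f g} → (∀ x → f x ≡ g x) → ∑ xs f ≡ ∑ xs g
  ∑-cong []       f≗g = refl
  ∑-cong (x ∷ xs) f≗g = cong₂ _+_ (f≗g x) (∑-cong xs f≗g)

  ∑-++ : ∀ (xs ys : List X) (f : X → ℤ) → ∑ (xs ++ ys) f ≡ ∑ xs f + ∑ ys f
  ∑-++ []       ys f = sym (ℤP.+-identityˡ (∑ ys f))
  ∑-++ (x ∷ xs) ys f = trans (cong (λ t → f x + t) (∑-++ xs ys f)) (sym (ℤP.+-assoc (f x) (∑ xs f) (∑ ys f)))

  ∑-map : ∀ (g : X → Y) xs (f : Y → ℤ) → ∑ (map g xs) f ≡ ∑ xs (f ∘ g)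
  ∑-map g []       f = refl
  ∑-map g (x ∷ xs) f = cong (λ t → f (g x) + t) (∑-map g xs f)

  ∑-concatMap : ∀ (g : X → List Y) xs (f : Y → ℤ) → ∑ (concatMap g xs) f ≡ ∑ xs (λ x → ∑ (g x) f)
  ∑-concatMap g []       f = refl
  ∑-concatMap g (x ∷ xs) f = trans (∑-++ (g x) (concatMap g xs) f) (cong (λ t → ∑ (g x) f + t) (∑-concatMap g xs f))

  ∑-0 : ∀ (xs : List X) → ∑ xs (λ _ → + 0) ≡ + 0
  ∑-0 []       = refl
  ∑-0 (x ∷ xs) = trans (ℤP.+-identityˡ (∑ xs (λ _ → + 0))) (∑-0 xs)

  ∑-+ : ∀ (xs : List X) (f g : X → ℤ) → ∑ xs (λ x → f x + g x) ≡ ∑ xs f + ∑ xs g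
  ∑-+ []       f g = refl
  ∑-+ (x ∷ xs) f g = trans (cong (λ t → f x + g x + t) (∑-+ xs f g)) (go (f x) (g x) (∑ xs f) (∑ xs g))
    where
    go : ∀ a b c d → a + b + (c + d) ≡ a + c + (b + d)
    go = ℤSolver.solve-∀

  ∑-*ˡ : ∀ (xs : List X) c (f : X → ℤ) → ∑ xs (λ x → c * f x) ≡ c * ∑ xs f
  ∑-*ˡ []       c f = sym (ℤP.*-zeroʳ c)
  ∑-*ˡ (x ∷ xs) c f = trans (cong (λ t → c * f x + t) (∑-*ˡ xs c f)) (sym (ℤP.*-distribˡ-+ c (f x) (∑ xs f)))

  ∑-*ʳ : ∀ (xs : List X) c (f : X → ℤ) → ∑ xs (λ x → f x * c) ≡ ∑ xs f * c
  ∑-*ʳ xs c f = trans (∑-cong xs (λ x → ℤP.*-comm (f x) c)) (trans (∑-*ˡ xs c f) (ℤP.*-comm c (∑ xs f)))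

  ∑-swap : ∀ (xs : List X) (ys : List Y) (f : X → Y → ℤ) → ∑ xs (λ x → ∑ ys (f x)) ≡ ∑ ys (λ y → ∑ xs (λ x → f x y))
  ∑-swap []       ys f = sym (∑-0 ys)
  ∑-swap (x ∷ xs) ys f = trans (cong (λ t → ∑ ys (f x) + t) (∑-swap xs ys f)) (sym (∑-+ ys (f x) (λ y → ∑ xs (λ x → f x y))))

  𝟙 : Bool → ℤ
  𝟙 false = + 0
  𝟙 true  = + 1

  𝟙-∧ : ∀ p q → 𝟙 (p ∧ q) ≡ 𝟙 p * 𝟙 q
  𝟙-∧ false q = refl
  𝟙-∧ true  q = sym (ℤP.*-identityˡ (𝟙 q))

  ∑-filter : ∀ {P : X → Set} (P? : ∀ x → Dec (P x)) xs (f : X → ℤ) → ∑ (filter P? xs) f ≡ ∑ xs (λ x → 𝟙 (does (P? x)) * f x)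
  ∑-filter P? []       f = refl
  ∑-filter P? (x ∷ xs) f with does (P? x)
  ... | true  = cong₂ _+_ (sym (ℤP.*-identityˡ (f x))) (∑-filter P? xs f)
  ... | false = trans (∑-filter P? xs f) (sym (ℤP.+-identityˡ (∑ xs (λ x → 𝟙 (does (P? x)) * f x))))

  length-∑ : ∀ (xs : List X) → + length xs ≡ ∑ xs (λ _ → + 1)
  length-∑ []       = refl
  length-∑ (x ∷ xs) = cong (λ t → + 1 + t) (length-∑ xs)

  ∑-allFuns : ∀ n (xs : List X) (F : Vector X (suc n) → ℤ) → ∑ (allFuns (suc n) xs) F ≡ ∑ xs (λ x → ∑ (allFuns n xs) (λ f → F (x VF.∷ f)))
  ∑-allFuns n xs F = trans (∑-concatMap (λ x → map (λ f → x VF.∷ f) (allFuns n xs)) xs F)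
    (∑-cong xs (λ x → ∑-map (λ f → x VF.∷ f) (allFuns n xs) F))

  Array : ℕ → ℕ → Set
  Array k m = Fin k → Fin m → ℤ

  -- Splitting and reassembling an array changes it only up to pointwise equality, which a summand
  -- has to respect explicitly.
  Extensional : ∀ {k m} → (Array k m → ℤ) → Set
  Extensional F = ∀ A B → (∀ i j → A i j ≡ B i j) → F A ≡ F B

  -- `allFuns` only splits off rows. Splitting off the first column too lets a symmetric matrix be
  -- peeled hook by hook.
  ∑-columns : ∀ k m xs (F : Array k (suc m) → ℤ) → Extensional F →
    ∑ (allFuns k (allFuns (suc m) xs)) F
      ≡ ∑ (allFuns k xs) (λ c → ∑ (allFuns k (allFuns m xs)) (λ B → F (λ i → c i VF.∷ B i)))
  ∑-columns zero m xs F ext = trans (cong (λ t → t + + 0) (trans (ext _ _ (λ ())) (sym (ℤP.+-identityʳ _)))) refl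
  ∑-columns (suc k) m xs F ext = begin
    ∑ (allFuns (suc k) (allFuns (suc m) xs)) F
      ≡⟨ ∑-allFuns k (allFuns (suc m) xs) F ⟩
    ∑ (allFuns (suc m) xs) (λ r → ∑ (allFuns k (allFuns (suc m) xs)) (λ A → F (r VF.∷ A)))
      ≡⟨ ∑-allFuns m xs (λ r → ∑ (allFuns k (allFuns (suc m) xs)) (λ A → F (r VF.∷ A))) ⟩
    ∑ xs (λ x → ∑ (allFuns m xs) (λ r → ∑ (allFuns k (allFuns (suc m) xs)) (λ A → F ((x VF.∷ r) VF.∷ A))))
      ≡⟨ ∑-cong xs (λ x → ∑-cong (allFuns m xs) (λ r → ∑-columns k m xs (λ A → F ((x VF.∷ r) VF.∷ A))
           (λ A B A≗B → ext _ _ (λ { zero j → refl ; (suc i) j → A≗B i j })))) ⟩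
    ∑ xs (λ x → ∑ (allFuns m xs) (λ r → ∑ (allFuns k xs) (λ c → ∑ (allFuns k (allFuns m xs))
      (λ B → F ((x VF.∷ r) VF.∷ (λ i → c i VF.∷ B i))))))
      ≡⟨ ∑-cong xs (λ x → ∑-swap (allFuns m xs) (allFuns k xs)
           (λ r c → ∑ (allFuns k (allFuns m xs)) (λ B → F ((x VF.∷ r) VF.∷ (λ i → c i VF.∷ B i))))) ⟩
    ∑ xs (λ x → ∑ (allFuns k xs) (λ c → ∑ (allFuns m xs) (λ r → ∑ (allFuns k (allFuns m xs))
      (λ B → F ((x VF.∷ r) VF.∷ (λ i → c i VF.∷ B i))))))
      ≡⟨ ∑-cong xs (λ x → ∑-cong (allFuns k xs) (λ c → ∑-cong (allFuns m xs) (λ r → ∑-cong (allFuns k (allFuns m xs))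
           (λ B → ext _ _ (λ { zero zero → refl ; zero (suc j) → refl ; (suc i) zero → refl ; (suc i) (suc j) → refl }))))) ⟩
    ∑ xs (λ x → ∑ (allFuns k xs) (λ c → ∑ (allFuns m xs) (λ r → ∑ (allFuns k (allFuns m xs))
      (λ B → F (λ i → (x VF.∷ c) i VF.∷ (r VF.∷ B) i)))))
      ≡⟨ ∑-cong xs (λ x → ∑-cong (allFuns k xs) (λ c → ∑-allFuns k (allFuns m xs) (λ B → F (λ i → (x VF.∷ c) i VF.∷ B i)))) ⟨
    ∑ xs (λ x → ∑ (allFuns k xs) (λ c → ∑ (allFuns (suc k) (allFuns m xs)) (λ B → F (λ i → (x VF.∷ c) i VF.∷ B i))))
      ≡⟨ ∑-allFuns k xs (λ c → ∑ (allFuns (suc k) (allFuns m xs)) (λ B → F (λ i → c i VF.∷ B i))) ⟨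
    ∑ (allFuns (suc k) xs) (λ c → ∑ (allFuns (suc k) (allFuns m xs)) (λ B → F (λ i → c i VF.∷ B i))) ∎

  -- Recognising symmetric matrices by partial sums, one hook at a time.

  entries : List ℤ
  entries = -[1+ 0 ] ∷ + 0 ∷ + 1 ∷ []

  -- The partial sum after adding an entry, when it stays in {0, 1}; otherwise the default z.
  step : X → Bool → ℤ → (Bool → X) → X
  step z false (+ 0)    k = k false
  step z false (+ 1)    k = k true
  step z true  (+ 0)    k = k true
  step z true  -[1+ 0 ] k = k false
  step z _     _        k = z

  line : Bool → List ℤ → Bool
  line h []       = h
  line h (x ∷ xs) = step false h x (λ h' → line h' xs)

  -- The default `z` is a parameter so that one recursion serves as a test, with `false`, and as a
  -- sum, with `+ 0`; `steps-map` relates the two.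
  steps : ∀ {k} → X → Vec Bool k → Vector ℤ k → (Vec Bool k → X) → X
  steps z []       r K = K []
  steps z (v ∷ vs) r K = step z v (r zero) (λ v' → steps z vs (r ∘ suc) (λ vs' → K (v' ∷ vs')))

  -- `d` is the budget of nonzero diagonal entries; the final test `none` demands that it is used
  -- up.
  spend : ℕ → ℤ → (ℕ → Bool) → Bool
  spend d       (+ 0) K = K d
  spend zero    _     K = false
  spend (suc d) _     K = K d

  agree : ∀ {k} → Vector ℤ k → Vector ℤ k → Bool
  agree {zero}  r c = true
  agree {suc k} r c = does (r zero ≟ c zero) ∧ agree (r ∘ suc) (c ∘ suc)

  none : ℕ → Bool
  none zero    = true
  none (suc d) = false

  -- chk d v A: A is symmetric with exactly d nonzero diagonal entries, and v i followed by row i of A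
  -- has all partial sums in {0, 1} and total 1.
  chk : ∀ {m} → ℕ → Vec Bool m → Matrix m → Bool
  chk d []       A = none d
  chk d (v ∷ vs) A =
    line v (tabulate (A zero)) ∧ (agree (λ j → A zero (suc j)) (λ i → A (suc i) zero) ∧
      steps false vs (λ j → A zero (suc j)) (λ vs' → spend d (A zero zero) (λ d' → chk d' vs' (λ i j → A (suc i) (suc j)))))

  step-cong : ∀ (z : X) v x {K L : Bool → X} → (∀ t → K t ≡ L t) → step z v x K ≡ step z v x L
  step-cong z false (+ 0)                 K≗L = K≗L false
  step-cong z false (+ 1)                 K≗L = K≗L true
  step-cong z false (+ suc (suc _))       K≗L = refl
  step-cong z false -[1+ _ ]              K≗L = refl
  step-cong z true  (+ 0)                 K≗L = K≗L true
  step-cong z true  (+ suc _)             K≗L = refl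
  step-cong z true  -[1+ 0 ]              K≗L = K≗L false
  step-cong z true  -[1+ suc _ ]          K≗L = refl

  steps-cong : ∀ {k} (z : X) (vs : Vec Bool k) {r s : Vector ℤ k} {K L : Vec Bool k → X} →
    (∀ i → r i ≡ s i) → (∀ t → K t ≡ L t) → steps z vs r K ≡ steps z vs s L
  steps-cong z []       r≗s K≗L = K≗L []
  steps-cong z (v ∷ vs) {r} {s} r≗s K≗L rewrite r≗s zero =
    step-cong z v (s zero) (λ v' → steps-cong z vs (r≗s ∘ suc) (λ t → K≗L (v' ∷ t)))

  agree-cong : ∀ {k} {r s c d : Vector ℤ k} → (∀ i → r i ≡ s i) → (∀ i → c i ≡ d i) → agree r c ≡ agree s d
  agree-cong {zero}  r≗s c≗d = refl
  agree-cong {suc k} r≗s c≗d = cong₂ _∧_ (cong₂ (λ x y → does (x ≟ y)) (r≗s zero) (c≗d zero)) (agree-cong (r≗s ∘ suc) (c≗d ∘ suc))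

  spend-cong : ∀ d x {K L : ℕ → Bool} → (∀ t → K t ≡ L t) → spend d x K ≡ spend d x L
  spend-cong d       (+ 0)     K≗L = K≗L d
  spend-cong zero    (+ suc _) K≗L = refl
  spend-cong zero    -[1+ _ ]  K≗L = refl
  spend-cong (suc d) (+ suc _) K≗L = K≗L d
  spend-cong (suc d) -[1+ _ ]  K≗L = K≗L d

  chk-cong : ∀ {m} d (vs : Vec Bool m) {A B : Matrix m} → (∀ i j → A i j ≡ B i j) → chk d vs A ≡ chk d vs B
  chk-cong d []       A≗B = refl
  chk-cong d (v ∷ vs) {A} {B} A≗B rewrite A≗B zero zero =
    cong₂ _∧_ (cong (λ t → line v (B zero zero ∷ t)) (ListP.tabulate-cong (λ j → A≗B zero (suc j))))
      (cong₂ _∧_ (agree-cong (λ j → A≗B zero (suc j)) (λ i → A≗B (suc i) zero))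
        (steps-cong false vs (λ j → A≗B zero (suc j)) (λ vs' →
          spend-cong d (B zero zero) (λ d' → chk-cong d' vs' (λ i j → A≗B (suc i) (suc j))))))

  step-map : ∀ (f : X → Y) z v x K → f (step z v x K) ≡ step (f z) v x (f ∘ K)
  step-map f z false (+ 0)           K = refl
  step-map f z false (+ 1)           K = refl
  step-map f z false (+ suc (suc _)) K = refl
  step-map f z false -[1+ _ ]        K = refl
  step-map f z true  (+ 0)           K = refl
  step-map f z true  (+ suc _)       K = refl
  step-map f z true  -[1+ 0 ]        K = refl
  step-map f z true  -[1+ suc _ ]    K = refl

  steps-map : ∀ {k} (f : X → Y) z (vs : Vec Bool k) r K → f (steps z vs r K) ≡ steps (f z) vs r (f ∘ K)
  steps-map f z []       r K = refl
  steps-map f z (v ∷ vs) r K = trans (step-map f z v (r zero) _)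
    (step-cong (f z) v (r zero) (λ v' → steps-map f z vs (r ∘ suc) (λ vs' → K (v' ∷ vs'))))

  -- Here `steps-map` is applied to steps with values in X → ℤ, since evaluation at `x` and
  -- summation over `xs` are both maps out of that type.
  steps-∑ : ∀ {k} (xs : List X) (vs : Vec Bool k) r (K : X → Vec Bool k → ℤ) →
    ∑ xs (λ x → steps (+ 0) vs r (K x)) ≡ steps (+ 0) vs r (λ t → ∑ xs (λ x → K x t))
  steps-∑ xs vs r K = begin
    ∑ xs (λ x → steps (+ 0) vs r (K x))
      ≡⟨ ∑-cong xs (λ x → sym (steps-map (λ k → k x) (λ _ → + 0) vs r (λ t x → K x t))) ⟩
    ∑ xs (steps (λ _ → + 0) vs r (λ t x → K x t))
      ≡⟨ steps-map (∑ xs) (λ _ → + 0) vs r (λ t x → K x t) ⟩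
    steps (∑ xs (λ _ → + 0)) vs r (λ t → ∑ xs (λ x → K x t))
      ≡⟨ cong (λ z → steps z vs r (λ t → ∑ xs (λ x → K x t))) (∑-0 xs) ⟩
    steps (+ 0) vs r (λ t → ∑ xs (λ x → K x t)) ∎

  -- Exactly one column over `entries` agrees with `r` unless `r` has other entries, and in that
  -- case `steps` falls back to 0 anyway. Symmetry thus removes the sum over the first column.
  ∑-agree : ∀ {k} (vs : Vec Bool k) r K → ∑ (allFuns k entries) (λ c → 𝟙 (agree r c)) * steps (+ 0) vs r K ≡ steps (+ 0) vs r K
  ∑-agree {zero}  []       r K = ℤP.*-identityˡ (K [])
  ∑-agree {suc k} (v ∷ vs) r K rewrite ∑-allFuns k entries (λ c → 𝟙 (agree r c)) = go v (r zero) refl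
    where
    S : ℤ
    S = ∑ (allFuns k entries) (λ c → 𝟙 (agree (r ∘ suc) c))
    sum : ℤ → ℤ
    sum x = ∑ entries (λ y → ∑ (allFuns k entries) (λ c → 𝟙 (does (x ≟ y) ∧ agree (r ∘ suc) c)))
    first : sum -[1+ 0 ] ≡ S
    first rewrite ∑-0 (allFuns k entries) = ℤP.+-identityʳ S
    second : sum (+ 0) ≡ S
    second rewrite ∑-0 (allFuns k entries) = trans (ℤP.+-identityˡ (S + + 0)) (ℤP.+-identityʳ S)
    third : sum (+ 1) ≡ S
    third rewrite ∑-0 (allFuns k entries) = trans (ℤP.+-identityˡ (+ 0 + (S + + 0))) (trans (ℤP.+-identityˡ (S + + 0)) (ℤP.+-identityʳ S))
    rest : Bool → ℤ
    rest v' = steps (+ 0) vs (r ∘ suc) (λ vs' → K (v' ∷ vs'))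
    finish : ∀ {x} v' → sum x ≡ S → sum x * rest v' ≡ rest v'
    finish v' e = trans (cong (_* rest v') e) (∑-agree vs (r ∘ suc) (λ vs' → K (v' ∷ vs')))
    go : ∀ v x → x ≡ r zero → sum x * step (+ 0) v x rest ≡ step (+ 0) v x rest
    go false (+ 0)           _ = finish {+ 0} false second
    go false (+ 1)           _ = finish {+ 1} true third
    go false (+ suc (suc n)) _ = ℤP.*-zeroʳ (sum (+ suc (suc n)))
    go false -[1+ n ]        _ = ℤP.*-zeroʳ (sum -[1+ n ])
    go true  (+ 0)           _ = finish {+ 0} true second
    go true  (+ suc n)       _ = ℤP.*-zeroʳ (sum (+ suc n))
    go true  -[1+ 0 ]        _ = finish { -[1+ 0 ] } false first
    go true  -[1+ suc n ]    _ = ℤP.*-zeroʳ (sum -[1+ suc n ])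

  -- From matrix sums to state sums at equal lines.

  units : ℕ → List Line
  units m = replicate m unit

  summand : ∀ {k} → Bool → Vec Bool k → (Vec Bool k → ℤ) → Vector ℤ k → ℤ
  summand h vs K r = 𝟙 (line h (tabulate r)) * steps (+ 0) vs r K

  private
    -- The summands belong to the entries -1, 0 and 1 in this order. `combine` is for the case that
    -- -1 contributes nothing, `combine′` for the case that 1 does not.
    combine : ∀ {p q r} s t {p' q'} → p ≡ + 0 → q ≡ s * p' → r ≡ t * q' → p + (q + (r + + 0)) ≡ s * p' + t * q'
    combine s t {p'} {q'} refl refl refl = go (s * p') (t * q')
      where
      go : ∀ m n → + 0 + (m + (n + + 0)) ≡ m + n
      go = ℤSolver.solve-∀

    combine′ : ∀ {p q r} s t {p' q'} → p ≡ t * q' → q ≡ s * p' → r ≡ + 0 → p + (q + (r + + 0)) ≡ s * p' + t * q'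
    combine′ s t {p'} {q'} refl refl refl = go (s * p') (t * q')
      where
      go : ∀ m n → n + (m + (+ 0 + + 0)) ≡ m + n
      go = ℤSolver.solve-∀

  ∑-zero : ∀ {X : Set} (xs : List X) {f} → (∀ x → f x ≡ + 0) → ∑ xs f ≡ + 0
  ∑-zero xs f≗0 = trans (∑-cong xs f≗0) (∑-0 xs)

  1* : ∀ {m n} → m ≡ n → m ≡ + 1 * n
  1* {n = n} e = trans e (sym (ℤP.*-identityˡ n))

  transfer-∑ : ∀ {k} h (vs : Vec Bool k) K →
    ∑ (allFuns k entries) (summand h vs (K ∘ toList)) ≡ transfer unit h (units k) (toList vs) K
  transfer-∑ {zero}  false [] K = refl
  transfer-∑ {zero}  true  [] K = trans (ℤP.+-identityʳ (+ 1 * K [])) (ℤP.*-identityˡ (K []))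
  transfer-∑ {suc k} false (false ∷ vs) K = trans (∑-allFuns k entries (summand false (false ∷ vs) (K ∘ toList)))
    (combine (+ 1) (+ 1) (∑-0 (allFuns k entries))
      (1* (transfer-∑ false vs (K ∘ (false ∷_)))) (1* (transfer-∑ true vs (K ∘ (true ∷_)))))
  transfer-∑ {suc k} false (true ∷ vs) K = trans (∑-allFuns k entries (summand false (true ∷ vs) (K ∘ toList)))
    (combine (+ 1) (+ 0) {q' = transfer unit true (units k) (toList vs) (K ∘ (false ∷_))} (∑-0 (allFuns k entries))
      (1* (transfer-∑ false vs (K ∘ (true ∷_)))) (∑-zero (allFuns k entries) (λ r → ℤP.*-zeroʳ (𝟙 (line true (tabulate r))))))
  transfer-∑ {suc k} true (false ∷ vs) K = trans (∑-allFuns k entries (summand true (false ∷ vs) (K ∘ toList)))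
    (combine (+ 1) (+ 0) {q' = transfer unit false (units k) (toList vs) (K ∘ (true ∷_))}
      (∑-zero (allFuns k entries) (λ r → ℤP.*-zeroʳ (𝟙 (line false (tabulate r)))))
      (1* (transfer-∑ true vs (K ∘ (false ∷_)))) (∑-0 (allFuns k entries)))
  transfer-∑ {suc k} true (true ∷ vs) K = trans (∑-allFuns k entries (summand true (true ∷ vs) (K ∘ toList)))
    (combine′ (+ 1) (+ 1) (1* (transfer-∑ false vs (K ∘ (false ∷_)))) (1* (transfer-∑ true vs (K ∘ (true ∷_))))
      (∑-0 (allFuns k entries)))

  -- The `suc` accounts for the diagonal zero that precedes `r`, so the exponent is `T` of the full
  -- row. In the row of ω a 0 before the 1 weighs b = -1 and a 0 after it a = 1; there are T - 2 of
  -- the former, which gives the same sign.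
  sgn : ∀ {k} → Bool → Vector ℤ k → ℤ
  sgn false r = -[1+ 0 ] ^ suc (firstOne r)
  sgn true  r = + 1

  summandω : ∀ {k} → Bool → (Vec Bool k → ℤ) → Vector ℤ k → ℤ
  summandω {k} h K r = 𝟙 (line h (tabulate r)) * sgn h r * steps (+ 0) (Vec.replicate k false) r K

  transferω-∑ : ∀ k h K → ∑ (allFuns k entries) (summandω h (K ∘ toList)) ≡ transfer ω h (units k) (toList (Vec.replicate k false)) K
  transferω-∑ zero    false K = refl
  transferω-∑ zero    true  K = trans (ℤP.+-identityʳ (+ 1 * K [])) (ℤP.*-identityˡ (K []))
  transferω-∑ (suc k) false K = trans (∑-allFuns k entries (summandω false (K ∘ toList)))
    (combine -[1+ 0 ] (+ 1) (∑-0 (allFuns k entries))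
      (trans (∑-cong (allFuns k entries) (λ r → go (𝟙 (line false (tabulate r))) (sgn false r)
               (steps (+ 0) (Vec.replicate k false) r (λ t → K (false ∷ toList t)))))
        (trans (∑-*ˡ (allFuns k entries) -[1+ 0 ] (summandω false (λ t → K (false ∷ toList t))))
          (cong (-[1+ 0 ] *_) (transferω-∑ k false (K ∘ (false ∷_))))))
      (1* (transferω-∑ k true (K ∘ (true ∷_)))))
    where
    go : ∀ l s t → l * (-[1+ 0 ] * s) * t ≡ -[1+ 0 ] * (l * s * t)
    go = ℤSolver.solve-∀
  transferω-∑ (suc k) true K = trans (∑-allFuns k entries (summandω true (K ∘ toList)))
    (combine (+ 1) (+ 0) {q' = transfer ω false (units k) (toList (Vec.replicate k false)) (K ∘ (true ∷_))}
      (∑-zero (allFuns k entries) (λ r → ℤP.*-zeroʳ (𝟙 (line false (tabulate r)) * + 1)))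
      (1* (transferω-∑ k true (K ∘ (false ∷_)))) (∑-0 (allFuns k entries)))

  corner : ∀ {m} → ℕ → ℤ → Vec Bool m → ℤ
  corner {m} d x vs = ∑ (allMatrices m) (λ B → 𝟙 (spend d x (λ d' → chk d' vs B)))

  -- Summation over the first hook and then over the remaining minor. A free weight `g` of the first
  -- row lets the same computation serve the plain count and the count with (-1)^T.
  chk-∑ : ∀ m d v (vs : Vec Bool m) (g : Vector ℤ (suc m) → ℤ) → (∀ r s → (∀ i → r i ≡ s i) → g r ≡ g s) →
    ∑ (allMatrices (suc m)) (λ A → 𝟙 (chk d (v ∷ vs) A) * g (A zero))
      ≡ ∑ entries (λ x → ∑ (allFuns m entries) (λ r →
          𝟙 (line v (x ∷ tabulate r)) * g (x VF.∷ r) * steps (+ 0) vs r (corner d x)))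
  chk-∑ m d v vs g g-cong = begin
    ∑ (allMatrices (suc m)) F
      ≡⟨ ∑-allFuns m (allFuns (suc m) entries) F ⟩
    ∑ (allFuns (suc m) entries) (λ r → ∑ (allFuns m (allFuns (suc m) entries)) (λ A → F (r VF.∷ A)))
      ≡⟨ ∑-allFuns m entries (λ r → ∑ (allFuns m (allFuns (suc m) entries)) (λ A → F (r VF.∷ A))) ⟩
    ∑ entries (λ x → ∑ (allFuns m entries) (λ r → ∑ (allFuns m (allFuns (suc m) entries)) (λ A → F ((x VF.∷ r) VF.∷ A))))
      ≡⟨ ∑-cong entries (λ x → ∑-cong (allFuns m entries) (λ r → first-row x r)) ⟩
    ∑ entries (λ x → ∑ (allFuns m entries) (λ r →
      𝟙 (line v (x ∷ tabulate r)) * g (x VF.∷ r) * steps (+ 0) vs r (corner d x))) ∎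
    where
    F : Matrix (suc m) → ℤ
    F A = 𝟙 (chk d (v ∷ vs) A) * g (A zero)
    F-cong : ∀ A B → (∀ i j → A i j ≡ B i j) → F A ≡ F B
    F-cong A B A≗B = cong₂ (λ p q → 𝟙 p * q) (chk-cong d (v ∷ vs) A≗B) (g-cong _ _ (A≗B zero))
    rearrange : ∀ l a s g → l * (a * s) * g ≡ l * g * (a * s)
    rearrange = ℤSolver.solve-∀
    first-row : ∀ x r → ∑ (allFuns m (allFuns (suc m) entries)) (λ A → F ((x VF.∷ r) VF.∷ A)) ≡
      𝟙 (line v (x ∷ tabulate r)) * g (x VF.∷ r) * steps (+ 0) vs r (corner d x)
    first-row x r = begin
      ∑ (allFuns m (allFuns (suc m) entries)) (λ A → F ((x VF.∷ r) VF.∷ A))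
        ≡⟨ ∑-columns m m entries (λ A → F ((x VF.∷ r) VF.∷ A))
             (λ A B A≗B → F-cong ((x VF.∷ r) VF.∷ A) ((x VF.∷ r) VF.∷ B) (λ { zero j → refl ; (suc i) j → A≗B i j })) ⟩
      ∑ columns (λ c → ∑ minors (λ B → 𝟙 (L ∧ (agree r c ∧ S B)) * G))
        ≡⟨ ∑-cong columns (λ c → begin
             ∑ minors (λ B → 𝟙 (L ∧ (agree r c ∧ S B)) * G)
               ≡⟨ ∑-cong minors (λ B → begin
                    𝟙 (L ∧ (agree r c ∧ S B)) * G
                      ≡⟨ cong (_* G) (trans (𝟙-∧ L (agree r c ∧ S B)) (cong (𝟙 L *_) (trans (𝟙-∧ (agree r c) (S B))
                           (cong (𝟙 (agree r c) *_) (steps-map 𝟙 false vs r (λ vs' → spend d x (λ d' → chk d' vs' B))))))) ⟩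
                    𝟙 L * (𝟙 (agree r c) * S′ B) * G
                      ≡⟨ rearrange (𝟙 L) (𝟙 (agree r c)) (S′ B) G ⟩
                    𝟙 L * G * (𝟙 (agree r c) * S′ B) ∎) ⟩
             ∑ minors (λ B → 𝟙 L * G * (𝟙 (agree r c) * S′ B))
               ≡⟨ ∑-*ˡ minors (𝟙 L * G) (λ B → 𝟙 (agree r c) * S′ B) ⟩
             𝟙 L * G * ∑ minors (λ B → 𝟙 (agree r c) * S′ B)
               ≡⟨ cong (𝟙 L * G *_) (trans (∑-*ˡ minors (𝟙 (agree r c)) S′)
                    (cong (𝟙 (agree r c) *_) (steps-∑ minors vs r (λ B vs' → 𝟙 (spend d x (λ d' → chk d' vs' B)))))) ⟩
             𝟙 L * G * (𝟙 (agree r c) * steps (+ 0) vs r (corner d x)) ∎) ⟩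
      ∑ columns (λ c → 𝟙 L * G * (𝟙 (agree r c) * steps (+ 0) vs r (corner d x)))
        ≡⟨ ∑-*ˡ columns (𝟙 L * G) (λ c → 𝟙 (agree r c) * steps (+ 0) vs r (corner d x)) ⟩
      𝟙 L * G * ∑ columns (λ c → 𝟙 (agree r c) * steps (+ 0) vs r (corner d x))
        ≡⟨ cong (𝟙 L * G *_) (trans (∑-*ʳ columns (steps (+ 0) vs r (corner d x)) (λ c → 𝟙 (agree r c)))
             (∑-agree vs r (corner d x))) ⟩
      𝟙 L * G * steps (+ 0) vs r (corner d x) ∎
      where
      columns : List (Vector ℤ m)
      columns = allFuns m entries
      minors : List (Matrix m)
      minors = allMatrices m
      L : Bool
      L = line v (x ∷ tabulate r)
      G : ℤ
      G = g (x VF.∷ r)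
      S : Matrix m → Bool
      S B = steps false vs r (λ vs' → spend d x (λ d' → chk d' vs' B))
      S′ : Matrix m → ℤ
      S′ B = steps (+ 0) vs r (λ vs' → 𝟙 (spend d x (λ d' → chk d' vs' B)))

  steps-zero : ∀ {k} (vs : Vec Bool k) r {K : Vec Bool k → ℤ} → (∀ t → K t ≡ + 0) → steps (+ 0) vs r K ≡ + 0
  steps-zero vs r {K} K≗0 = trans (steps-cong (+ 0) vs (λ _ → refl) K≗0) (sym (steps-map (λ _ → + 0) (+ 0) vs r K))

  corner-zero : ∀ {m} (vs : Vec Bool m) r (x : ℤ) c → (∀ t → corner 0 x t ≡ + 0) → c * steps (+ 0) vs r (corner 0 x) ≡ + 0
  corner-zero vs r x c e = trans (cong (c *_) (steps-zero vs r e)) (ℤP.*-zeroʳ c)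

  chk-∑₁ : ∀ m d v (vs : Vec Bool m) → ∑ (allMatrices (suc m)) (λ A → 𝟙 (chk d (v ∷ vs) A))
    ≡ ∑ entries (λ x → ∑ (allFuns m entries) (λ r → 𝟙 (line v (x ∷ tabulate r)) * + 1 * steps (+ 0) vs r (corner d x)))
  chk-∑₁ m d v vs = trans
    (∑-cong (allMatrices (suc m)) (λ A → sym (ℤP.*-identityʳ (𝟙 (chk d (v ∷ vs) A)))))
    (chk-∑ m d v vs (λ _ → + 1) (λ _ _ _ → refl))

  unit-transfer : ∀ {m} h (vs : Vec Bool m) {G : Vec Bool m → ℤ} (K : List Bool → ℤ) → (∀ t → G t ≡ K (toList t)) →
    ∑ (allFuns m entries) (λ r → 𝟙 (line h (tabulate r)) * + 1 * steps (+ 0) vs r G) ≡ transfer unit h (units m) (toList vs) K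
  unit-transfer {m} h vs K G≗K = trans
    (∑-cong (allFuns m entries) (λ r → cong₂ _*_ (ℤP.*-identityʳ (𝟙 (line h (tabulate r)))) (steps-cong (+ 0) vs (λ _ → refl) G≗K)))
    (transfer-∑ h vs K)

  F₀-∑ : ∀ c → c unit ≡ + 1 → ∀ {m} (vs : Vec Bool m) →
    ∑ (allMatrices m) (λ A → 𝟙 (chk 0 vs A)) ≡ F₀ c (units m) (toList vs)
  F₀-∑ c c≡1 [] = refl
  F₀-∑ c c≡1 {suc m} (v ∷ vs) rewrite c≡1 = trans (chk-∑₁ m 0 v vs) (trans only-middle (1* middle))
    where
    xs : List (Vector ℤ m)
    xs = allFuns m entries
    nothing : ∀ x → (∀ t → corner {m} 0 x t ≡ + 0) →
      ∑ xs (λ r → 𝟙 (line v (x ∷ tabulate r)) * + 1 * steps (+ 0) vs r (corner 0 x)) ≡ + 0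
    nothing x e = ∑-zero xs (λ r → corner-zero vs r x (𝟙 (line v (x ∷ tabulate r)) * + 1) e)
    M : ℤ
    M = ∑ xs (λ r → 𝟙 (line v (+ 0 ∷ tabulate r)) * + 1 * steps (+ 0) vs r (corner 0 (+ 0)))
    only-middle : ∑ entries (λ x → ∑ xs (λ r → 𝟙 (line v (x ∷ tabulate r)) * + 1 * steps (+ 0) vs r (corner 0 x))) ≡ M
    only-middle rewrite nothing -[1+ 0 ] (λ t → ∑-0 (allMatrices m)) | nothing (+ 1) (λ t → ∑-0 (allMatrices m)) =
      trans (ℤP.+-identityˡ (M + + 0)) (ℤP.+-identityʳ M)
    keep : ∀ v (l : List ℤ) → line v (+ 0 ∷ l) ≡ line v l
    keep false l = refl
    keep true  l = refl
    middle : M ≡ transfer unit v (units m) (toList vs) (F₀ c (units m))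
    middle = trans (∑-cong xs (λ r → cong (λ t → 𝟙 t * + 1 * steps (+ 0) vs r (corner 0 (+ 0))) (keep v (tabulate r))))
      (unit-transfer v vs (F₀ c (units m)) (λ t → F₀-∑ c c≡1 t))

  F₁-∑ : ∀ {m} (vs : Vec Bool m) → ∑ (allMatrices m) (λ A → 𝟙 (chk 1 vs A)) ≡ F₁ (units m) (toList vs)
  F₁-∑ [] = refl
  F₁-∑ {suc m} (false ∷ vs) = trans (chk-∑₁ m 1 false vs)
    (combine (+ 1) (+ 1) (∑-0 (allFuns m entries))
      (1* (unit-transfer false vs (F₁ (units m)) F₁-∑))
      (1* (unit-transfer true vs (F₀ proj₁ (units m)) (F₀-∑ proj₁ refl))))
  F₁-∑ {suc m} (true ∷ vs) = trans (chk-∑₁ m 1 true vs)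
    (combine′ (+ 1) (+ 1)
      (1* (unit-transfer false vs (F₀ proj₁ (units m)) (F₀-∑ proj₁ refl)))
      (1* (unit-transfer true vs (F₁ (units m)) F₁-∑))
      (∑-0 (allFuns m entries)))

  firstOne-cong : ∀ {k} (r s : Vector ℤ k) → (∀ i → r i ≡ s i) → firstOne r ≡ firstOne s
  firstOne-cong {zero}  r s r≗s = refl
  firstOne-cong {suc k} r s r≗s with r zero ≟ + 1 | s zero ≟ + 1
  ... | yes _   | yes _   = refl
  ... | yes r≡1 | no s≢1  = contradiction (trans (sym (r≗s zero)) r≡1) s≢1
  ... | no r≢1  | yes s≡1 = contradiction (trans (r≗s zero) s≡1) r≢1
  ... | no _    | no _    = cong suc (firstOne-cong (r ∘ suc) (s ∘ suc) (r≗s ∘ suc))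

  toList-zeros : ∀ m → toList (Vec.replicate m false) ≡ zeros (units m)
  toList-zeros zero    = refl
  toList-zeros (suc m) = cong (false ∷_) (toList-zeros m)

  Z₁-∑ : ∀ m → ∑ (allMatrices m) (λ A → 𝟙 (chk 1 (Vec.replicate m false) A)) ≡ Z₁ (units m)
  Z₁-∑ m = trans (F₁-∑ (Vec.replicate m false)) (cong (F₁ (units m)) (toList-zeros m))

  Z₀-∑ : ∀ m → ∑ (allMatrices (suc m)) (λ A → 𝟙 (chk 0 (Vec.replicate (suc m) false) A) * (-[1+ 0 ] ^ T A)) ≡ Z₀ (ω ∷ units m)
  Z₀-∑ m = trans (chk-∑ m 0 false vs (λ r → -[1+ 0 ] ^ firstOne r) (λ r s e → cong (-[1+ 0 ] ^_) (firstOne-cong r s e)))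
    (trans (drop-ends (∑-0 xs) (∑-zero xs (λ r → corner-zero vs r (+ 1) (𝟙 (line true (tabulate r)) * -[1+ 0 ] ^ 1) (λ t → ∑-0 (allMatrices m)))))
      (1* (trans (∑-cong xs (λ r → cong (𝟙 (line false (tabulate r)) * sgn false r *_)
            (steps-cong (+ 0) vs (λ _ → refl) (F₀-∑ one refl))))
        (trans (transferω-∑ m false (F₀ one (units m))) (cong (λ t → transfer ω false (units m) t (F₀ one (units m))) (toList-zeros m))))))
    where
    xs : List (Vector ℤ m)
    xs = allFuns m entries
    vs : Vec Bool m
    vs = Vec.replicate m false
    drop-ends : ∀ {p q r} → p ≡ + 0 → r ≡ + 0 → p + (q + (r + + 0)) ≡ q
    drop-ends {q = q} refl refl = trans (ℤP.+-identityˡ (q + + 0)) (ℤP.+-identityʳ q)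

  -- Alternating lines and OSASMs

  -- The sign of the last nonzero entry when the partial sum is h.
  sign : Bool → ℤ
  sign false = -[1+ 0 ]
  sign true  = + 1

  missing : Bool → ℤ
  missing false = + 1
  missing true  = + 0

  -- `sign h` acts as a fictitious entry in front of `xs`, so that the start of a line, with partial
  -- sum 0, looks like a place after a -1.
  line⇒alternating : ∀ h xs → line h xs ≡ true → Alternating (sign h ∷ nonzeros xs) × sumℤ (nonzeros xs) ≡ missing h
  line⇒alternating true  [] refl = tt , refl
  line⇒alternating false (+ 0 ∷ xs) e = line⇒alternating false xs e
  line⇒alternating false (+ 1 ∷ xs) e with line⇒alternating true xs e
  ... | alt , total = (refl , alt) , cong (λ t → + 1 + t) total
  line⇒alternating true  (+ 0 ∷ xs) e = line⇒alternating true xs e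
  line⇒alternating true  (-[1+ 0 ] ∷ xs) e with line⇒alternating false xs e
  ... | alt , total = (refl , alt) , cong (λ t → -[1+ 0 ] + t) total
  line⇒alternating false [] ()
  line⇒alternating false (+ suc (suc _) ∷ xs) ()
  line⇒alternating false (-[1+ _ ] ∷ xs) ()
  line⇒alternating true (+ suc _ ∷ xs) ()
  line⇒alternating true (-[1+ suc _ ] ∷ xs) ()

  line⇒entries : ∀ h xs → line h xs ≡ true → All Entry xs
  line⇒entries h     []              e = []
  line⇒entries false (+ 0 ∷ xs)      e = inj₂ (inj₁ refl) ∷ line⇒entries false xs e
  line⇒entries false (+ 1 ∷ xs)      e = inj₂ (inj₂ refl) ∷ line⇒entries true xs e
  line⇒entries true  (+ 0 ∷ xs)      e = inj₂ (inj₁ refl) ∷ line⇒entries true xs e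
  line⇒entries true  (-[1+ 0 ] ∷ xs) e = inj₁ refl ∷ line⇒entries false xs e
  line⇒entries false (+ suc (suc _) ∷ xs) ()
  line⇒entries false (-[1+ _ ] ∷ xs) ()
  line⇒entries true (+ suc _ ∷ xs) ()
  line⇒entries true (-[1+ suc _ ] ∷ xs) ()

  alternating⇒line : ∀ h xs → All Entry xs → Alternating (sign h ∷ nonzeros xs) → sumℤ (nonzeros xs) ≡ missing h → line h xs ≡ true
  alternating⇒line true  []       []                        alt       total = refl
  alternating⇒line false (_ ∷ xs) (inj₂ (inj₁ refl) ∷ es)   alt       total = alternating⇒line false xs es alt total
  alternating⇒line true  (_ ∷ xs) (inj₂ (inj₁ refl) ∷ es)   alt       total = alternating⇒line true xs es alt total
  alternating⇒line false (_ ∷ xs) (inj₂ (inj₂ refl) ∷ es)   (_ , alt) total =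
    alternating⇒line true xs es alt (∙-cancelˡ (+ 1) (sumℤ (nonzeros xs)) (+ 0) total)
  alternating⇒line true  (_ ∷ xs) (inj₁ refl ∷ es)          (_ , alt) total =
    alternating⇒line false xs es alt (∙-cancelˡ -[1+ 0 ] (sumℤ (nonzeros xs)) (+ 1) total)
  alternating⇒line false (_ ∷ xs) (inj₁ refl ∷ es)          (() , _)  total
  alternating⇒line true  (_ ∷ xs) (inj₂ (inj₂ refl) ∷ es)   (() , _)  total

  alternating-sum : ∀ x xs → Alternating (x ∷ xs) → sumℤ (x ∷ xs) ≡ + 0 ⊎ sumℤ (x ∷ xs) ≡ x
  alternating-sum x []       alt = inj₂ (ℤP.+-identityʳ x)
  alternating-sum x (y ∷ ys) (refl , alt) with alternating-sum y ys alt
  ... | inj₁ e = inj₂ (trans (cong (λ t → x + t) e) (ℤP.+-identityʳ x))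
  ... | inj₂ e = inj₁ (trans (cong (λ t → x + t) e) (ℤP.+-inverseʳ x))

  -- An alternating list that starts with -1 sums to 0 or -1, so the total 1 forces the first
  -- nonzero entry to be 1; the fictitious -1 may then be put in front of it.
  good⇒line : ∀ xs → All Entry xs → GoodLine xs → line false xs ≡ true
  good⇒line xs es (alt , total) = alternating⇒line false xs es
    (start (nonzeros xs) (AllP.all-filter (λ x → ¬? (x ≟ + 0)) xs) (AllP.filter⁺ (λ x → ¬? (x ≟ + 0)) es) alt total) total
    where
    start : ∀ ys → All (λ y → ¬ (y ≡ + 0)) ys → All Entry ys → Alternating ys → sumℤ ys ≡ + 1 → Alternating (sign false ∷ ys)
    start []       _         _                         alt total = tt
    start (y ∷ ys) (y≢0 ∷ _) (inj₂ (inj₁ refl) ∷ _)    alt total = contradiction refl y≢0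
    start (y ∷ ys) _         (inj₂ (inj₂ refl) ∷ _)    alt total = refl , alt
    start (y ∷ ys) _         (inj₁ refl ∷ _)           alt total with alternating-sum y ys alt
    ... | inj₁ e with () ← trans (sym total) e
    ... | inj₂ e with () ← trans (sym total) e

  line⇒good : ∀ xs → line false xs ≡ true → GoodLine xs
  line⇒good xs e with nonzeros xs | line⇒alternating false xs e
  ... | []     | _         , total = tt , total
  ... | y ∷ ys | (_ , alt) , total = alt , total

  step-true : ∀ v x {K : Bool → Bool} → step false v x K ≡ true → ∃ λ v' → (∀ (L : Bool → Bool) → step false v x L ≡ L v') × K v' ≡ true
  step-true false (+ 0)           e = false , (λ _ → refl) , e
  step-true false (+ 1)           e = true , (λ _ → refl) , e
  step-true true  (+ 0)           e = true , (λ _ → refl) , e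
  step-true true  -[1+ 0 ]        e = false , (λ _ → refl) , e
  step-true false (+ suc (suc _)) ()
  step-true false -[1+ _ ]        ()
  step-true true  (+ suc _)       ()
  step-true true  -[1+ suc _ ]    ()

  -- Successful steps are described by their effect on every continuation, so that one witness
  -- drives both the recursion in `steps` and that in `line`.
  Steps : ∀ {k} → Vec Bool k → Vector ℤ k → Vec Bool k → Set
  Steps vs r ws = ∀ i (L : Bool → Bool) → step false (lookup vs i) (r i) L ≡ L (lookup ws i)

  steps-true : ∀ {k} (vs : Vec Bool k) r {K} → steps false vs r K ≡ true → ∃ λ ws → Steps vs r ws × K ws ≡ true
  steps-true []       r e = [] , (λ ()) , e
  steps-true (v ∷ vs) r {K} e with step-true v (r zero) e
  ... | w , p , e' with steps-true vs (r ∘ suc) e'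
  ...   | ws , q , e'' = w ∷ ws , (λ { zero → p ; (suc i) → q i }) , e''

  true-steps : ∀ {k} (vs : Vec Bool k) r ws {K} → Steps vs r ws → K ws ≡ true → steps false vs r K ≡ true
  true-steps []       r []       p e = e
  true-steps (v ∷ vs) r (w ∷ ws) {K} p e = trans (p zero (λ v' → steps false vs (r ∘ suc) (λ vs' → K (v' ∷ vs'))))
    (true-steps vs (r ∘ suc) ws {λ vs' → K (w ∷ vs')} (p ∘ suc) e)

  Lines : ∀ {k m} → Vec Bool k → Array k m → Set
  Lines vs A = ∀ i → line (lookup vs i) (tabulate (A i)) ≡ true

  lines⇒steps : ∀ {k m} (vs : Vec Bool k) (A : Array k (suc m)) → Lines vs A →
    ∃ λ ws → Steps vs (λ i → A i zero) ws × Lines ws (λ i j → A i (suc j))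
  lines⇒steps []       A ls = [] , (λ ()) , λ ()
  lines⇒steps (v ∷ vs) A ls with step-true v (A zero zero) (ls zero) | lines⇒steps vs (A ∘ suc) (ls ∘ suc)
  ... | w , p , e | ws , q , es = w ∷ ws , (λ { zero → p ; (suc i) → q i }) , λ { zero → e ; (suc i) → es i }

  steps⇒lines : ∀ {k m} (vs ws : Vec Bool k) (A : Array k (suc m)) → Steps vs (λ i → A i zero) ws →
    Lines ws (λ i j → A i (suc j)) → Lines vs A
  steps⇒lines vs ws A p ls i = trans (p i (λ h → line h (tabulate (λ j → A i (suc j))))) (ls i)

  agree⇒≗ : ∀ {k} (r c : Vector ℤ k) → agree r c ≡ true → ∀ i → r i ≡ c i
  agree⇒≗ {suc k} r c e zero with r zero ≟ c zero
  ... | yes r≡c = r≡c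
  agree⇒≗ {suc k} r c e (suc i) with r zero ≟ c zero
  ... | yes _ = agree⇒≗ (r ∘ suc) (c ∘ suc) e i

  ≗⇒agree : ∀ {k} (r c : Vector ℤ k) → (∀ i → r i ≡ c i) → agree r c ≡ true
  ≗⇒agree {zero}  r c r≗c = refl
  ≗⇒agree {suc k} r c r≗c = cong₂ _∧_ (dec-true (r zero ≟ c zero) (r≗c zero)) (≗⇒agree (r ∘ suc) (c ∘ suc) (r≗c ∘ suc))

  support : ∀ {k} → Vector ℤ k → ℕ
  support r = length (nonzeros (tabulate r))

  spend-true : ∀ d x {K xs} → spend d x K ≡ true → (∀ d' → K d' ≡ true → length (nonzeros xs) ≡ d') → length (nonzeros (x ∷ xs)) ≡ d
  spend-true d       (+ 0)     e h = h d e
  spend-true (suc d) (+ suc _) e h = cong suc (h d e)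
  spend-true (suc d) -[1+ _ ]  e h = cong suc (h d e)

  true-spend : ∀ d x {K xs} → length (nonzeros (x ∷ xs)) ≡ d → (∀ d' → length (nonzeros xs) ≡ d' → K d' ≡ true) → spend d x K ≡ true
  true-spend d       (+ 0)     e h = h d e
  true-spend (suc d) (+ suc _) e h = h d (ℕP.suc-injective e)
  true-spend (suc d) -[1+ _ ]  e h = h d (ℕP.suc-injective e)

  Checked : ∀ {m} → ℕ → Vec Bool m → Matrix m → Set
  Checked d vs A = Symmetric A × Lines vs A × support (λ i → A i i) ≡ d

  ∧-true : ∀ p q → p ∧ q ≡ true → p ≡ true × q ≡ true
  ∧-true true true refl = refl , refl

  -- `chk` updates the sums `vs` along the first row, whereas `Lines` consumes the first column. By
  -- symmetry these have the same entries, so both lead to the same `ws` for the minor.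
  chk⇒Checked : ∀ {m} d (vs : Vec Bool m) A → chk d vs A ≡ true → Checked d vs A
  chk⇒Checked zero [] A e = (λ ()) , (λ ()) , refl
  chk⇒Checked d (v ∷ vs) A e with ∧-true (line v (tabulate (A zero))) _ e
  ... | first , e₁ with ∧-true (agree (λ j → A zero (suc j)) (λ i → A (suc i) zero)) _ e₁
  ...   | agreed , e₂ with steps-true vs (λ j → A zero (suc j)) e₂
  ...     | ws , p , e₃ = symmetric , rows , spend-true d (A zero zero) e₃ (λ d' e' → proj₂ (proj₂ (minor d' e')))
    where
    A⁻ = λ i j → A (suc i) (suc j)
    first-column : ∀ j → A zero (suc j) ≡ A (suc j) zero
    first-column = agree⇒≗ _ _ agreed
    minor : ∀ d' → chk d' ws A⁻ ≡ true → Checked d' ws A⁻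
    minor d' = chk⇒Checked d' ws A⁻
    spent : ∀ d x {K} → spend d x K ≡ true → ∃ λ d' → K d' ≡ true
    spent d       (+ 0)     e = d , e
    spent (suc d) (+ suc _) e = d , e
    spent (suc d) -[1+ _ ]  e = d , e
    checked⁻ : ∃ λ d' → Checked d' ws A⁻
    checked⁻ = let (d' , e') = spent d (A zero zero) e₃ in d' , minor d' e'
    symmetric : Symmetric A
    symmetric zero    zero    = refl
    symmetric zero    (suc j) = first-column j
    symmetric (suc i) zero    = sym (first-column i)
    symmetric (suc i) (suc j) = proj₁ (proj₂ checked⁻) i j
    rows : Lines (v ∷ vs) A
    rows zero    = first
    rows (suc i) = steps⇒lines vs ws (A ∘ suc)
      (λ i L → trans (cong (λ x → step false (lookup vs i) x L) (sym (first-column i))) (p i L))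
      (proj₁ (proj₂ (proj₂ checked⁻))) i

  Checked⇒chk : ∀ {m} d (vs : Vec Bool m) A → Checked d vs A → chk d vs A ≡ true
  Checked⇒chk .0 [] A (_ , _ , refl) = refl
  Checked⇒chk d (v ∷ vs) A (symmetric , rows , diagonals) with lines⇒steps vs (A ∘ suc) (rows ∘ suc)
  ... | ws , p , rows⁻ = cong₂ _∧_ (rows zero) (cong₂ _∧_
    (≗⇒agree (λ j → A zero (suc j)) (λ i → A (suc i) zero) (λ i → symmetric zero (suc i)))
    (true-steps vs (λ j → A zero (suc j)) ws
      (λ i L → trans (cong (λ x → step false (lookup vs i) x L) (symmetric zero (suc i))) (p i L))
      (true-spend d (A zero zero) diagonals (λ d' e →
        Checked⇒chk d' ws (λ i j → A (suc i) (suc j)) ((λ i j → symmetric (suc i) (suc j)) , rows⁻ , e)))))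

  map-allFin : ∀ {k} (r : Vector ℤ k) → map r (allFin k) ≡ tabulate r
  map-allFin r = ListP.map-tabulate id r

  DSASM⇒lines : ∀ {m} {A : Matrix m} → IsDSASM A → Lines (Vec.replicate m false) A
  DSASM⇒lines {m} {A} ((entry , good , _) , _) i rewrite VecP.lookup-replicate i false =
    good⇒line (tabulate (A i)) (AllP.tabulate⁺ (entry i)) (subst GoodLine (map-allFin (A i)) (good i))

  lines⇒DSASM : ∀ {m} {A : Matrix m} → Symmetric A → Lines (Vec.replicate m false) A → IsDSASM A
  lines⇒DSASM {m} {A} symmetric lines = (entry , good , good-column) , symmetric
    where
    line-i : ∀ i → line false (tabulate (A i)) ≡ true
    line-i i = subst (λ h → line h (tabulate (A i)) ≡ true) (VecP.lookup-replicate i false) (lines i)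
    entry : ∀ i j → Entry (A i j)
    entry i = AllP.tabulate⁻ (line⇒entries false (tabulate (A i)) (line-i i))
    good : ∀ i → GoodLine (row A i)
    good i = subst GoodLine (sym (map-allFin (A i))) (line⇒good (tabulate (A i)) (line-i i))
    good-column : ∀ j → GoodLine (col A j)
    good-column j = subst GoodLine (ListP.map-cong (λ i → symmetric j i) (allFin m)) (good j)

  support≡0⇒ : ∀ {k} (r : Vector ℤ k) → support r ≡ 0 → ∀ i → r i ≡ + 0
  support≡0⇒ {suc k} r e i with r zero in eq
  support≡0⇒ {suc k} r e zero    | + 0     = eq
  support≡0⇒ {suc k} r e (suc i) | + 0     = support≡0⇒ (r ∘ suc) e i
  support≡0⇒ {suc k} r () i      | + suc _
  support≡0⇒ {suc k} r () i      | -[1+ _ ]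

  ⇒support≡0 : ∀ {k} (r : Vector ℤ k) → (∀ i → r i ≡ + 0) → support r ≡ 0
  ⇒support≡0 {zero}  r r≗0 = refl
  ⇒support≡0 {suc k} r r≗0 rewrite r≗0 zero = ⇒support≡0 (r ∘ suc) (r≗0 ∘ suc)

  diagonal-support : ∀ {m} (A : Matrix m) → length (nonzeros (diagonal A)) ≡ support (λ i → A i i)
  diagonal-support A = cong (length ∘ nonzeros) (map-allFin (λ i → A i i))

  -- The remainder `m % 2` both selects the case of `DiagCond` and equals the prescribed number of
  -- nonzero diagonal entries.
  diagCond⇒support : ∀ {m} (A : Matrix m) → DiagCond A → support (λ i → A i i) ≡ m % 2
  diagCond⇒support {m} A d with m % 2 | DivMod.m%n<n m 2
  ... | 0 | _ = ⇒support≡0 (λ i → A i i) d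
  ... | 1 | _ = trans (sym (diagonal-support A)) d
  ... | suc (suc _) | ℕ.s≤s (ℕ.s≤s ())

  support⇒diagCond : ∀ {m} (A : Matrix m) → support (λ i → A i i) ≡ m % 2 → DiagCond A
  support⇒diagCond {m} A e with m % 2 | DivMod.m%n<n m 2
  ... | 0 | _ = support≡0⇒ (λ i → A i i) e
  ... | 1 | _ = trans (diagonal-support A) e
  ... | suc (suc _) | ℕ.s≤s (ℕ.s≤s ())

  isOSASM-chk : ∀ {m} (A : Matrix m) → does (isOSASM? A) ≡ chk (m % 2) (Vec.replicate m false) A
  isOSASM-chk {m} A with chk (m % 2) (Vec.replicate m false) A in eq
  ... | true  = dec-true (isOSASM? A) (let (s , l , d) = chk⇒Checked (m % 2) (Vec.replicate m false) A eq in
    lines⇒DSASM s l , support⇒diagCond A d)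
  ... | false = dec-false (isOSASM? A) λ (ds , d) →
    contradiction (trans (sym eq) (Checked⇒chk (m % 2) (Vec.replicate m false) A
      (proj₂ ds , DSASM⇒lines ds , diagCond⇒support A d))) λ ()

  OSASM-length : ∀ m → m % 2 ≡ 1 → + length (OSASM m) ≡ Z₁ (units m)
  OSASM-length m m-odd = begin
    + length (OSASM m)
      ≡⟨ length-∑ (OSASM m) ⟩
    ∑ (OSASM m) (λ _ → + 1)
      ≡⟨ ∑-filter isOSASM? (allMatrices m) (λ _ → + 1) ⟩
    ∑ (allMatrices m) (λ A → 𝟙 (does (isOSASM? A)) * + 1)
      ≡⟨ ∑-cong (allMatrices m) (λ A → trans (ℤP.*-identityʳ (𝟙 (does (isOSASM? A))))
           (cong 𝟙 (trans (isOSASM-chk A) (cong (λ d → chk d (Vec.replicate m false) A) m-odd)))) ⟩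
    ∑ (allMatrices m) (λ A → 𝟙 (chk 1 (Vec.replicate m false) A))
      ≡⟨ Z₁-∑ m ⟩
    Z₁ (units m) ∎

  XO-Z₀ : ∀ m → suc m % 2 ≡ 0 → XO m (+ 1) (- (+ 1)) ≡ Z₀ (ω ∷ units m)
  XO-Z₀ m m-even = begin
    XO m (+ 1) (- (+ 1))
      ≡⟨ ∑-filter isOSASM? (allMatrices (suc m)) (λ A → (+ 1) ^ R A * -[1+ 0 ] ^ T A) ⟩
    ∑ (allMatrices (suc m)) (λ A → 𝟙 (does (isOSASM? A)) * ((+ 1) ^ R A * -[1+ 0 ] ^ T A))
      ≡⟨ ∑-cong (allMatrices (suc m)) (λ A → cong₂ _*_
           (cong 𝟙 (trans (isOSASM-chk A) (cong (λ d → chk d (Vec.replicate (suc m) false) A) m-even)))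
           (trans (cong (_* -[1+ 0 ] ^ T A) (ℤP.^-zeroˡ (R A))) (ℤP.*-identityˡ (-[1+ 0 ] ^ T A)))) ⟩
    ∑ (allMatrices (suc m)) (λ A → 𝟙 (chk 0 (Vec.replicate (suc m) false) A) * -[1+ 0 ] ^ T A)
      ≡⟨ Z₀-∑ m ⟩
    Z₀ (ω ∷ units m) ∎

open import Data.Nat using (ℕ; suc; _*_; _%_)
import Data.Nat as ℕ
import Data.Nat.DivMod as DivMod
import Data.Nat.Properties as ℕP
open import Data.Integer using (+_; -_) renaming (_*_ to _*ℤ_; _^_ to _^ℤ_)
open import Data.List using (length; _∷_)
open import Relation.Binary.PropositionalEquality using (_≡_; cong; trans; module ≡-Reasoning)
open SixVertex
open ≡-Reasoning

theorem4p3 : (n : ℕ) →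
    + length (OSASM (suc (2 * n))) ≡ ((+ 2) ^ℤ (2 * n)) *ℤ XO (suc (2 * n)) (+ 1) (- (+ 1))
theorem4p3 n = begin
  + length (OSASM (suc (2 * n)))
    ≡⟨ OSASM-length (suc (2 * n)) (parity 1) ⟩
  Z₁ (units (suc (2 * n)))
    ≡⟨ cong (λ k → Z₁ (units (suc k))) double ⟩
  Z₁ (units (suc (n ℕ.+ n)))
    ≡⟨ units-relation n ⟩
  (+ 2) ^ℤ (n ℕ.+ n) *ℤ Z₀ (ω ∷ units (suc (n ℕ.+ n)))
    ≡⟨ cong (λ k → (+ 2) ^ℤ k *ℤ Z₀ (ω ∷ units (suc k))) double ⟨
  (+ 2) ^ℤ (2 * n) *ℤ Z₀ (ω ∷ units (suc (2 * n)))
    ≡⟨ cong ((+ 2) ^ℤ (2 * n) *ℤ_) (XO-Z₀ (suc (2 * n)) (parity 2)) ⟨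
  (+ 2) ^ℤ (2 * n) *ℤ XO (suc (2 * n)) (+ 1) (- (+ 1)) ∎
  where
  double : 2 * n ≡ n ℕ.+ n
  double = cong (n ℕ.+_) (ℕP.+-identityʳ n)
  parity : ∀ k → (k ℕ.+ 2 * n) % 2 ≡ k % 2
  parity k = trans (cong (λ t → (k ℕ.+ t) % 2) (ℕP.*-comm 2 n)) (DivMod.[m+kn]%n≡m%n k n 2)
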